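{- Let $\lambda$ be a partition and $M\in\mathrm{MLQ}(\lambda,n)$. Then $\mathrm{maj}(M)=\mathrm{charge}(\rho_Q(M))$.
   Context: A multiline queue of shape $\lambda$ on $n$ columns is a tuple $M=(B_1,\dots,B_L)$, $L=\lambda_1$, of subsets of $[n]$ with $|B_r|=\lambda'_r$, drawn with rows $1..L$ bottom to top, columns $1..n$ left to right, a ball at $(r,j)$ iff $j\in B_r$; the set is $\mathrm{MLQ}(\lambda,n)$. Ferrari–Martin labelling and major index: for $r=L,\dots,2$, unlabelled balls of row $r$ get label $r$; then the balls of row $r$, in order of decreasing label and left to right among equal labels, are each paired with the first not yet labelled ball of row $r-1$ weakly to their right, cyclically (from column $n$ back to column $1$), which receives the same label; a pairing wraps if the reached column is strictly smaller than the starting column. $\mathrm{maj}(M)=\sum(\ell-r+1)$ over all wrapping pairings, where $\ell$ is the label and $r$ the starting row. Collapsing: $\mathrm{cw}(M)$ records row numbers of balls scanning columns left to right, each column top to bottom. For $i\ge1$, $\mathrm{Par}_i(w)$ writes "(" for each $i+1$ and ")" for each $i$ in the word $w$ read left to right and matches parentheses iteratively when an "(" is immediately followed by ")" or separated from it only by matched parentheses; a ball of row $i+1$ is unmatched above if its letter is unmatched in $\mathrm{Par}_i(\mathrm{cw}(M))$. $e_i^\star$ moves all balls of row $i+1$ that are unmatched above to row $i$ (same column). Operators compose right to left, $e^\star_{[a,b]}=e^\star_a\cdots e^\star_b$. For $0\le k\le L$ let $c^{(k)}_r$ be the number of balls in row $r$ of $e^\star_{[1,k-1]}\cdots e^\star_{[1,1]}(M)$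 for $r\le k$ (for $k=1$ this is $M$), and $0$ for $r>k$. The recording tableau $\rho_Q(M)$ is the French-notation filling whose row $r$ (from the bottom) consists of $c^{(k)}_r-c^{(k-1)}_r$ entries equal to $k$, $k=1,\dots,L$, in increasing order; it is a semistandard tableau with content $\lambda'$. Charge: for a permutation $\tau$ of $[k]$, $\mathrm{charge}(\tau)=\sum_{i\in[k-1],\,\tau^{ -1}(i)<\tau^{ -1}(i+1)}(k-i)$. For a word $w$ with partition content and largest letter $k$, extract $w^{(1)}$ by taking the first occurrence of $k$, then the next occurrence of $k-1$ to its right, …, down to $1$, returning cyclically to the start of $w$ when needed; $w^{(1)}$ (letters in their order in $w$) is a permutation of $[k]$; remove it and repeat to get $w^{(2)},\dots$; $\mathrm{charge}(w)=\sum_j\mathrm{charge}(w^{(j)})$. For a semistandard tableau $T$ (French notation), $\mathrm{charge}(T)$ is the charge of its row reading word (rows from top to bottom, each read left to right). -}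

module Defs where

open import Data.Nat.Base using (ℕ; zero; suc; pred; _+_; _∸_; _⊔_; _≤_; _≥_; _≤ᵇ_; _<ᵇ_; _≡ᵇ_)
open import Data.Bool.Base using (Bool; true; false; if_then_else_; _∧_; _∨_; not)
open import Data.List.Base using (List; []; _∷_; _++_; map; concat; concatMap; foldr; length; reverse; replicate; upTo; downFrom)
open import Data.Nat.ListAction using (sum)
open import Data.Maybe.Base using (Maybe; just; nothing)
open import Data.Product.Base using (_×_; _,_; proj₁; proj₂)
open import Data.Fin.Base using (Fin; toℕ)
open import Data.Vec.Base as Vec using (Vec)
open import Data.Fin.Subset using (Subset; ∣_∣)
open import Data.List.Relation.Unary.All using (All)
open import Data.List.Relation.Unary.Linked using (Linked)
open import Relation.Binary.PropositionalEquality using (_≡_)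

IsPartition : List ℕ → Set
IsPartition p = Linked _≥_ p × All (λ x → 1 ≤ x) p

largestPart : List ℕ → ℕ
largestPart = foldr _⊔_ 0

countᵇ : {A : Set} → (A → Bool) → List A → ℕ
countᵇ f [] = 0
countᵇ f (x ∷ xs) = (if f x then 1 else 0) + countᵇ f xs

filterᵇ : {A : Set} → (A → Bool) → List A → List A
filterᵇ f [] = []
filterᵇ f (x ∷ xs) = if f x then x ∷ filterᵇ f xs else filterᵇ f xs

conj : List ℕ → ℕ → ℕ
conj p r = countᵇ (λ x → r ≤ᵇ x) p

-- Multiline queues
-- M = (B_1,…,B_L), L = λ₁, B_r ⊆ [n] encoded as a Subset n;
-- the Vec index r : Fin L stands for row (toℕ r + 1); column j ∈ [n] is Fin index j-1.

MLQConfig : ℕ → ℕ → Set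
MLQConfig L n = Vec (Subset n) L

IsMLQ : (p : List ℕ) (n : ℕ) → MLQConfig (largestPart p) n → Set
IsMLQ p n M = (r : Fin (largestPart p)) → ∣ Vec.lookup M r ∣ ≡ conj p (suc (toℕ r))

-- Internal representation: list of rows, bottom (row 1) to top (row L),
-- each row a list of n booleans (column 1 first).
Rows : Set
Rows = List (List Bool)

toRows : {L n : ℕ} → MLQConfig L n → Rows
toRows M = Vec.toList (Vec.map Vec.toList M)

posFrom : ℕ → List Bool → List ℕ
posFrom i [] = []
posFrom i (true ∷ bs) = i ∷ posFrom (suc i) bs
posFrom i (false ∷ bs) = posFrom (suc i) bs

positions : List Bool → List ℕ
positions = posFrom 0

memℕ : ℕ → List ℕ → Bool
memℕ x [] = false
memℕ x (y ∷ ys) = (x ≡ᵇ y) ∨ memℕ x ys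

-- Ferrari–Martin labelling and the major index

-- a labelled ball: (column, label)
Lab : Set
Lab = ℕ × ℕ

labBefore : Lab → Lab → Bool
labBefore (c₁ , l₁) (c₂ , l₂) = (l₂ <ᵇ l₁) ∨ ((l₁ ≡ᵇ l₂) ∧ (c₁ <ᵇ c₂))

insertLab : Lab → List Lab → List Lab
insertLab x [] = x ∷ []
insertLab x (y ∷ ys) = if labBefore x y then x ∷ y ∷ ys else y ∷ insertLab x ys

sortLab : List Lab → List Lab
sortLab = foldr insertLab []

firstGeq : ℕ → List ℕ → Maybe ℕ
firstGeq c [] = nothing
firstGeq c (j ∷ js) = if c ≤ᵇ j then just j else firstGeq c js

-- first free ball weakly right of column c, cyclically; the Bool says
-- whether the pairing wraps (reached column strictly smaller than c)
findTarget : ℕ → List ℕ → Maybe (ℕ × Bool)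
findTarget c free with firstGeq c free
... | just j = just (j , false)
... | nothing with free
...   | [] = nothing
...   | j ∷ _ = just (j , true)

-- pair the (sorted) labelled balls of row r with row r-1 (given as booleans);
-- acc = already labelled balls of row r-1. Returns labelled balls of row r-1
-- and the contribution (ℓ - r + 1) of wrapping pairings.
pairAll : ℕ → List Lab → List Bool → List Lab → List Lab × ℕ
pairAll r [] row' acc = acc , 0
pairAll r ((c , ℓ) ∷ rest) row' acc
  with findTarget c (filterᵇ (λ j → not (memℕ j (map proj₁ acc))) (positions row'))
... | nothing = pairAll r rest row' acc
... | just (j , w) with pairAll r rest row' (acc ++ ((j , ℓ) ∷ []))
...   | (acc' , m) = acc' , ((if w then ℓ + 1 ∸ r else 0) + m)

-- majGo r partial (row_r ∷ row_{r-1} ∷ … ∷ row_1):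
-- partial = balls of row r already labelled from above.
majGo : ℕ → List Lab → Rows → ℕ
majGo r partial [] = 0
majGo r partial (row ∷ []) = 0
majGo r partial (row ∷ row' ∷ rest) =
  let complete = partial ++ map (λ c → (c , r))
                   (filterᵇ (λ c → not (memℕ c (map proj₁ partial))) (positions row))
      res = pairAll r (sortLab complete) row' []
  in proj₂ res + majGo (pred r) (proj₁ res) (row' ∷ rest)

majRows : Rows → ℕ
majRows rows = majGo (length rows) [] (reverse rows)

maj : {L n : ℕ} → MLQConfig L n → ℕ
maj M = majRows (toRows M)

lookupB : List Bool → ℕ → Bool
lookupB [] _ = false
lookupB (b ∷ bs) zero = b
lookupB (b ∷ bs) (suc j) = lookupB bs j

lookupRow : Rows → ℕ → List Bool
lookupRow [] _ = []
lookupRow (x ∷ xs) zero = x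
lookupRow (x ∷ xs) (suc i) = lookupRow xs i

-- ball in row r (1-based) and column j (0-based)
ball : Rows → ℕ → ℕ → Bool
ball rows r j = lookupB (lookupRow rows (pred r)) j

-- cw(M): letters (row , column), columns left to right, each top to bottom
cw : ℕ → Rows → List (ℕ × ℕ)
cw n rows = concatMap (λ j → concatMap (λ k → if ball rows (suc k) j then (suc k , j) ∷ [] else [])
                                           (downFrom (length rows)))
                      (upTo n)

-- Par_i: true = "(" (a letter i+1), false = ")" (a letter i); column kept
parWord : ℕ → List (ℕ × ℕ) → List (Bool × ℕ)
parWord i [] = []
parWord i ((r , j) ∷ w) =
  if r ≡ᵇ suc i then (true , j) ∷ parWord i w
  else (if r ≡ᵇ i then (false , j) ∷ parWord i w else parWord i w)

removePair : List (Bool × ℕ) → Maybe (List (Bool × ℕ))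
removePair [] = nothing
removePair (x ∷ xs) = go x xs
  where
  go : Bool × ℕ → List (Bool × ℕ) → Maybe (List (Bool × ℕ))
  go x [] = nothing
  go x (y ∷ ys) with proj₁ x ∧ not (proj₁ y)
  ... | true = just ys
  ... | false with go y ys
  ...   | nothing = nothing
  ...   | just zs = just (x ∷ zs)

-- iterate matching until no more pairs (fuel = word length suffices)
matchLoop : ℕ → List (Bool × ℕ) → List (Bool × ℕ)
matchLoop zero u = u
matchLoop (suc f) u with removePair u
... | nothing = u
... | just u' = matchLoop f u'

unmatchedAbove : ℕ → ℕ → Rows → List ℕ
unmatchedAbove n i rows =
  let u = parWord i (cw n rows)
  in map proj₂ (filterᵇ proj₁ (matchLoop (length u) u))

setCols : Bool → List ℕ → List Bool → List Bool
setCols v cs bs = go 0 bs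
  where
  go : ℕ → List Bool → List Bool
  go j [] = []
  go j (b ∷ bs') = (if memℕ j cs then v else b) ∷ go (suc j) bs'

updateAt : {A : Set} → ℕ → (A → A) → List A → List A
updateAt _ f [] = []
updateAt zero f (x ∷ xs) = f x ∷ xs
updateAt (suc i) f (x ∷ xs) = x ∷ updateAt i f xs

-- e*_i (i ≥ 1): rows are 1-based, list index = row - 1
eStar : ℕ → ℕ → Rows → Rows
eStar n i rows =
  let cs = unmatchedAbove n i rows
  in updateAt i (setCols false cs) (updateAt (pred i) (setCols true cs) rows)

eInt : ℕ → ℕ → Rows → Rows
eInt n zero rows = rows
eInt n (suc m) rows = eInt n m (eStar n (suc m) rows)

-- D_k = e*_{[1,k-1]} ⋯ e*_{[1,1]}(M)  (D_1 = M; D_0 unused)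
collapseStage : ℕ → ℕ → Rows → Rows
collapseStage n zero rows = rows
collapseStage n (suc zero) rows = rows
collapseStage n (suc (suc k)) rows = eInt n (suc k) (collapseStage n (suc k) rows)

cnt : ℕ → Rows → ℕ → ℕ → ℕ
cnt n rows k r = if r ≤ᵇ k then countᵇ (λ b → b) (lookupRow (collapseStage n k rows) (pred r)) else 0

-- recording tableau: list of rows, bottom (row 1) to top (row L)
recRows : ℕ → Rows → List (List ℕ)
recRows n rows =
  let L = length rows
  in map (λ i → let r = suc i in
            concatMap (λ j → let k = suc j in replicate (cnt n rows k r ∸ cnt n rows j r) k) (upTo L))
         (upTo L)

ρQ : {L n : ℕ} → MLQConfig L n → List (List ℕ)
ρQ {n = n} M = recRows n (toRows M)

indexOf : ℕ → List ℕ → ℕ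
indexOf x [] = 0
indexOf x (y ∷ ys) = if x ≡ᵇ y then 0 else suc (indexOf x ys)

-- charge of a permutation τ of [k] (given as the word τ(1)…τ(k))
chargePerm : List ℕ → ℕ
chargePerm τ =
  let k = length τ
  in sum (map (λ j → let i = suc j in
                 if indexOf i τ <ᵇ indexOf (suc i) τ then k ∸ i else 0)
              (upTo (k ∸ 1)))

-- indexed words: (position , letter)
IWord : Set
IWord = List (ℕ × ℕ)

maxLetter : IWord → ℕ
maxLetter = foldr (λ x m → proj₂ x ⊔ m) 0

firstOcc : ℕ → IWord → Maybe ℕ
firstOcc m [] = nothing
firstOcc m ((p , a) ∷ xs) = if a ≡ᵇ m then just p else firstOcc m xs

firstOccAfter : ℕ → ℕ → IWord → Maybe ℕ
firstOccAfter m q [] = nothing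
firstOccAfter m q ((p , a) ∷ xs) = if (a ≡ᵇ m) ∧ (q <ᵇ p) then just p else firstOccAfter m q xs

nextOcc : ℕ → ℕ → IWord → Maybe ℕ
nextOcc m q w with firstOccAfter m q w
... | just p = just p
... | nothing = firstOcc m w

selectDown : ℕ → ℕ → IWord → Maybe (List ℕ)
selectDown zero q w = just []
selectDown (suc m) q w with nextOcc (suc m) q w
... | nothing = nothing
... | just p with selectDown m p w
...   | nothing = nothing
...   | just ps = just (p ∷ ps)

extractPos : IWord → Maybe (List ℕ)
extractPos w with firstOcc (maxLetter w) w
... | nothing = nothing
... | just p with selectDown (pred (maxLetter w)) p w
...   | nothing = nothing
...   | just ps = just (p ∷ ps)

chargeGo : ℕ → IWord → ℕ
chargeGo zero w = 0
chargeGo (suc f) w with extractPos w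
... | nothing = 0
... | just ps =
  chargePerm (map proj₂ (filterᵇ (λ x → memℕ (proj₁ x) ps) w))
  + chargeGo f (filterᵇ (λ x → not (memℕ (proj₁ x) ps)) w)

indexWord : List ℕ → IWord
indexWord w = go 0 w
  where
  go : ℕ → List ℕ → IWord
  go i [] = []
  go i (a ∷ as) = (i , a) ∷ go (suc i) as

chargeWord : List ℕ → ℕ
chargeWord w = chargeGo (length w) (indexWord w)

-- row reading word of a French tableau (rows given bottom to top):
-- rows from top to bottom, each left to right
readingWord : List (List ℕ) → List ℕ
readingWord T = concat (reverse T)

chargeTableau : List (List ℕ) → ℕ
chargeTableau T = chargeWord (readingWord T)

{-# OPTIONS --safe #-}
{-
For a threshold t, read a word from left to right as service orders for queues in series: a letter t
lets a customer enter queue t - 1, a letter k < t moves a customer from queue k to queue k - 1, and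
larger letters do nothing.  The resulting map on queue lengths depends only on the plactic class of the
word, since only adjacent letters interact.  Let F_t be the total length of its least pre-fixed state.

Both statistics are the sum of the F_t.  A pairing that wraps from row r with label l contributes
l - r + 1, one for every threshold r ≤ t ≤ l, and for each t the wrapping customers are exactly those
in the queues at the end of a sweep.  The order in which customers are paired is irrelevant: removing
one customer together with its ball lowers the least state by the number of wraps of its pairing.  This
covers Ferrari–Martin pairing (row by row) as well as charge extraction (path by path), with cw(M) and
the reading word as the words.

It remains to see that the reading word of the recording tableau is plactically equivalent to cw(M).
By row insertion cw(M) is equivalent to the reading word of some tableau T; the operators e*_i respect
the Knuth relations, so the recording tableau may be computed from T, where stage k of collapsing simply
replaces every entry ≤ k of row r by r, so that the recording tableau is T itself.
-}
module Submission where

open import Defs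
open import Data.Nat.Base
open import Data.Nat.Properties
open import Data.Nat.ListAction using (sum)
open import Data.Nat.Solver using (module +-*-Solver)
open import Data.Bool.Base using (Bool; true; false; if_then_else_; _∧_; _∨_; not)
open import Data.Bool.Properties using (T-≡; ∧-zeroʳ; ∧-identityʳ; ∨-identityʳ; ∨-zeroʳ; ∨-comm)
open import Data.List.Base using (List; []; _∷_; _++_; map; concat; concatMap; length; reverse; replicate; upTo; downFrom; applyUpTo; [_])
open import Data.List.Properties using (++-assoc; ++-identityʳ; map-++; length-++; map-cong; unfold-reverse; length-map; concat-++; map-upTo; applyUpTo-∷ʳ)
open import Data.List.Relation.Unary.All using (All; []; _∷_)
open import Data.List.Relation.Unary.All.Properties using (++⁺; ++⁻ˡ; ++⁻ʳ; map⁺; map⁻)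
import Data.List.Relation.Unary.All as All
open import Data.List.Relation.Unary.AllPairs as AllPairs using (AllPairs; []; _∷_)
open import Data.List.Relation.Binary.Pointwise.Base using (Pointwise; []; _∷_)
open import Data.List.Relation.Unary.Linked using (Linked; []; [-]; _∷_)
import Data.List.Relation.Unary.AllPairs.Properties as AllPairsₚ
open import Data.Vec.Properties using (length-toList)
open import Data.Maybe.Base as Maybe using (Maybe; just; nothing)
open import Data.Product.Base using (∃; ∃₂; _×_; _,_; proj₁; proj₂)
open import Data.Sum.Base using (_⊎_; inj₁; inj₂)
open import Data.Unit.Base using (⊤; tt)
open import Data.Fin.Base using (toℕ; zero; suc)
open import Data.Fin.Subset using (∣_∣; Subset)
open import Data.Vec.Base as Vec using (Vec; []; _∷_)
open import Function.Base using (_∘_; _∋_; id; case_of_)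
open import Function.Bundles using (module Equivalence)
open import Relation.Nullary using (¬_; yes; no; contradiction)
open import Relation.Binary.Definitions using (tri<; tri≈; tri>)
open import Relation.Binary.PropositionalEquality using (_≡_; _≢_; refl; sym; trans; cong; cong₂; subst; subst₂; module ≡-Reasoning)

-- The plactic action on queues

-- A cyclic pairing is made linear by guessing how many customers wrap: a sweep starts with `q`
-- customers already waiting, and the guess is consistent if at most `q` are left at the end. The
-- least consistent guess depends only on the map on queue lengths, not on columns or labels, which
-- is what lets Knuth equivalence act. Both words are brought to the common form `gridWord B L n`;
-- for a reading word each column holds a single letter.
--
-- Two orders of computation have to be reconciled. A word is read column by column, while pairings
-- descend row by row; `sweep-∷` exchanges the two, and monotonicity turns the rowwise least choices
-- into the least state.
--
-- Labels disappear once `t` is fixed: balls with label at least `t` are paired before all others,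
-- hence as if the others were absent. Removing a customer is harmless to the rest because queues
-- are anonymous: only lengths are recorded, so a free ball may be credited to any customer that
-- reaches it.

infix 4 _~_

data _~_ : List ℕ → List ℕ → Set where
  ~refl  : ∀ {u} → u ~ u
  ~sym   : ∀ {u v} → u ~ v → v ~ u
  ~trans : ∀ {u v w} → u ~ v → v ~ w → u ~ w
  ~cons  : ∀ a {u v} → u ~ v → a ∷ u ~ a ∷ v
  knuth₁ : ∀ {x y z} v → x < y → y ≤ z → y ∷ z ∷ x ∷ v ~ y ∷ x ∷ z ∷ v
  knuth₂ : ∀ {x y z} v → x ≤ y → y < z → x ∷ z ∷ y ∷ v ~ z ∷ x ∷ y ∷ v

~reflexive : ∀ {u v} → u ≡ v → u ~ v
~reflexive refl = ~refl

~++ˡ : ∀ u {v w} → v ~ w → u ++ v ~ u ++ w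
~++ˡ []      e = e
~++ˡ (a ∷ u) e = ~cons a (~++ˡ u e)

~++ʳ : ∀ {u v} w → u ~ v → u ++ w ~ v ++ w
~++ʳ w ~refl           = ~refl
~++ʳ w (~sym e)        = ~sym (~++ʳ w e)
~++ʳ w (~trans e f)    = ~trans (~++ʳ w e) (~++ʳ w f)
~++ʳ w (~cons a e)     = ~cons a (~++ʳ w e)
~++ʳ w (knuth₁ v p q)  = knuth₁ (v ++ w) p q
~++ʳ w (knuth₂ v p q)  = knuth₂ (v ++ w) p q

-- A state lists the lengths of queues in series; serve 0 is an arrival at the first queue and
-- serve (suc i) moves one customer from the i-th queue (if any) to the next one.
serve : ℕ → List ℕ → List ℕ
serve zero          []           = []
serve zero          (p ∷ ps)     = suc p ∷ ps
serve (suc zero)    []           = []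
serve (suc zero)    (zero ∷ ps)  = zero ∷ ps
serve (suc zero)    (suc p ∷ ps) = p ∷ serve zero ps
serve (suc (suc i)) []           = []
serve (suc (suc i)) (p ∷ ps)     = p ∷ serve (suc i) ps

serve-comm : ∀ i k ps → serve i (serve (2 + i + k) ps) ≡ serve (2 + i + k) (serve i ps)
serve-comm zero          k []           = refl
serve-comm zero          k (p ∷ ps)     = refl
serve-comm (suc zero)    k []           = refl
serve-comm (suc zero)    k (zero ∷ ps)  = refl
serve-comm (suc zero)    k (suc p ∷ ps) = cong (p ∷_) (serve-comm zero k ps)
serve-comm (suc (suc i)) k []           = refl
serve-comm (suc (suc i)) k (p ∷ ps)     = cong (p ∷_) (serve-comm (suc i) k ps)

-- `serve i` feeds the queue that `serve (suc i)` drains. If the first feeding succeeds, the fed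
-- queue is nonempty (or lies beyond the end of the list, where draining does nothing), so the drain
-- has the same effect before or after the second feeding. If it fails, the second one fails too,
-- since draining leaves the source alone.
serve-iij : ∀ i ps → serve (suc i) (serve i (serve i ps)) ≡ serve i (serve (suc i) (serve i ps))
serve-iij zero          []                 = refl
serve-iij zero          (p ∷ ps)           = refl
serve-iij (suc zero)    []                 = refl
serve-iij (suc zero)    (zero ∷ [])        = refl
serve-iij (suc zero)    (zero ∷ zero ∷ ps) = refl
serve-iij (suc zero)    (zero ∷ suc _ ∷ ps) = refl
serve-iij (suc zero)    (suc zero ∷ [])        = refl
serve-iij (suc zero)    (suc (suc p) ∷ [])        = refl
serve-iij (suc zero)    (suc zero ∷ q ∷ ps) = refl
serve-iij (suc zero)    (suc (suc p) ∷ q ∷ ps) = refl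
serve-iij (suc (suc i)) []                 = refl
serve-iij (suc (suc i)) (p ∷ ps)           = cong (p ∷_) (serve-iij (suc i) ps)

-- A nonempty queue can give up a customer before it is fed as well as after; an empty one wastes
-- exactly one of the two drains in either order.
serve-jij : ∀ i ps → serve (suc i) (serve i (serve (suc i) ps)) ≡ serve (suc i) (serve (suc i) (serve i ps))
serve-jij zero          []                 = refl
serve-jij zero          (zero ∷ ps)        = refl
serve-jij zero          (suc p ∷ ps)       = refl
serve-jij (suc zero)    []                 = refl
serve-jij (suc zero)    (zero ∷ [])        = refl
serve-jij (suc zero)    (suc p ∷ [])       = refl
serve-jij (suc zero)    (zero ∷ zero ∷ ps) = refl
serve-jij (suc zero)    (zero ∷ suc q ∷ ps) = refl
serve-jij (suc zero)    (suc p ∷ zero ∷ ps) = refl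
serve-jij (suc zero)    (suc p ∷ suc q ∷ ps) = refl
serve-jij (suc (suc i)) []                 = refl
serve-jij (suc (suc i)) (p ∷ ps)           = cong (p ∷_) (serve-jij (suc i) ps)

-- With threshold t, letter t is the arrival, letter k < t the (t ∸ k)-th service, and larger letters act trivially.
letterAct : ℕ → ℕ → List ℕ → List ℕ
letterAct t a ps with a ≤? t
... | yes _ = serve (t ∸ a) ps
... | no  _ = ps

act : ℕ → List ℕ → List ℕ → List ℕ
act t []      ps = ps
act t (a ∷ w) ps = act t w (letterAct t a ps)

letterAct-≤ : ∀ {t a} ps → a ≤ t → letterAct t a ps ≡ serve (t ∸ a) ps
letterAct-≤ {t} {a} ps a≤t with a ≤? t
... | yes _ = refl
... | no a≰t = contradiction a≤t a≰t

letterAct-> : ∀ {t a} ps → t < a → letterAct t a ps ≡ ps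
letterAct-> {t} {a} ps t<a with a ≤? t
... | yes a≤t = contradiction t<a (≤⇒≯ a≤t)
... | no _ = refl

∸-far : ∀ {t x z} → 2 + x ≤ z → z ≤ t → t ∸ x ≡ 2 + (t ∸ z) + (z ∸ (2 + x))
∸-far {t} {x} {z} h z≤t = begin
  t ∸ x                              ≡⟨ cong (_∸ x) (sym (m∸n+n≡m z≤t)) ⟩
  (t ∸ z + z) ∸ x                    ≡⟨ cong (λ m → (t ∸ z + m) ∸ x) (sym (m+[n∸m]≡n h)) ⟩
  (t ∸ z + (2 + x + e)) ∸ x          ≡⟨ cong (_∸ x) (solve 3 (λ a b c → a :+ (con 2 :+ b :+ c) := b :+ (con 2 :+ a :+ c)) refl (t ∸ z) x e) ⟩
  (x + (2 + (t ∸ z) + e)) ∸ x        ≡⟨ m+n∸m≡n x _ ⟩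
  2 + (t ∸ z) + e                    ∎
  where
  open ≡-Reasoning
  open +-*-Solver
  e = z ∸ (2 + x)

letterAct-far : ∀ {t x z} ps → 2 + x ≤ z → letterAct t x (letterAct t z ps) ≡ letterAct t z (letterAct t x ps)
letterAct-far {t} {x} {z} ps h with z ≤? t
... | no _ = refl
... | yes z≤t
  rewrite letterAct-≤ {t} {x} ps (≤-trans (≤-trans (m≤n+m x 2) h) z≤t)
        | letterAct-≤ {t} {x} (serve (t ∸ z) ps) (≤-trans (≤-trans (m≤n+m x 2) h) z≤t)
        | ∸-far {t} h z≤t = sym (serve-comm (t ∸ z) (z ∸ (2 + x)) ps)

suc-∸ : ∀ {t x} → suc x ≤ t → t ∸ x ≡ suc (t ∸ suc x)
suc-∸ {suc t} {x} (s≤s h) = +-∸-assoc 1 h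

letterAct-near₁ : ∀ t x ps → let z = suc x in
  letterAct t x (letterAct t z (letterAct t z ps)) ≡ letterAct t z (letterAct t x (letterAct t z ps))
letterAct-near₁ t x ps with suc x ≤? t
... | no _ = refl
... | yes z≤t
  rewrite letterAct-≤ {t} {x} (serve (t ∸ suc x) (serve (t ∸ suc x) ps)) (<⇒≤ z≤t)
        | letterAct-≤ {t} {x} (serve (t ∸ suc x) ps) (<⇒≤ z≤t) | suc-∸ z≤t = serve-iij (t ∸ suc x) ps

letterAct-near₂ : ∀ t x ps → let z = suc x in
  letterAct t x (letterAct t z (letterAct t x ps)) ≡ letterAct t x (letterAct t x (letterAct t z ps))
letterAct-near₂ t x ps with suc x ≤? t
... | no _ = refl
... | yes z≤t
  rewrite letterAct-≤ {t} {x} ps (<⇒≤ z≤t)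
        | letterAct-≤ {t} {x} (serve (t ∸ suc x) (serve (t ∸ x) ps)) (<⇒≤ z≤t)
        | letterAct-≤ {t} {x} (serve (t ∸ suc x) ps) (<⇒≤ z≤t)
        | letterAct-≤ {t} {x} (serve (t ∸ x) (serve (t ∸ suc x) ps)) (<⇒≤ z≤t)
        | suc-∸ z≤t = serve-jij (t ∸ suc x) ps

-- In a Knuth relation `x` and `z` trade places next to `y`. If `2 + x ≤ z` their actions commute by
-- themselves; otherwise `z` is `suc x`, `y` equals one of the two, and an identity between adjacent
-- services remains.
act-~ : ∀ t {u v} → u ~ v → ∀ ps → act t u ps ≡ act t v ps
act-~ t ~refl        ps = refl
act-~ t (~sym e)     ps = sym (act-~ t e ps)
act-~ t (~trans e f) ps = trans (act-~ t e ps) (act-~ t f ps)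
act-~ t (~cons a e)  ps = act-~ t e (letterAct t a ps)
act-~ t (knuth₁ {x} {y} {z} v x<y y≤z) ps with m≤n⇒m<n∨m≡n (≤-trans x<y y≤z)
... | inj₁ far  = cong (act t v) (letterAct-far (letterAct t y ps) far)
... | inj₂ refl with ≤-antisym y≤z x<y
...   | refl = cong (act t v) (letterAct-near₁ t x ps)
act-~ t (knuth₂ {x} {y} {z} v x≤y y<z) ps with m≤n⇒m<n∨m≡n (≤-trans (s≤s x≤y) y<z)
... | inj₁ far  = cong (act t v ∘ letterAct t y) (sym (letterAct-far ps far))
... | inj₂ refl with ≤-antisym (s≤s⁻¹ y<z) x≤y
...   | refl = cong (act t v) (letterAct-near₂ t x ps)

act-++ : ∀ t u v ps → act t (u ++ v) ps ≡ act t v (act t u ps)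
act-++ t []      v ps = refl
act-++ t (a ∷ u) v ps = act-++ t u v (letterAct t a ps)

-- Collapsing operators on words

data Side (i : ℕ) : ℕ → Set where
  close : Side i i
  open′ : Side i (suc i)
  other : ∀ {a} → a ≢ i → a ≢ suc i → Side i a

side : ∀ i a → Side i a
side i a with a ≟ i | a ≟ suc i
... | yes refl | _        = close
... | no _     | yes refl = open′
... | no p     | no q     = other p q

pendingStep : ∀ {i a} → Side i a → ℕ → ℕ
pendingStep close       q = suc q
pendingStep open′       q = pred q
pendingStep (other _ _) q = q

letterStep : ∀ {i a} → Side i a → ℕ → ℕ
letterStep {i}         close       q       = i
letterStep {i}         open′       zero    = i
letterStep {i}         open′       (suc q) = suc i
letterStep {i} {a}     (other _ _) q       = a

-- The word is read from right to left; the counter holds the number of letters i not yet matched,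
-- and a letter i + 1 that finds none is lowered to i.
pending : ℕ → ℕ → List ℕ → ℕ
pending i q []      = q
pending i q (a ∷ w) = pendingStep (side i a) (pending i q w)

raise : ℕ → ℕ → List ℕ → List ℕ
raise i q []      = []
raise i q (a ∷ w) = letterStep (side i a) (pending i q w) ∷ raise i q w

pending-++ : ∀ i q u v → pending i q (u ++ v) ≡ pending i (pending i q v) u
pending-++ i q []      v = refl
pending-++ i q (a ∷ u) v = cong (pendingStep (side i a)) (pending-++ i q u v)

-- The counter is all that passes from `v` to `u`; the initial value `q` is a parameter so that a
-- factor of a word can be treated on its own.
raise-++ : ∀ i q u v → raise i q (u ++ v) ≡ raise i (pending i q v) u ++ raise i q v
raise-++ i q []      v = refl
raise-++ i q (a ∷ u) v = cong₂ _∷_ (cong (letterStep (side i a)) (pending-++ i q u v)) (raise-++ i q u v)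

pending-knuth₁ : ∀ {i x y z} (a : Side i x) (b : Side i y) (c : Side i z) q → x < y → y ≤ z →
  pendingStep b (pendingStep c (pendingStep a q)) ≡ pendingStep b (pendingStep a (pendingStep c q))
pending-knuth₁ close       b           close       q       p r = refl
pending-knuth₁ close       open′       open′       zero    p r = refl
pending-knuth₁ close       open′       open′       (suc q) p r = refl
pending-knuth₁ close       close       open′       q       p r = contradiction p (<-irrefl refl)
pending-knuth₁ close       (other _ n) open′       q       p r = contradiction (≤-antisym r p) n
pending-knuth₁ open′       b           close       q       p r = contradiction (<-≤-trans p r) (≤⇒≯ (n≤1+n _))
pending-knuth₁ open′       b           open′       q       p r = refl
pending-knuth₁ close       b           (other _ _) q       p r = refl
pending-knuth₁ open′       b           (other _ _) q       p r = refl
pending-knuth₁ (other _ _) b           close       q       p r = refl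
pending-knuth₁ (other _ _) b           open′       q       p r = refl
pending-knuth₁ (other _ _) b           (other _ _) q       p r = refl

-- A letter changes at most from i + 1 to i, so the same relation usually applies to the new
-- letters. Where a strict inequality might collapse, the side `other` supplies it, as such a letter
-- differs from both i and i + 1.
raise-knuth₁ : ∀ {i x y z} (a : Side i x) (b : Side i y) (c : Side i z) q v → x < y → y ≤ z →
  letterStep b (pendingStep c (pendingStep a q)) ∷ letterStep c (pendingStep a q) ∷ letterStep a q ∷ v ~
  letterStep b (pendingStep a (pendingStep c q)) ∷ letterStep a (pendingStep c q) ∷ letterStep c q ∷ v
raise-knuth₁ (other _ _) (other _ _) (other _ _) q       v p r = knuth₁ v p r
raise-knuth₁ (other _ _) (other _ _) close       q       v p r = knuth₁ v p r
raise-knuth₁ (other _ _) (other _ n) open′       zero    v p r = knuth₁ v p (s≤s⁻¹ (≤∧≢⇒< r n))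
raise-knuth₁ (other _ _) (other _ _) open′       (suc q) v p r = knuth₁ v p r
raise-knuth₁ (other _ _) close       (other _ _) q       v p r = knuth₁ v p r
raise-knuth₁ (other _ _) close       close       q       v p r = knuth₁ v p r
raise-knuth₁ (other _ _) close       open′       zero    v p r = knuth₁ v p ≤-refl
raise-knuth₁ (other _ _) close       open′       (suc q) v p r = knuth₁ v p r
raise-knuth₁ (other n _) open′       (other _ _) zero    v p r = knuth₁ v (≤∧≢⇒< (s≤s⁻¹ p) n) (<⇒≤ r)
raise-knuth₁ (other _ _) open′       (other _ _) (suc q) v p r = knuth₁ v p r
raise-knuth₁ (other _ _) open′       close       q       v p r = contradiction r (<-irrefl refl)
raise-knuth₁ (other n _) open′       open′       zero    v p r = knuth₁ v (≤∧≢⇒< (s≤s⁻¹ p) n) ≤-refl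
raise-knuth₁ (other n _) open′       open′       (suc zero) v p r = knuth₁ v (≤∧≢⇒< (s≤s⁻¹ p) n) (n≤1+n _)
raise-knuth₁ (other _ _) open′       open′       (suc (suc q)) v p r = knuth₁ v p r
raise-knuth₁ close       (other _ _) (other _ _) q       v p r = knuth₁ v p r
raise-knuth₁ close       b           close       q       v p r = contradiction (<-≤-trans p r) (<-irrefl refl)
raise-knuth₁ close       (other _ n) open′       q       v p r = contradiction (≤-antisym r p) n
raise-knuth₁ close       close       c           q       v p r = contradiction p (<-irrefl refl)
raise-knuth₁ close       open′       (other _ _) q       v p r = knuth₁ v p r
-- The left word loses its first i + 1, the right word its last: the results `i (i+1) i` and
-- `(i+1) i i` are related by the other Knuth relation.
raise-knuth₁ close       open′       open′       zero    v p r = knuth₂ v ≤-refl p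
raise-knuth₁ close       open′       open′       (suc q) v p r = knuth₁ v p r
raise-knuth₁ open′       (other _ _) (other _ _) zero    v p r = knuth₁ v (<⇒≤ p) r
raise-knuth₁ open′       (other _ _) (other _ _) (suc q) v p r = knuth₁ v p r
raise-knuth₁ open′       b           close       q       v p r = contradiction (<-≤-trans p r) (≤⇒≯ (n≤1+n _))
raise-knuth₁ open′       b           open′       q       v p r = contradiction (<-≤-trans p r) (<-irrefl refl)
raise-knuth₁ open′       close       c           q       v p r = contradiction p (≤⇒≯ (n≤1+n _))
raise-knuth₁ open′       open′       c           q       v p r = contradiction p (<-irrefl refl)

pending-knuth₂ : ∀ {i x y z} (a : Side i x) (b : Side i y) (c : Side i z) q → x ≤ y → y < z →
  pendingStep a (pendingStep c (pendingStep b q)) ≡ pendingStep c (pendingStep a (pendingStep b q))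
pending-knuth₂ close       close       open′       q       p r = refl
pending-knuth₂ close       (other n _) open′       q       p r = contradiction (≤-antisym p (s≤s⁻¹ r)) (n ∘ sym)
pending-knuth₂ close       open′       open′       q       p r = contradiction r (<-irrefl refl)
pending-knuth₂ close       b           close       q       p r = refl
pending-knuth₂ open′       b           close       q       p r = contradiction (<-trans p r) (<-irrefl refl)
pending-knuth₂ open′       b           open′       q       p r = refl
pending-knuth₂ close       b           (other _ _) q       p r = refl
pending-knuth₂ open′       b           (other _ _) q       p r = refl
pending-knuth₂ (other _ _) b           close       q       p r = refl
pending-knuth₂ (other _ _) b           open′       q       p r = refl
pending-knuth₂ (other _ _) b           (other _ _) q       p r = refl

raise-knuth₂ : ∀ {i x y z} (a : Side i x) (b : Side i y) (c : Side i z) q v → x ≤ y → y < z →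
  letterStep a (pendingStep c (pendingStep b q)) ∷ letterStep c (pendingStep b q) ∷ letterStep b q ∷ v ~
  letterStep c (pendingStep a (pendingStep b q)) ∷ letterStep a (pendingStep b q) ∷ letterStep b q ∷ v
raise-knuth₂ (other _ _) (other _ _) (other _ _) q       v p r = knuth₂ v p r
raise-knuth₂ (other _ _) (other _ _) close       q       v p r = knuth₂ v p r
raise-knuth₂ (other _ _) (other n _) open′       zero    v p r = knuth₂ v p (≤∧≢⇒< (s≤s⁻¹ r) n)
raise-knuth₂ (other _ _) (other _ _) open′       (suc q) v p r = knuth₂ v p r
raise-knuth₂ (other _ _) close       (other _ _) q       v p r = knuth₂ v p r
raise-knuth₂ a           close       close       q       v p r = contradiction r (<-irrefl refl)
raise-knuth₂ (other _ _) close       open′       q       v p r = knuth₂ v p r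
raise-knuth₂ (other _ n) open′       (other _ _) zero    v p r = knuth₂ v (s≤s⁻¹ (≤∧≢⇒< p n)) (<⇒≤ r)
raise-knuth₂ (other _ _) open′       (other _ _) (suc q) v p r = knuth₂ v p r
raise-knuth₂ a           open′       close       q       v p r = contradiction r (≤⇒≯ (n≤1+n _))
raise-knuth₂ a           open′       open′       q       v p r = contradiction r (<-irrefl refl)
raise-knuth₂ close       (other _ _) (other _ _) q       v p r = knuth₂ v p r
raise-knuth₂ close       (other _ _) close       q       v p r = contradiction (≤-<-trans p r) (<-irrefl refl)
raise-knuth₂ close       (other n _) open′       q       v p r = contradiction (≤-antisym p (s≤s⁻¹ r)) (n ∘ sym)
raise-knuth₂ close       close       (other _ _) q       v p r = knuth₂ v p r
raise-knuth₂ close       close       open′       q       v p r = knuth₂ v p r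
raise-knuth₂ close       open′       (other _ _) zero    v p r = knuth₂ v ≤-refl (<⇒≤ r)
raise-knuth₂ close       open′       (other _ _) (suc q) v p r = knuth₂ v p r
raise-knuth₂ open′       (other _ _) (other _ _) zero    v p r = knuth₂ v (<⇒≤ p) r
raise-knuth₂ open′       (other _ _) (other _ _) (suc q) v p r = knuth₂ v p r
raise-knuth₂ open′       (other _ _) close       q       v p r = contradiction (<-trans p r) (<-irrefl refl)
raise-knuth₂ open′       (other _ _) open′       q       v p r = contradiction (≤-<-trans p r) (<-irrefl refl)
raise-knuth₂ open′       close       c           q       v p r = contradiction p (<-irrefl refl)
raise-knuth₂ open′       open′       (other _ _) zero    v p r = knuth₂ v ≤-refl (<⇒≤ r)
raise-knuth₂ open′       open′       (other _ _) (suc zero) v p r = knuth₂ v (n≤1+n _) r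
raise-knuth₂ open′       open′       (other _ _) (suc (suc q)) v p r = knuth₂ v p r

pending-~ : ∀ i q {u v} → u ~ v → pending i q u ≡ pending i q v
pending-~ i q ~refl        = refl
pending-~ i q (~sym e)     = sym (pending-~ i q e)
pending-~ i q (~trans e f) = trans (pending-~ i q e) (pending-~ i q f)
pending-~ i q (~cons a e)  = cong (pendingStep (side i a)) (pending-~ i q e)
pending-~ i q (knuth₁ {x} {y} {z} v p r) = pending-knuth₁ (side i x) (side i y) (side i z) (pending i q v) p r
pending-~ i q (knuth₂ {x} {y} {z} v p r) = pending-knuth₂ (side i x) (side i y) (side i z) (pending i q v) p r

raise-~ : ∀ i q {u v} → u ~ v → raise i q u ~ raise i q v
raise-~ i q ~refl        = ~refl
raise-~ i q (~sym e)     = ~sym (raise-~ i q e)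
raise-~ i q (~trans e f) = ~trans (raise-~ i q e) (raise-~ i q f)
raise-~ i q (~cons a {v = v} e) rewrite pending-~ i q e = ~cons (letterStep (side i a) (pending i q v)) (raise-~ i q e)
raise-~ i q (knuth₁ {x} {y} {z} v p r) = raise-knuth₁ (side i x) (side i y) (side i z) (pending i q v) (raise i q v) p r
raise-~ i q (knuth₂ {x} {y} {z} v p r) = raise-knuth₂ (side i x) (side i y) (side i z) (pending i q v) (raise i q v) p r

raiseDown : ℕ → List ℕ → List ℕ
raiseDown zero    w = w
raiseDown (suc m) w = raiseDown m (raise (suc m) 0 w)

raiseDown-~ : ∀ m {u v} → u ~ v → raiseDown m u ~ raiseDown m v
raiseDown-~ zero    e = e
raiseDown-~ (suc m) e = raiseDown-~ m (raise-~ (suc m) 0 e)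

stage : ℕ → List ℕ → List ℕ
stage zero          w = w
stage (suc zero)    w = w
stage (suc (suc k)) w = raiseDown (suc k) (stage (suc k) w)

stage-~ : ∀ k {u v} → u ~ v → stage k u ~ stage k v
stage-~ zero          e = e
stage-~ (suc zero)    e = e
stage-~ (suc (suc k)) e = raiseDown-~ (suc k) (stage-~ (suc k) e)

occ : ℕ → List ℕ → ℕ
occ a []      = 0
occ a (b ∷ w) = (if b ≡ᵇ a then 1 else 0) + occ a w

+-swap : ∀ a b c → a + (b + c) ≡ b + (a + c)
+-swap = solve 3 (λ a b c → a :+ (b :+ c) := b :+ (a :+ c)) refl where open +-*-Solver

occ-++ : ∀ a u v → occ a (u ++ v) ≡ occ a u + occ a v
occ-++ a []      v = refl
occ-++ a (b ∷ u) v = trans (cong ((if b ≡ᵇ a then 1 else 0) +_) (occ-++ a u v)) (sym (+-assoc (if b ≡ᵇ a then 1 else 0) _ _))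

occ-~ : ∀ a {u v} → u ~ v → occ a u ≡ occ a v
occ-~ a ~refl        = refl
occ-~ a (~sym e)     = sym (occ-~ a e)
occ-~ a (~trans e f) = trans (occ-~ a e) (occ-~ a f)
occ-~ a (~cons b e)  = cong ((if b ≡ᵇ a then 1 else 0) +_) (occ-~ a e)
occ-~ a (knuth₁ {x} {y} {z} v _ _) = cong ((if y ≡ᵇ a then 1 else 0) +_) (+-swap (if z ≡ᵇ a then 1 else 0) (if x ≡ᵇ a then 1 else 0) (occ a v))
occ-~ a (knuth₂ {x} {y} {z} v _ _) = +-swap (if x ≡ᵇ a then 1 else 0) (if z ≡ᵇ a then 1 else 0) _

-- Row insertion

ind : ℕ → ℕ → ℕ
ind a k = if a ≤ᵇ k then 1 else 0

≤ᵇ-true : ∀ {m n} → m ≤ n → (m ≤ᵇ n) ≡ true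
≤ᵇ-true m≤n = Equivalence.to T-≡ (≤⇒≤ᵇ m≤n)

≤ᵇ-false : ∀ {m n} → n < m → (m ≤ᵇ n) ≡ false
≤ᵇ-false {m} {n} n<m with m ≤ᵇ n in eq
... | false = refl
... | true  = contradiction n<m (≤⇒≯ (≤ᵇ⇒≤ m n (Equivalence.from T-≡ eq)))

ind-≤ : ∀ {a k} → a ≤ k → ind a k ≡ 1
ind-≤ h rewrite ≤ᵇ-true h = refl

ind-> : ∀ {a k} → k < a → ind a k ≡ 0
ind-> h rewrite ≤ᵇ-false h = refl

ind-mono : ∀ a {k l} → k ≤ l → ind a k ≤ ind a l
ind-mono a {k} {l} k≤l with a ≤? k
... | yes a≤k = ≤-reflexive (trans (ind-≤ a≤k) (sym (ind-≤ (≤-trans a≤k k≤l))))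
... | no  a≰k rewrite ind-> (≰⇒> a≰k) = z≤n

-- Rows are handled through this counting function. For weakly increasing rows, the columns are
-- strict exactly when `le (suc k) R′ ≤ le k R` for all `k`, with `R′` above `R`; no indexing into
-- columns is required.
le : ℕ → List ℕ → ℕ
le k []      = 0
le k (a ∷ R) = ind a k + le k R

le-mono : ∀ R {k l} → k ≤ l → le k R ≤ le l R
le-mono []      h = z≤n
le-mono (a ∷ R) h = +-mono-≤ (ind-mono a h) (le-mono R h)

le-zero : ∀ {k R} → All (k <_) R → le k R ≡ 0
le-zero []       = refl
le-zero (h ∷ hs) rewrite ind-> h = le-zero hs

Sorted : List ℕ → Set
Sorted = AllPairs _≤_

-- Entries ≤ k of a row that are new after inserting x are only those between x and the first larger entry.
Inserted : ℕ → List ℕ → List ℕ → Set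
Inserted x R R′ = ∀ k → le k R′ ≤ le k R ⊎ (x ≤ k × le k R′ ≤ suc (le x R))

-- In `bump`, the counting equation says that `x` has replaced `y`, and the strict increase at `y`
-- that `y` did occur in `R`. The new head `h` is exposed because a further entry `a` in front of
-- `y` is passed by `knuth₂` on `a`, `y`, `h`, which uses `a ≤ h < y`. The last field preserves
-- lower bounds, hence sortedness.
data RowInsertion (x : ℕ) (R : List ℕ) : Set where
  stop : ∀ R′ → Sorted R′ → R ++ [ x ] ≡ R′ → Inserted x R R′ → (∀ k → le k R ≤ le k R′) →
         (∀ a → a ≤ x → All (a ≤_) R → All (a ≤_) R′) → RowInsertion x R
  bump : ∀ y h R″ → let R′ = h ∷ R″ in Sorted R′ → R ++ [ x ] ~ y ∷ R′ → x < y → h ≤ x →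
         (∀ k → le k R′ + ind y k ≡ le k R + ind x k) → (∀ k → k < y → le k R < le y R) →
         Inserted x R R′ → (∀ a → a ≤ x → All (a ≤_) R → All (a ≤_) R′) → RowInsertion x R

-- `x` travels left through the row; each exchange is a `knuth₁` whose pivot is the entry to the
-- left of the one being passed, so `x` comes to rest just after `a`.
bump-~ : ∀ a R x → x < a → Sorted (a ∷ R) → a ∷ R ++ [ x ] ~ a ∷ x ∷ R
bump-~ a []      x x<a s = ~refl
bump-~ a (b ∷ R) x x<a ((a≤b ∷ _) ∷ s) =
  ~trans (~cons a (bump-~ b R x (<-≤-trans x<a a≤b) s)) (knuth₁ R x<a a≤b)

Inserted-∷ : ∀ {x a} R R′ → a ≤ x → Inserted x R R′ → Inserted x (a ∷ R) (a ∷ R′)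
Inserted-∷ {x} {a} _ _ a≤x h k with h k
... | inj₁ p       = inj₁ (+-monoʳ-≤ (ind a k) p)
... | inj₂ (q , p) rewrite ind-≤ a≤x | ind-≤ (≤-trans a≤x q) = inj₂ (q , s≤s p)

rowInsert : ∀ x R → Sorted R → RowInsertion x R
rowInsert x [] [] = stop [ x ] ([] ∷ []) refl ins (λ _ → z≤n) (λ _ p _ → p ∷ [])
  where
  ins : Inserted x [] [ x ]
  ins k with x ≤? k
  ... | yes p rewrite ind-≤ p = inj₂ (p , ≤-refl)
  ... | no  p rewrite ind-> (≰⇒> p) = inj₁ z≤n
rowInsert x (a ∷ R) s@(a≤R ∷ sR) with a ≤? x
... | no a≰x = bump a x R (All.map (≤-trans (<⇒≤ x<a)) a≤R ∷ sR) (bump-~ a R x x<a s) x<a ≤-refl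
                (λ k → solve 3 (λ i j l → i :+ l :+ j := j :+ l :+ i) refl (ind x k) (ind a k) (le k R))
                step ins (λ b b≤x bs → b≤x ∷ All.map (≤-trans (≤-trans b≤x (<⇒≤ x<a))) a≤R)
  where
  open +-*-Solver
  x<a = ≰⇒> a≰x
  none : ∀ {k} → k < a → le k R ≡ 0
  none k<a = le-zero (All.map (<-≤-trans k<a) a≤R)
  step : ∀ k → k < a → le k (a ∷ R) < le a (a ∷ R)
  step k k<a rewrite none k<a | ind-> k<a | ind-≤ (≤-refl {a}) = s≤s z≤n
  ins : Inserted x (a ∷ R) (x ∷ R)
  ins k with x ≤? k | a ≤? k
  ... | no p  | _     rewrite ind-> (≰⇒> p) = inj₁ (m≤n+m (le k R) (ind a k))
  ... | yes p | yes q rewrite ind-≤ p | ind-≤ q = inj₁ ≤-refl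
  ... | yes p | no q  rewrite ind-≤ p | none (≰⇒> q) = inj₂ (p , s≤s z≤n)
... | yes a≤x with rowInsert x R sR
...   | stop R′ sR′ refl ins grow keep =
        stop (a ∷ R′) (keep a a≤x a≤R ∷ sR′) refl (Inserted-∷ R R′ a≤x ins) (λ k → +-monoʳ-≤ (ind a k) (grow k))
             (λ { b b≤x (b≤a ∷ bs) → b≤a ∷ keep b b≤x bs })
...   | bump y h R″ sR′ e x<y h≤x eq st ins keep =
        bump y a (h ∷ R″) (keep a a≤x a≤R ∷ sR′)
             (~trans (~cons a e) (knuth₂ R″ (All.head (keep a a≤x a≤R)) (≤-<-trans h≤x x<y))) x<y a≤x
             (λ k → trans (+-assoc (ind a k) _ _) (trans (cong (ind a k +_) (eq k)) (sym (+-assoc (ind a k) _ _))))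
             (λ k k<y → +-mono-≤-< (ind-mono a (<⇒≤ k<y)) (st k k<y))
             (Inserted-∷ R (h ∷ R″) a≤x ins)
             (λ { b b≤x (b≤a ∷ bs) → b≤a ∷ keep b b≤x bs })

-- Rows are listed from the bottom; f k counts the entries ≤ k of the row just below.
data Above (f : ℕ → ℕ) : List (List ℕ) → Set where
  []  : Above f []
  row : ∀ {R Rs} → Sorted R → (∀ k → le (suc k) R ≤ f k) → Above (λ k → le k R) Rs → Above f (R ∷ Rs)

data Tableau : List (List ℕ) → Set where
  []  : Tableau []
  row : ∀ {R Rs} → Sorted R → Above (λ k → le k R) Rs → Tableau (R ∷ Rs)

Above-mono : ∀ {f g Rs} → (∀ k → f k ≤ g k) → Above f Rs → Above g Rs
Above-mono f≤g []          = []
Above-mono f≤g (row s c a) = row s (λ k → ≤-trans (c k) (f≤g k)) a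

rw : List (List ℕ) → List ℕ
rw []       = []
rw (R ∷ Rs) = rw Rs ++ R

-- What the row above has to know about the row below, whose counts change from `f` to `g` when `x`
-- replaces `y`.
data Bumped (f g : ℕ → ℕ) : ℕ → ℕ → Set where
  bumped : ∀ {x y} → x < y → (∀ k → g k + ind y k ≡ f k + ind x k) →
           (∀ {k l} → k ≤ l → f k ≤ f l) → (∀ k → k < y → f k < f y) → Bumped f g x y

-- New entries in the upper row are bounded by `suc (le (suc y) R) ≤ suc (f y)`. The lower row
-- contained `suc y`, so `f y < f (suc y)`, which settles every `k` beyond `y`; at `k = y` the
-- smaller `x` has just taken the place of `suc y`, so `g y` is `suc (f y)`.
inserted-column : ∀ {f g x y} R R′ → Bumped f g x y → Inserted y R R′ → (∀ k → le (suc k) R ≤ f k) →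
  ∀ k → le (suc k) R′ ≤ g k
inserted-column {f} {g} {x} {suc y} R R′ (bumped x<y eq mono st) ins col k = case ins (suc k) of λ where
    (inj₁ p)       → ≤-trans p (≤-trans (col k) f≤g)
    (inj₂ (q , p)) → case m≤n⇒m<n∨m≡n q of λ where
      (inj₁ y<k)  → ≤-trans p (≤-trans (s≤s (col y)) (≤-trans (st y ≤-refl) (≤-trans (mono (s≤s⁻¹ y<k)) f≤g)))
      (inj₂ refl) → ≤-trans p (≤-trans (s≤s (col y)) (≤-reflexive (sym (at-y))))
  where
  at-y : g y ≡ suc (f y)
  at-y = begin
    g y                   ≡⟨ +-identityʳ _ ⟨
    g y + 0               ≡⟨ cong (g y +_) (sym (ind-> {suc y} ≤-refl)) ⟩
    g y + ind (suc y) y   ≡⟨ eq y ⟩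
    f y + ind x y         ≡⟨ cong (f y +_) (ind-≤ (s≤s⁻¹ x<y)) ⟩
    f y + 1               ≡⟨ +-comm (f y) 1 ⟩
    suc (f y)             ∎
    where open ≡-Reasoning
  f≤g : ∀ {k} → f k ≤ g k
  f≤g {k} = +-cancelʳ-≤ (ind (suc y) k) (f k) (g k) (≤-trans (+-monoʳ-≤ (f k) lemma) (≤-reflexive (sym (eq k))))
    where
    lemma : ind (suc y) k ≤ ind x k
    lemma with suc y ≤? k
    ... | yes p rewrite ind-≤ p | ind-≤ (≤-trans (<⇒≤ x<y) p) = ≤-refl
    ... | no p rewrite ind-> (≰⇒> p) = z≤n

insertAbove : ∀ {f g x y} Rs → Bumped f g x y → Above f Rs →
  ∃ λ Rs′ → Above g Rs′ × rw Rs ++ [ y ] ~ rw Rs′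
insertAbove {y = y} [] b [] = [ [ y ] ] , row ([] ∷ []) (inserted-column [] [ y ] b ins λ _ → z≤n) [] , ~refl
  where
  ins : Inserted y [] [ y ]
  ins k with y ≤? k
  ... | yes p rewrite ind-≤ p = inj₂ (p , ≤-refl)
  ... | no  p rewrite ind-> (≰⇒> p) = inj₁ z≤n
insertAbove {y = y} (R ∷ Rs) b (row s c a) with rowInsert y R s
... | stop R′ sR′ refl ins grow _ =
  R′ ∷ Rs , row sR′ (inserted-column R R′ b ins c) (Above-mono grow a) , ~reflexive (++-assoc (rw Rs) R [ y ])
... | bump z h R″ sR′ e y<z _ eq st ins _ with insertAbove Rs (bumped y<z eq (le-mono R) st) a
...   | Rs′ , a′ , e′ = (h ∷ R″) ∷ Rs′ , row sR′ (inserted-column R (h ∷ R″) b ins c) a′ ,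
        ~trans (~reflexive (++-assoc (rw Rs) R [ y ])) (~trans (~++ˡ (rw Rs) e)
          (~trans (~reflexive (sym (++-assoc (rw Rs) [ z ] (h ∷ R″)))) (~++ʳ (h ∷ R″) e′)))

insertTableau : ∀ x T → Tableau T → ∃ λ T′ → Tableau T′ × rw T ++ [ x ] ~ rw T′
insertTableau x [] [] = [ [ x ] ] , row ([] ∷ []) [] , ~refl
insertTableau x (R ∷ Rs) (row s a) with rowInsert x R s
... | stop R′ sR′ refl ins grow _ = R′ ∷ Rs , row sR′ (Above-mono grow a) , ~reflexive (++-assoc (rw Rs) R [ x ])
... | bump z h R″ sR′ e y<z _ eq st ins _ with insertAbove Rs (bumped y<z eq (le-mono R) st) a
...   | Rs′ , a′ , e′ = (h ∷ R″) ∷ Rs′ , row sR′ a′ ,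
        ~trans (~reflexive (++-assoc (rw Rs) R [ x ])) (~trans (~++ˡ (rw Rs) e)
          (~trans (~reflexive (sym (++-assoc (rw Rs) [ z ] (h ∷ R″)))) (~++ʳ (h ∷ R″) e′)))

~tableau-from : ∀ T → Tableau T → ∀ w → ∃ λ T′ → Tableau T′ × rw T ++ w ~ rw T′
~tableau-from T t []      = T , t , ~reflexive (++-identityʳ (rw T))
~tableau-from T t (x ∷ w) with insertTableau x T t
... | T₁ , t₁ , e₁ with ~tableau-from T₁ t₁ w
...   | T₂ , t₂ , e₂ = T₂ , t₂ ,
        ~trans (~reflexive (sym (++-assoc (rw T) [ x ] w))) (~trans (~++ʳ w e₁) e₂)

~tableau : ∀ w → ∃ λ T → Tableau T × w ~ rw T
~tableau = ~tableau-from [] []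

-- Collapsing the reading word of a tableau

module _ {P : ℕ → Set} where
  All-~ : ∀ {u v} → u ~ v → (All P u → All P v) × (All P v → All P u)
  All-~ ~refl        = id , id
  All-~ (~sym e)     = proj₂ (All-~ e) , proj₁ (All-~ e)
  All-~ (~trans e f) = proj₁ (All-~ f) ∘ proj₁ (All-~ e) , proj₂ (All-~ e) ∘ proj₂ (All-~ f)
  All-~ (~cons a e)  = (λ { (p ∷ ps) → p ∷ proj₁ (All-~ e) ps }) , (λ { (p ∷ ps) → p ∷ proj₂ (All-~ e) ps })
  All-~ (knuth₁ _ _ _) = (λ { (p ∷ q ∷ r ∷ s) → p ∷ r ∷ q ∷ s }) , (λ { (p ∷ q ∷ r ∷ s) → p ∷ r ∷ q ∷ s })
  All-~ (knuth₂ _ _ _) = (λ { (p ∷ q ∷ r ∷ s) → q ∷ p ∷ r ∷ s }) , (λ { (p ∷ q ∷ r ∷ s) → q ∷ p ∷ r ∷ s })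

Dominates : List ℕ → List (List ℕ) → Set
Dominates R []       = ⊤
Dominates R (R′ ∷ _) = ∀ k → le (suc k) R′ ≤ le k R

data Stacked (r : ℕ) : List (List ℕ) → Set where
  []  : Stacked r []
  row : ∀ {R Rs} → Sorted R → All (r ≤_) R → Dominates R Rs → Stacked (suc r) Rs → Stacked r (R ∷ Rs)

le≡0⇒All : ∀ {k} R → le k R ≡ 0 → All (k <_) R
le≡0⇒All []      _ = []
le≡0⇒All {k} (a ∷ R) e with a ≤? k
... | yes p = contradiction (trans (sym e) (cong (_+ le k R) (ind-≤ p))) λ ()
... | no  p = ≰⇒> p ∷ le≡0⇒All R (m+n≡0⇒n≡0 (ind a k) e)

-- Column strictness at `k = r`: if the lower row has no entry ≤ r, the next row has none ≤ r + 1.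
above⇒stacked : ∀ {r} R Rs → All (suc r ≤_) R → Sorted R → Above (λ k → le k R) Rs → Stacked (suc r) (R ∷ Rs)
above⇒stacked R [] p s [] = row s p tt []
above⇒stacked {r} R (R′ ∷ Rs) p s (row s′ c a) = row s p c (above⇒stacked R′ Rs p′ s′ a)
  where
  p′ : All (suc (suc r) ≤_) R′
  p′ = le≡0⇒All R′ (n≤0⇒n≡0 (≤-trans (c r) (≤-reflexive (le-zero p))))

tableau⇒stacked : ∀ T → Tableau T → All (1 ≤_) (rw T) → Stacked 1 T
tableau⇒stacked []       []        p = []
tableau⇒stacked (R ∷ Rs) (row s a) p = above⇒stacked R Rs (++⁻ʳ (rw Rs) p) s a

-- Stage k of collapsing replaces the entries ≤ k of row r by r; on the way to stage k + 1, the
-- letters k + 1 that came from row r have been lowered to r ⊔ j once e*_j has been applied.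
relabel : ℕ → ℕ → ℕ → ℕ → ℕ
relabel k j r a with <-cmp a (suc k)
... | tri< _ _ _ = r
... | tri≈ _ _ _ = r ⊔ j
... | tri> _ _ _ = a

relabelWord : ℕ → ℕ → ℕ → List (List ℕ) → List ℕ
relabelWord k j r []       = []
relabelWord k j r (R ∷ Rs) = relabelWord k j (suc r) Rs ++ map (relabel k j r) R

relabel-> : ∀ {k j r a} → suc k < a → relabel k j r a ≡ a
relabel-> {k} {a = a} h with <-cmp a (suc k)
... | tri< p _ _ = contradiction p (<-asym h)
... | tri≈ _ refl _ = contradiction h (<-irrefl refl)
... | tri> _ _ _ = refl

pendingStep-open : ∀ {i} (s : Side i (suc i)) q → pendingStep s q ≡ pred q
pendingStep-open open′       q = refl
pendingStep-open (other _ n) q = contradiction refl n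

pendingStep-close : ∀ {i} (s : Side i i) q → pendingStep s q ≡ suc q
pendingStep-close close       q = refl
pendingStep-close (other n _) q = contradiction refl n

pendingStep-other : ∀ {i a} (s : Side i a) q → a ≢ i → a ≢ suc i → pendingStep s q ≡ q
pendingStep-other close       q m n = contradiction refl m
pendingStep-other open′       q m n = contradiction refl n
pendingStep-other (other _ _) q m n = refl

letterStep-open : ∀ {i} (s : Side i (suc i)) → letterStep s 0 ≡ i
letterStep-open open′       = refl
letterStep-open (other _ n) = contradiction refl n

letterStep-matched : ∀ {i} (s : Side i (suc i)) q → letterStep s (suc q) ≡ suc i
letterStep-matched open′       q = refl
letterStep-matched (other _ n) q = contradiction refl n

letterStep-close : ∀ {i} (s : Side i i) q → letterStep s q ≡ i
letterStep-close close       q = refl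
letterStep-close (other n _) q = contradiction refl n

letterStep-other : ∀ {i a} (s : Side i a) q → a ≢ i → a ≢ suc i → letterStep s q ≡ a
letterStep-other close       q m n = contradiction refl m
letterStep-other open′       q m n = contradiction refl n
letterStep-other (other _ _) q m n = refl

module _ {j k : ℕ} (j≤k : j ≤ k) where

  large : ∀ {a} → suc k < a → a ≢ j × a ≢ suc j
  large h = (λ { refl → contradiction (<-≤-trans h j≤k) (≤⇒≯ (n≤1+n _)) })
          , (λ { refl → contradiction (<-≤-trans h (s≤s j≤k)) (<-irrefl refl) })

  -- Since the word is read from the right, rows are met from the bottom up. Rows below row j
  -- contain no letter j, so nothing is pending and every j + 1 (an original k + 1) is lowered.
  lower-below : ∀ {r} R → r < j →
    pending j 0 (map (relabel k (suc j) r) R) ≡ 0 ×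
    raise j 0 (map (relabel k (suc j) r) R) ≡ map (relabel k j r) R
  lower-below [] _ = refl , refl
  lower-below {r} (a ∷ R) r<j with lower-below R r<j | <-cmp a (suc k)
  ... | p , o | tri< _ _ _ rewrite p | o =
    pendingStep-other (side j r) 0 (<⇒≢ r<j) (<⇒≢ (m<n⇒m<1+n r<j)) ,
    cong (_∷ map (relabel k j r) R) (letterStep-other (side j r) 0 (<⇒≢ r<j) (<⇒≢ (m<n⇒m<1+n r<j)))
  ... | p , o | tri≈ _ _ _ rewrite p | o | m≤n⇒m⊔n≡n (m≤n⇒m≤1+n (<⇒≤ r<j)) | m≤n⇒m⊔n≡n (<⇒≤ r<j) =
    pendingStep-open (side j (suc j)) 0 ,
    cong (_∷ map (relabel k j r) R) (letterStep-open (side j (suc j)))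
  ... | p , o | tri> _ _ h rewrite p | o with large h
  ...   | m , n = pendingStep-other (side j a) 0 m n , cong (_∷ map (relabel k j r) R) (letterStep-other (side j a) 0 m n)

  -- In row j the letters j + 1 (originally k + 1) stand to the right of the letters j (originally ≤
  -- k). They are read while nothing is pending and are lowered; afterwards all letters j of the row
  -- stay pending.
  lower-at : ∀ R → Sorted R →
    pending j 0 (map (relabel k (suc j) j) R) ≡ le k R ×
    raise j 0 (map (relabel k (suc j) j) R) ≡ map (relabel k j j) R
  lower-at [] _ = refl , refl
  lower-at (a ∷ R) (a≤R ∷ s) with lower-at R s | <-cmp a (suc k)
  ... | p , o | tri< h _ _ rewrite p | o | ind-≤ (s≤s⁻¹ h) =
    pendingStep-close (side j j) (le k R) , cong (_∷ map (relabel k j j) R) (letterStep-close (side j j) _)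
  ... | p , o | tri≈ _ refl _ rewrite p | o | m≤n⇒m⊔n≡n (n≤1+n j) | ⊔-idem j | ind-> {suc k} ≤-refl | le-zero a≤R =
    pendingStep-open (side j (suc j)) 0 , cong (_∷ map (relabel k j j) R) (letterStep-open (side j (suc j)))
  ... | p , o | tri> _ _ h rewrite p | o | ind-> (<⇒≤ h) with large h
  ...   | m , n = pendingStep-other (side j a) _ m n , cong (_∷ map (relabel k j j) R) (letterStep-other (side j a) _ m n)

  -- In row j + 1 all original entries ≤ k + 1 now read j + 1. Column strictness bounds their number
  -- by that of the letters j pending from row j, so each is matched and none moves.
  lower-next : ∀ R q → le (suc k) R ≤ q →
    pending j q (map (relabel k (suc j) (suc j)) R) ≡ q ∸ le (suc k) R ×
    raise j q (map (relabel k (suc j) (suc j)) R) ≡ map (relabel k j (suc j)) R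
  lower-next [] q _ = refl , refl
  lower-next (a ∷ R) q b with a ≤? suc k
  ... | no h rewrite ind-> (≰⇒> h) with lower-next R q b | large (≰⇒> h)
  ...   | p , o | m , n rewrite relabel-> {j = j} {suc j} (≰⇒> h) | relabel-> {j = suc j} {suc j} (≰⇒> h) | p | o =
        pendingStep-other (side j a) _ m n , cong (_∷ map (relabel k j (suc j)) R) (letterStep-other (side j a) _ m n)
  lower-next (a ∷ R) zero b | yes h rewrite ind-≤ h = contradiction b λ ()
  lower-next (a ∷ R) (suc q) b | yes h rewrite ind-≤ h with lower-next R (suc q) (m≤n⇒m≤1+n (s≤s⁻¹ b))
  ... | p , o = goal
    where
    letter : ∀ i → i ≤ suc j → relabel k i (suc j) a ≡ suc j
    letter i i≤ with <-cmp a (suc k)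
    ... | tri< _ _ _ = refl
    ... | tri≈ _ _ _ = m≥n⇒m⊔n≡m i≤
    ... | tri> _ _ g = contradiction h (<⇒≱ g)
    goal : pending j (suc q) (map (relabel k (suc j) (suc j)) (a ∷ R)) ≡ q ∸ le (suc k) R ×
           raise j (suc q) (map (relabel k (suc j) (suc j)) (a ∷ R)) ≡ map (relabel k j (suc j)) (a ∷ R)
    goal rewrite letter (suc j) ≤-refl | letter j (n≤1+n j) | p | o | +-∸-assoc 1 (s≤s⁻¹ b) =
      pendingStep-open (side j (suc j)) _ , cong (_∷ map (relabel k j (suc j)) R) (letterStep-matched (side j (suc j)) _)

  lower-above : ∀ {r} R q → suc j < r →
    pending j q (map (relabel k (suc j) r) R) ≡ q ×
    raise j q (map (relabel k (suc j) r) R) ≡ map (relabel k j r) R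
  lower-above [] q _ = refl , refl
  lower-above {r} (a ∷ R) q h with lower-above R q h
  ... | p , o = goal
    where
    b = relabel k (suc j) r a
    same : b ≡ relabel k j r a × b ≢ j × b ≢ suc j
    same with <-cmp a (suc k)
    ... | tri< _ _ _ = refl , >⇒≢ (<-trans (n<1+n j) h) , >⇒≢ h
    ... | tri≈ _ _ _ rewrite m≥n⇒m⊔n≡m (<⇒≤ h) | m≥n⇒m⊔n≡m (<⇒≤ (<-trans (n<1+n j) h)) =
      refl , >⇒≢ (<-trans (n<1+n j) h) , >⇒≢ h
    ... | tri> _ _ g = refl , large g
    goal : pending j q (map (relabel k (suc j) r) (a ∷ R)) ≡ q ×
           raise j q (map (relabel k (suc j) r) (a ∷ R)) ≡ map (relabel k j r) (a ∷ R)
    goal with same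
    ... | e , m , n rewrite p | o = pendingStep-other (side j b) q m n ,
          cong (_∷ map (relabel k j r) R) (trans (letterStep-other (side j b) q m n) e)

  raise-above : ∀ {r} Rs q → suc j < r → raise j q (relabelWord k (suc j) r Rs) ≡ relabelWord k j r Rs
  raise-above []       q h = refl
  raise-above {r} (R ∷ Rs) q h
    rewrite raise-++ j q (relabelWord k (suc j) (suc r) Rs) (map (relabel k (suc j) r) R)
          | proj₁ (lower-above R q h) | proj₂ (lower-above R q h) | raise-above Rs q (m<n⇒m<1+n h) = refl

  raise-next : ∀ R Rs → Dominates R Rs →
    raise j (le k R) (relabelWord k (suc j) (suc j) Rs) ≡ relabelWord k j (suc j) Rs
  raise-next R []        d = refl
  raise-next R (R′ ∷ Rs) d
    rewrite raise-++ j (le k R) (relabelWord k (suc j) (2 + j) Rs) (map (relabel k (suc j) (suc j)) R′)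
          | proj₂ (lower-next R′ (le k R) (d k))
          | raise-above Rs (pending j (le k R) (map (relabel k (suc j) (suc j)) R′)) ≤-refl = refl

  raise-relabel : ∀ {r} Rs → Stacked r Rs → r ≤ j → raise j 0 (relabelWord k (suc j) r Rs) ≡ relabelWord k j r Rs
  raise-relabel [] [] h = refl
  raise-relabel {r} (R ∷ Rs) (row s _ d st) h
    rewrite raise-++ j 0 (relabelWord k (suc j) (suc r) Rs) (map (relabel k (suc j) r) R) with m≤n⇒m<n∨m≡n h
  ... | inj₁ r<j rewrite proj₁ (lower-below R r<j) | proj₂ (lower-below R r<j) =
    cong (_++ map (relabel k j r) R) (raise-relabel Rs st r<j)
  ... | inj₂ refl rewrite proj₁ (lower-at R s) | proj₂ (lower-at R s) =
    cong (_++ map (relabel k j j) R) (raise-next R Rs d)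

raiseDown-relabel : ∀ {j k} T → Stacked 1 T → j ≤ k → raiseDown j (relabelWord k (suc j) 1 T) ≡ relabelWord k 1 1 T
raiseDown-relabel {zero}  T st h = refl
raiseDown-relabel {suc j} T st h rewrite raise-relabel h T st (s≤s z≤n) = raiseDown-relabel T st (<⇒≤ h)

collapsed : ℕ → ℕ → ℕ → ℕ
collapsed k r a = if a ≤ᵇ k then r else a

collapsedWord : ℕ → ℕ → List (List ℕ) → List ℕ
collapsedWord k r []       = []
collapsedWord k r (R ∷ Rs) = collapsedWord k (suc r) Rs ++ map (collapsed k r) R

map-cong-All : ∀ {P : ℕ → Set} {f g : ℕ → ℕ} {R} → (∀ {a} → P a → f a ≡ g a) → All P R → map f R ≡ map g R
map-cong-All h []       = refl
map-cong-All h (p ∷ ps) = cong₂ _∷_ (h p) (map-cong-All h ps)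

-- The descent starts at `j = suc k`, where an entry `suc k` has not moved: `r ⊔ suc k` is `suc k`
-- because entries of row `r` are at least `r`. It ends at `j = 1`, where `r ⊔ 1` is `r`.
collapsed⇒relabel : ∀ {k r} T → Stacked r T → collapsedWord k r T ≡ relabelWord k (suc k) r T
collapsed⇒relabel [] [] = refl
collapsed⇒relabel {k} {r} (R ∷ Rs) (row _ p _ st) = cong₂ _++_ (collapsed⇒relabel Rs st) (map-cong-All eq p)
  where
  eq : ∀ {a} → r ≤ a → collapsed k r a ≡ relabel k (suc k) r a
  eq {a} r≤a with <-cmp a (suc k)
  ... | tri< h _ _ rewrite ≤ᵇ-true (s≤s⁻¹ h) = refl
  ... | tri≈ _ refl _ rewrite ≤ᵇ-false (n<1+n k) = sym (m≤n⇒m⊔n≡n r≤a)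
  ... | tri> _ _ h rewrite ≤ᵇ-false (<⇒≤ h) = refl

relabel⇒collapsed : ∀ {k r} T → 1 ≤ r → relabelWord k 1 r T ≡ collapsedWord (suc k) r T
relabel⇒collapsed [] _ = refl
relabel⇒collapsed {k} {r} (R ∷ Rs) 1≤r = cong₂ _++_ (relabel⇒collapsed Rs (s≤s z≤n)) (map-cong eq R)
  where
  eq : ∀ a → relabel k 1 r a ≡ collapsed (suc k) r a
  eq a with <-cmp a (suc k)
  ... | tri< h _ _ rewrite ≤ᵇ-true (<⇒≤ h) = refl
  ... | tri≈ _ refl _ rewrite ≤ᵇ-true (≤-refl {suc k}) = m≥n⇒m⊔n≡m 1≤r
  ... | tri> _ _ h rewrite ≤ᵇ-false h = refl

rw-collapsed : ∀ {r} T → Stacked r T → 1 ≤ r → rw T ≡ collapsedWord 1 r T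
rw-collapsed [] [] _ = refl
rw-collapsed {r} (R ∷ Rs) (row _ p _ st) 1≤r = cong₂ _++_ (rw-collapsed Rs st (s≤s z≤n)) (id-map p)
  where
  eq : ∀ {a} → r ≤ a → a ≡ collapsed 1 r a
  eq {a} r≤a with a ≤? 1
  ... | yes h rewrite ≤ᵇ-true h = ≤-antisym (≤-trans h 1≤r) r≤a
  ... | no h rewrite ≤ᵇ-false (≰⇒> h) = refl
  id-map : ∀ {R} → All (r ≤_) R → R ≡ map (collapsed 1 r) R
  id-map []       = refl
  id-map (p ∷ ps) = cong₂ _∷_ (eq p) (id-map ps)

stage-tableau : ∀ k T → Stacked 1 T → stage (suc k) (rw T) ≡ collapsedWord (suc k) 1 T
stage-tableau zero    T st = rw-collapsed T st ≤-refl
stage-tableau (suc k) T st = begin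
  raiseDown (suc k) (stage (suc k) (rw T))           ≡⟨ cong (raiseDown (suc k)) (stage-tableau k T st) ⟩
  raiseDown (suc k) (collapsedWord (suc k) 1 T)      ≡⟨ cong (raiseDown (suc k)) (collapsed⇒relabel T st) ⟩
  raiseDown (suc k) (relabelWord (suc k) (2 + k) 1 T) ≡⟨ raiseDown-relabel T st ≤-refl ⟩
  relabelWord (suc k) 1 1 T                          ≡⟨ relabel⇒collapsed T ≤-refl ⟩
  collapsedWord (2 + k) 1 T                          ∎
  where open ≡-Reasoning

-- Reading the recording tableau off the collapsing stages

rowAt : List (List ℕ) → ℕ → List ℕ
rowAt []       i       = []
rowAt (R ∷ Rs) zero    = R
rowAt (R ∷ Rs) (suc i) = rowAt Rs i

≡ᵇ-true : ∀ {m n} → m ≡ n → (m ≡ᵇ n) ≡ true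
≡ᵇ-true {m} {n} e = Equivalence.to T-≡ (≡⇒≡ᵇ m n e)

≡ᵇ-false : ∀ {m n} → m ≢ n → (m ≡ᵇ n) ≡ false
≡ᵇ-false {m} {n} ne with m ≡ᵇ n in eq
... | false = refl
... | true  = contradiction (≡ᵇ⇒≡ m n (Equivalence.from T-≡ eq)) ne

occ-none : ∀ {a w} → All (_≢ a) w → occ a w ≡ 0
occ-none []       = refl
occ-none (p ∷ ps) rewrite ≡ᵇ-false p = occ-none ps

collapsedWord-≥ : ∀ {k r s} T → s ≤ r → s ≤ suc k → All (s ≤_) (collapsedWord k r T)
collapsedWord-≥ [] _ _ = []
collapsedWord-≥ {k} {r} {s} (R ∷ Rs) h h′ = ++⁺ (collapsedWord-≥ Rs (m≤n⇒m≤1+n h) h′) (go R)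
  where
  go : ∀ R → All (s ≤_) (map (collapsed k r) R)
  go []      = []
  go (a ∷ R) with a ≤? k
  ... | yes p rewrite ≤ᵇ-true p = h ∷ go R
  ... | no  p rewrite ≤ᵇ-false (≰⇒> p) = ≤-trans h′ (≰⇒> p) ∷ go R

occ-row : ∀ {k r} R → r ≤ k → occ r (map (collapsed k r) R) ≡ le k R
occ-row [] _ = refl
occ-row {k} {r} (a ∷ R) h with a ≤? k
... | yes p rewrite ≤ᵇ-true p | ≡ᵇ-true {r} refl = cong suc (occ-row R h)
... | no  p rewrite ≤ᵇ-false (≰⇒> p) | ≡ᵇ-false (>⇒≢ (≤-<-trans h (≰⇒> p))) = occ-row R h

occ-other-row : ∀ {k r s} R → s ≤ k → r ≢ s → occ s (map (collapsed k r) R) ≡ 0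
occ-other-row [] _ _ = refl
occ-other-row {k} {r} {s} (a ∷ R) h n with a ≤? k
... | yes p rewrite ≤ᵇ-true p | ≡ᵇ-false n = occ-other-row R h n
... | no  p rewrite ≤ᵇ-false (≰⇒> p) | ≡ᵇ-false (>⇒≢ (≤-<-trans h (≰⇒> p))) = occ-other-row R h n

-- Letters that are not replaced exceed `k`, so they cannot be confused with a row number at most
-- `k`.
occ-collapsedWord : ∀ {k} r i T → i + r ≤ k → occ (i + r) (collapsedWord k r T) ≡ le k (rowAt T i)
occ-collapsedWord r i [] h = refl
occ-collapsedWord {k} r zero (R ∷ Rs) h
  rewrite occ-++ r (collapsedWord k (suc r) Rs) (map (collapsed k r) R)
        | occ-none (All.map >⇒≢ (collapsedWord-≥ {k} {suc r} {suc r} Rs ≤-refl (s≤s h))) = occ-row R h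
occ-collapsedWord {k} r (suc i) (R ∷ Rs) h
  rewrite occ-++ (suc i + r) (collapsedWord k (suc r) Rs) (map (collapsed k r) R)
        | occ-other-row {k} {r} {suc i + r} R h (<⇒≢ (s≤s (m≤n+m r i)))
        | +-identityʳ (occ (suc i + r) (collapsedWord k (suc r) Rs)) | sym (+-suc i r) =
  occ-collapsedWord (suc r) i Rs h

applyUpTo-cong : ∀ {A : Set} {f g : ℕ → A} n → (∀ i → i < n → f i ≡ g i) → applyUpTo f n ≡ applyUpTo g n
applyUpTo-cong zero    h = refl
applyUpTo-cong (suc n) h = cong₂ _∷_ (h 0 (s≤s z≤n)) (applyUpTo-cong n (λ i p → h (suc i) (s≤s p)))

concat-∷ʳ : ∀ {A : Set} (xss : List (List A)) xs → concat (xss ++ [ xs ]) ≡ concat xss ++ xs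
concat-∷ʳ xss xs = trans (sym (concat-++ xss [ xs ])) (cong (concat xss ++_) (++-identityʳ xs))

le-++ : ∀ k R S → le k (R ++ S) ≡ le k R + le k S
le-++ k []      S = refl
le-++ k (a ∷ R) S = trans (cong (ind a k +_) (le-++ k R S)) (sym (+-assoc (ind a k) _ _))

le-replicate-≤ : ∀ {k a} m → a ≤ k → le k (replicate m a) ≡ m
le-replicate-≤ zero    h = refl
le-replicate-≤ (suc m) h rewrite ind-≤ h = cong suc (le-replicate-≤ m h)

le-replicate-> : ∀ {k a} m → k < a → le k (replicate m a) ≡ 0
le-replicate-> zero    h = refl
le-replicate-> (suc m) h rewrite ind-> h = le-replicate-> m h

le-length : ∀ {k R} → All (_≤ k) R → le k R ≡ length R
le-length []       = refl
le-length (p ∷ ps) rewrite ind-≤ p = cong suc (le-length ps)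

split-top : ∀ L R → Sorted R → All (_≤ suc L) R →
  ∃₂ λ R₀ m → R ≡ R₀ ++ replicate m (suc L) × Sorted R₀ × All (_≤ L) R₀
split-top L [] _ _ = [] , 0 , refl , [] , []
split-top L (a ∷ R) (a≤R ∷ s) (h ∷ hs) with split-top L R s hs | m≤n⇒m<n∨m≡n h
... | R₀ , m , refl , s₀ , b₀      | inj₁ a≤L = a ∷ R₀ , m , refl , (++⁻ˡ R₀ a≤R ∷ s₀) , (s≤s⁻¹ a≤L ∷ b₀)
... | [] , m , refl , s₀ , b₀      | inj₂ refl = [] , suc m , refl , [] , []
... | b ∷ R₀ , m , refl , s₀ , b≤L ∷ b₀ | inj₂ refl = contradiction b≤L (<⇒≱ (All.head a≤R))

pieces : (ℕ → ℕ) → ℕ → List ℕ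
pieces C L = concat (applyUpTo (λ j → replicate (C (suc j) ∸ C j) (suc j)) L)

pieces-cong : ∀ {C D} L → (∀ k → k ≤ L → C k ≡ D k) → pieces C L ≡ pieces D L
pieces-cong L h = cong concat (applyUpTo-cong L (λ j p → cong₂ (λ a b → replicate (a ∸ b) (suc j)) (h (suc j) p) (h j (<⇒≤ p))))

row-pieces : ∀ L R → Sorted R → All (1 ≤_) R → All (_≤ L) R → R ≡ pieces (λ k → le k R) L
row-pieces zero []      _ _        _        = refl
row-pieces zero (a ∷ R) _ (p ∷ _)  (q ∷ _)  = contradiction (≤-trans p q) λ ()
row-pieces (suc L) R s p h with split-top L R s h
... | R₀ , m , refl , s₀ , b₀ = begin
  R₀ ++ replicate m (suc L)
    ≡⟨ cong (_++ replicate m (suc L)) (row-pieces L R₀ s₀ (++⁻ˡ R₀ p) b₀) ⟩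
  pieces (λ k → le k R₀) L ++ replicate m (suc L)
    ≡⟨ cong₂ _++_ (pieces-cong L below) (cong (λ c → replicate c (suc L)) (sym top)) ⟩
  pieces C L ++ replicate (C (suc L) ∸ C L) (suc L)
    ≡⟨ concat-∷ʳ (applyUpTo (λ j → replicate (C (suc j) ∸ C j) (suc j)) L) _ ⟨
  concat (applyUpTo (λ j → replicate (C (suc j) ∸ C j) (suc j)) L ++ [ replicate (C (suc L) ∸ C L) (suc L) ])
    ≡⟨ cong concat (applyUpTo-∷ʳ (λ j → replicate (C (suc j) ∸ C j) (suc j)) L) ⟩
  pieces C (suc L) ∎
  where
  open ≡-Reasoning
  C : ℕ → ℕ
  C k = le k (R₀ ++ replicate m (suc L))
  below : ∀ k → k ≤ L → le k R₀ ≡ C k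
  below k k≤L = sym (begin
    C k                                   ≡⟨ le-++ k R₀ _ ⟩
    le k R₀ + le k (replicate m (suc L))  ≡⟨ cong (le k R₀ +_) (le-replicate-> m (s≤s k≤L)) ⟩
    le k R₀ + 0                           ≡⟨ +-identityʳ _ ⟩
    le k R₀                               ∎)
  top : C (suc L) ∸ C L ≡ m
  top = begin
    C (suc L) ∸ C L            ≡⟨ cong₂ _∸_ (le-++ (suc L) R₀ _) (sym (below L ≤-refl)) ⟩
    (le (suc L) R₀ + le (suc L) (replicate m (suc L))) ∸ le L R₀
      ≡⟨ cong₂ (λ a b → (a + b) ∸ le L R₀) (trans (le-length (All.map m≤n⇒m≤1+n b₀)) (sym (le-length b₀))) (le-replicate-≤ m ≤-refl) ⟩
    (le L R₀ + m) ∸ le L R₀    ≡⟨ m+n∸m≡n (le L R₀) m ⟩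
    m                          ∎

rw-empty : ∀ {L r} T → Stacked r T → L < r → All (_≤ L) (rw T) → rw T ≡ []
rw-empty [] [] _ _ = refl
rw-empty ([] ∷ Rs) (row _ _ _ st) h b rewrite ++-identityʳ (rw Rs) = rw-empty Rs st (m<n⇒m<1+n h) b
rw-empty ((a ∷ R) ∷ Rs) (row _ (r≤a ∷ _) _ _) h b =
  contradiction (All.head (++⁻ʳ (rw Rs) b)) (<⇒≱ (<-≤-trans h r≤a))

concat-reverse-∷ : ∀ {A : Set} (xs : List A) xss → concat (reverse (xs ∷ xss)) ≡ concat (reverse xss) ++ xs
concat-reverse-∷ xs xss = trans (cong concat (unfold-reverse xs xss)) (concat-∷ʳ (reverse xss) xs)

concat-reverse-[] : ∀ n → concat (reverse (applyUpTo (rowAt []) n)) ≡ []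
concat-reverse-[] zero    = refl
concat-reverse-[] (suc n) = trans (concat-reverse-∷ [] (applyUpTo (rowAt []) n)) (trans (++-identityʳ _) (concat-reverse-[] n))

-- The recording tableau lists exactly `L` rows, whereas `T` may have fewer or more. Missing rows
-- are read as empty; rows beyond `L` are empty, as an entry would be at least its row number and at
-- most `L`.
readingWord-rows : ∀ {L r} m T → Stacked r T → All (_≤ L) (rw T) → m + r ≡ suc L →
  readingWord (applyUpTo (rowAt T) m) ≡ rw T
readingWord-rows m [] _ _ _ = concat-reverse-[] m
readingWord-rows zero T@(_ ∷ _) st b refl = sym (rw-empty T st ≤-refl b)
readingWord-rows {r = r} (suc m) (R ∷ Rs) (row _ _ _ st) b e =
  trans (concat-reverse-∷ R (applyUpTo (rowAt Rs) m))
        (cong (_++ R) (readingWord-rows m Rs st (++⁻ˡ (rw Rs) b) (trans (+-suc m r) e)))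

stacked-row : ∀ {r L} T i → Stacked r T → All (_≤ L) (rw T) →
  Sorted (rowAt T i) × All (i + r ≤_) (rowAt T i) × All (_≤ L) (rowAt T i)
stacked-row []       i       _              _ = [] , [] , []
stacked-row (R ∷ Rs) zero    (row s p _ st) b = s , p , ++⁻ʳ (rw Rs) b
stacked-row {r} (R ∷ Rs) (suc i) (row s p _ st) b with stacked-row Rs i st (++⁻ˡ (rw Rs) b)
... | s′ , p′ , b′ = s′ , subst (λ m → All (m ≤_) (rowAt Rs i)) (+-suc i r) p′ , b′

occ-stage : ∀ {w} T → w ~ rw T → Stacked 1 T → ∀ i k → suc i ≤ k → occ (suc i) (stage k w) ≡ le k (rowAt T i)
occ-stage {w} T e st i (suc k) h = begin
  occ (suc i) (stage (suc k) w)             ≡⟨ occ-~ (suc i) (stage-~ (suc k) e) ⟩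
  occ (suc i) (stage (suc k) (rw T))        ≡⟨ cong (occ (suc i)) (stage-tableau k T st) ⟩
  occ (suc i) (collapsedWord (suc k) 1 T)   ≡⟨ cong (λ m → occ m (collapsedWord (suc k) 1 T)) (sym (+-comm i 1)) ⟩
  occ (i + 1) (collapsedWord (suc k) 1 T)   ≡⟨ occ-collapsedWord 1 i T (≤-trans (≤-reflexive (+-comm i 1)) h) ⟩
  le (suc k) (rowAt T i)                    ∎
  where open ≡-Reasoning

recordedRows : (ℕ → ℕ → ℕ) → ℕ → List (List ℕ)
recordedRows c L = map (λ i → concatMap (λ j → replicate (c (suc j) (suc i) ∸ c j (suc i)) (suc j)) (upTo L)) (upTo L)

-- The counts enter as an abstract `c`, which separates the tableau argument from the Boolean rows
-- on which collapsing is defined.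
readingWord-recorded : ∀ {L w} (c : ℕ → ℕ → ℕ) → All (1 ≤_) w → All (_≤ L) w →
  (∀ k r → k ≤ L → 1 ≤ r → c k r ≡ (if r ≤ᵇ k then occ r (stage k w) else 0)) →
  w ~ readingWord (recordedRows c L)
readingWord-recorded {L} {w} c pos bd hc with ~tableau w
... | T , t , e = ~trans e (~reflexive (sym (begin
  readingWord (recordedRows c L)     ≡⟨ cong readingWord (map-upTo _ L) ⟩
  readingWord (applyUpTo (λ i → concat (map (λ j → replicate (c (suc j) (suc i) ∸ c j (suc i)) (suc j)) (upTo L))) L)
                                     ≡⟨ cong readingWord (applyUpTo-cong L same) ⟩
  readingWord (applyUpTo (rowAt T) L) ≡⟨ readingWord-rows L T st bdT (+-comm L 1) ⟩
  rw T                               ∎)))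
  where
  open ≡-Reasoning
  bdT : All (_≤ L) (rw T)
  bdT = proj₁ (All-~ e) bd
  st : Stacked 1 T
  st = tableau⇒stacked T t (proj₁ (All-~ e) pos)
  count : ∀ i k → i < L → k ≤ L → le k (rowAt T i) ≡ c k (suc i)
  count i k i<L k≤L with stacked-row T i st bdT | suc i ≤? k
  ... | s , p , b | yes h rewrite hc k (suc i) k≤L (s≤s z≤n) | ≤ᵇ-true h = sym (occ-stage T e st i k h)
  -- For k below the row number the count is 0 by convention; this agrees with `T`, whose entries
  -- are at least their row number.
  ... | s , p , b | no h rewrite hc k (suc i) k≤L (s≤s z≤n) | ≤ᵇ-false (≰⇒> h) =
    le-zero (All.map (≤-trans (≤-trans (≰⇒> h) (≤-reflexive (+-comm 1 i)))) p)
  same : ∀ i → i < L →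
    concat (map (λ j → replicate (c (suc j) (suc i) ∸ c j (suc i)) (suc j)) (upTo L)) ≡ rowAt T i
  same i i<L with stacked-row T i st bdT
  ... | s , p , b = begin
    concat (map (λ j → replicate (c (suc j) (suc i) ∸ c j (suc i)) (suc j)) (upTo L))
      ≡⟨ cong concat (map-upTo _ L) ⟩
    pieces (λ k → c k (suc i)) L
      ≡⟨ pieces-cong L (λ k k≤L → sym (count i k i<L k≤L)) ⟩
    pieces (λ k → le k (rowAt T i)) L
      ≡⟨ row-pieces L (rowAt T i) s (All.map (≤-trans (m≤n+m 1 i)) p) b ⟨
    rowAt T i ∎

-- Sweeping the columns

bit : Bool → ℕ
bit true  = 1
bit false = 0

-- Sweeping the columns from left to right, carry counts the customers (marked by s) that have not yet
-- met a free ball of b, starting from q customers that wrapped around; taken marks the balls they obtain.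
carry : (s b : ℕ → Bool) → ℕ → ℕ → ℕ
carry s b q zero    = q
carry s b q (suc j) = carry s b q j + bit (s j) ∸ bit (b j)

taken : (s b : ℕ → Bool) → ℕ → ℕ → Bool
taken s b q j = b j ∧ (0 <ᵇ carry s b q j + bit (s j))

Least : (s b : ℕ → Bool) (n q : ℕ) → Set
Least s b n q = carry s b q n ≤ q × (∀ q′ → carry s b q′ n ≤ q′ → q ≤ q′)

-- Wraps B n r s f: customers s of row r + 1 wrap f times altogether while descending to row 1.
data Wraps (B : ℕ → ℕ → Bool) (n : ℕ) : ℕ → (ℕ → Bool) → ℕ → Set where
  base : ∀ {s} → Wraps B n zero s 0
  step : ∀ {r s q f} → Least s (B (suc r)) n q → Wraps B n r (taken s (B (suc r)) q) f → Wraps B n (suc r) s (q + f)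

carry-cong : ∀ {s s′ b b′ n} q → (∀ j → j < n → s j ≡ s′ j) → (∀ j → j < n → b j ≡ b′ j) →
  ∀ j → j ≤ n → carry s b q j ≡ carry s′ b′ q j
carry-cong q hs hb zero    _ = refl
carry-cong q hs hb (suc j) h rewrite carry-cong q hs hb j (<⇒≤ h) | hs j h | hb j h = refl

taken-cong : ∀ {s s′ b b′ n} q → (∀ j → j < n → s j ≡ s′ j) → (∀ j → j < n → b j ≡ b′ j) →
  ∀ j → j < n → taken s b q j ≡ taken s′ b′ q j
taken-cong q hs hb j h rewrite carry-cong q hs hb j (<⇒≤ h) | hs j h | hb j h = refl

Least-cong : ∀ {s s′ b b′ n q} → (∀ j → j < n → s j ≡ s′ j) → (∀ j → j < n → b j ≡ b′ j) →
  Least s b n q → Least s′ b′ n q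
Least-cong {n = n} {q} hs hb (p , m) = subst (_≤ q) (carry-cong q hs hb n ≤-refl) p ,
  λ q′ h → m q′ (subst (_≤ q′) (sym (carry-cong q′ hs hb n ≤-refl)) h)

Wraps-cong : ∀ {B B′ n r s s′ f} → (∀ k j → 1 ≤ k → k ≤ r → j < n → B k j ≡ B′ k j) → (∀ j → j < n → s j ≡ s′ j) →
  Wraps B n r s f → Wraps B′ n r s′ f
Wraps-cong hB hs base = base
Wraps-cong {r = suc r} hB hs (step {q = q} l w) =
  step (Least-cong hs (λ j → hB (suc r) j (s≤s z≤n) ≤-refl) l)
       (Wraps-cong (λ k j h h′ → hB k j h (m≤n⇒m≤1+n h′))
                   (taken-cong q hs (λ j → hB (suc r) j (s≤s z≤n) ≤-refl)) w)

Least-none : ∀ {s b n} → (∀ j → j < n → s j ≡ false) → Least s b n 0 × (∀ j → j < n → taken s b 0 j ≡ false)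
Least-none {s} {b} {n} h = (≤-reflexive (zeros n ≤-refl) , λ _ _ → z≤n) , none
  where
  zeros : ∀ j → j ≤ n → carry s b 0 j ≡ 0
  zeros zero    _ = refl
  zeros (suc j) p rewrite zeros j (<⇒≤ p) | h j p = 0∸n≡0 (bit (b j))
  none : ∀ j → j < n → taken s b 0 j ≡ false
  none j p rewrite zeros j (<⇒≤ p) | h j p = ∧-zeroʳ (b j)

Wraps-none : ∀ {B n s} r → (∀ j → j < n → s j ≡ false) → Wraps B n r s 0
Wraps-none zero    h = base
Wraps-none {B} {s = s} (suc r) h with Least-none {s} {B (suc r)} h
... | l , t = step l (Wraps-none r t)

_⊑_below_ : (ℕ → Bool) → (ℕ → Bool) → ℕ → Set
s ⊑ s′ below n = ∀ j → j < n → s j ≡ true → s′ j ≡ true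

bit-mono : ∀ {x y} → (x ≡ true → y ≡ true) → bit x ≤ bit y
bit-mono {false} h = z≤n
bit-mono {true}  h rewrite h refl = ≤-refl

carry-mono : ∀ {s s′ b n q q′} → s ⊑ s′ below n → q ≤ q′ → ∀ j → j ≤ n → carry s b q j ≤ carry s′ b q′ j
carry-mono hs hq zero    _ = hq
carry-mono {b = b} hs hq (suc j) h =
  ∸-monoˡ-≤ (bit (b j)) (+-mono-≤ (carry-mono {b = b} hs hq j (<⇒≤ h)) (bit-mono (hs j h)))

positive-mono : ∀ {m n} → m ≤ n → (0 <ᵇ m) ≡ true → (0 <ᵇ n) ≡ true
positive-mono {suc m} {suc n} h e = refl

∧-true : ∀ {x y} → x ∧ y ≡ true → x ≡ true × y ≡ true
∧-true {true} {true} _ = refl , refl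

taken-mono : ∀ {s s′ b n q q′} → s ⊑ s′ below n → q ≤ q′ → taken s b q ⊑ taken s′ b q′ below n
taken-mono {b = b} hs hq j h e with ∧-true {b j} e
... | p , p′ rewrite p = positive-mono (+-mono-≤ (carry-mono {b = b} hs hq j (<⇒≤ h)) (bit-mono (hs j h))) p′

-- All rows in one sweep, and the action of words

colStep : Bool → ℕ → (ℕ → Bool) → List ℕ → List ℕ
colStep x zero    c ps       = ps
colStep x (suc r) c []       = []
colStep x (suc r) c (p ∷ ps) = p + bit x ∸ bit (c (suc r)) ∷ colStep (c (suc r) ∧ (0 <ᵇ p + bit x)) r c ps

sweep : (ℕ → ℕ → Bool) → (ℕ → Bool) → ℕ → ℕ → List ℕ → List ℕ
sweep B s r zero    ps = ps
sweep B s r (suc j) ps = colStep (s j) r (λ k → B k j) (sweep B s r j ps)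

-- Exchanges the columnwise order of a word with the rowwise order of pairings: the top queue
-- evolves independently of the lower ones, which see it only through the balls it takes.
sweep-∷ : ∀ B s r n q qs →
  sweep B s (suc r) n (q ∷ qs) ≡ carry s (B (suc r)) q n ∷ sweep B (taken s (B (suc r)) q) r n qs
sweep-∷ B s r zero    q qs = refl
sweep-∷ B s r (suc n) q qs rewrite sweep-∷ B s r n q qs = refl

LeastState : (List ℕ → List ℕ) → ℕ → List ℕ → Set
LeastState φ r qs = length qs ≡ r × Pointwise _≤_ (φ qs) qs ×
  (∀ ps → length ps ≡ r → Pointwise _≤_ (φ ps) ps → Pointwise _≤_ qs ps)

Pointwise-antisym : ∀ {ps qs} → Pointwise _≤_ ps qs → Pointwise _≤_ qs ps → ps ≡ qs
Pointwise-antisym []       []       = refl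
Pointwise-antisym (h ∷ hs) (g ∷ gs) = cong₂ _∷_ (≤-antisym h g) (Pointwise-antisym hs gs)

LeastState-unique : ∀ {φ ψ r ps qs} → (∀ xs → length xs ≡ r → φ xs ≡ ψ xs) → LeastState φ r ps → LeastState ψ r qs → ps ≡ qs
LeastState-unique {ps = ps} {qs} h (lp , fp , mp) (lq , fq , mq) = Pointwise-antisym
  (mp qs lq (subst (λ x → Pointwise _≤_ x qs) (sym (h qs lq)) fq))
  (mq ps lp (subst (λ x → Pointwise _≤_ x ps) (h ps lp) fp))

-- Minimality is proved for all larger customer sets `s′`, since a competing state may start with
-- more waiting customers, which take more balls and so send more customers to the row below.
wraps-state : ∀ {B n r s f} → Wraps B n r s f → ∃ λ qs → length qs ≡ r × sum qs ≡ f ×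
  Pointwise _≤_ (sweep B s r n qs) qs ×
  (∀ s′ ps → s ⊑ s′ below n → length ps ≡ r → Pointwise _≤_ (sweep B s′ r n ps) ps → Pointwise _≤_ qs ps)
wraps-state {B} {n} {s = s} base = [] , refl , refl , subst (λ x → Pointwise _≤_ x []) (sym (nil n)) [] , λ { s′ [] _ _ _ → [] }
  where
  nil : ∀ m → sweep B s 0 m [] ≡ []
  nil zero    = refl
  nil (suc m) = nil m
wraps-state {B} {n} {suc r} {s} (step {q = q} (l , m) w) with wraps-state w
... | qs , len , tot , fix , least =
  q ∷ qs , cong suc len , cong (q +_) tot , subst (λ x → Pointwise _≤_ x (q ∷ qs)) (sym (sweep-∷ B s r n q qs)) (l ∷ fix) , least′
  where
  least′ : ∀ s′ ps → s ⊑ s′ below n → length ps ≡ suc r →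
    Pointwise _≤_ (sweep B s′ (suc r) n ps) ps → Pointwise _≤_ (q ∷ qs) ps
  least′ s′ (p ∷ ps) hs len′ pf rewrite sweep-∷ B s′ r n p ps with pf
  ... | h ∷ t = q≤p ∷ least _ ps (taken-mono {b = B (suc r)} hs q≤p) (suc-injective len′) t
    where
    q≤p : q ≤ p
    q≤p = m p (≤-trans (carry-mono {b = B (suc r)} hs ≤-refl n ≤-refl) h)

wraps-least : ∀ {B n r s f} → Wraps B n r s f → ∃ λ qs → sum qs ≡ f × LeastState (sweep B s r n) r qs
wraps-least w with wraps-state w
... | qs , len , tot , fix , least = qs , tot , len , fix , λ ps → least _ ps (λ _ _ e → e)

columnLetters : (ℕ → Bool) → ℕ → List ℕ
columnLetters c zero    = []
columnLetters c (suc k) = if c (suc k) then suc k ∷ columnLetters c k else columnLetters c k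

gridWord : (ℕ → ℕ → Bool) → ℕ → ℕ → List ℕ
gridWord B L zero    = []
gridWord B L (suc n) = gridWord B L n ++ columnLetters (λ k → B k n) L

arrive : Bool → List ℕ → List ℕ
arrive true  ps = serve 0 ps
arrive false ps = ps

serve-skip : ∀ pre p ps → serve (suc (length pre)) (pre ++ p ∷ ps) ≡ pre ++ serve 1 (p ∷ ps)
serve-skip []        p ps = refl
serve-skip (x ∷ pre) p ps = cong (x ∷_) (serve-skip pre p ps)

arrive-∷ : ∀ x p ps → arrive x (p ∷ ps) ≡ p + bit x ∷ ps
arrive-∷ true  p ps = cong (_∷ ps) (+-comm 1 p)
arrive-∷ false p ps = cong (_∷ ps) (sym (+-identityʳ p))

mutual
  -- `pre` holds the queues this column has already dealt with; `arrive x ps` are the remaining ones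
  -- after the customer `x` has been handed down. Reading a column from the top delivers that
  -- customer before the ball of the next row serves, so a ball directly beneath can be used.
  act-columnLetters : ∀ c t pre x r ps → length ps ≡ r → suc (length pre + r) ≡ t →
    act t (columnLetters c r) (pre ++ arrive x ps) ≡ pre ++ colStep x r c ps
  act-columnLetters c t pre true  zero [] refl _ = refl
  act-columnLetters c t pre false zero [] refl _ = refl
  act-columnLetters c t pre x (suc r) (p ∷ ps) refl refl rewrite arrive-∷ x p ps with c (suc r) | p + bit x
  ... | false | m = act-columnLetters-∷ c pre m false r ps refl
  ... | true  | m
    rewrite letterAct-≤ {suc (length pre + suc r)} {suc r} (pre ++ m ∷ ps) (m≤n⇒m≤1+n (m≤n+m (suc r) (length pre)))
          | m+n∸n≡m (suc (length pre)) (suc r) | serve-skip pre m ps with m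
  ...   | zero   = act-columnLetters-∷ c pre 0 false r ps refl
  ...   | suc m′ = act-columnLetters-∷ c pre m′ true r ps refl

  act-columnLetters-∷ : ∀ c pre m x r ps → length ps ≡ r →
    act (suc (length pre + suc r)) (columnLetters c r) (pre ++ m ∷ arrive x ps) ≡ pre ++ m ∷ colStep x r c ps
  act-columnLetters-∷ c pre m x r ps len = begin
    act t (columnLetters c r) (pre ++ m ∷ arrive x ps)         ≡⟨ cong (act t (columnLetters c r)) (sym (++-assoc pre [ m ] _)) ⟩
    act t (columnLetters c r) ((pre ++ [ m ]) ++ arrive x ps)  ≡⟨ act-columnLetters c t (pre ++ [ m ]) x r ps len len′ ⟩
    (pre ++ [ m ]) ++ colStep x r c ps                         ≡⟨ ++-assoc pre [ m ] _ ⟩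
    pre ++ m ∷ colStep x r c ps                                ∎
    where
    open ≡-Reasoning
    t = suc (length pre + suc r)
    len′ : suc (length (pre ++ [ m ]) + r) ≡ t
    len′ = cong suc (trans (cong (_+ r) (length-++ pre)) (+-assoc (length pre) 1 r))

act-column : ∀ c t L ps → length ps ≡ t → suc t ≤ L →
  act (suc t) (columnLetters c L) ps ≡ colStep (c (suc t)) t c ps
act-column c t (suc L) ps len h with m≤n⇒m<n∨m≡n h
... | inj₂ refl with c (suc t)
...   | true rewrite letterAct-≤ {suc t} ps ≤-refl | n∸n≡0 t = act-columnLetters c (suc t) [] true t ps len refl
...   | false = act-columnLetters c (suc t) [] false t ps len refl
act-column c t (suc L) ps len h | inj₁ (s≤s t<L) with c (suc L)
... | true rewrite letterAct-> {suc t} ps (s≤s t<L) = act-column c t L ps len t<L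
... | false = act-column c t L ps len t<L

colStep-length : ∀ x r c ps → length (colStep x r c ps) ≡ length ps
colStep-length x zero    c ps       = refl
colStep-length x (suc r) c []       = refl
colStep-length x (suc r) c (p ∷ ps) = cong suc (colStep-length _ r c ps)

sweep-length : ∀ B s r n ps → length (sweep B s r n ps) ≡ length ps
sweep-length B s r zero    ps = refl
sweep-length B s r (suc n) ps = trans (colStep-length (s n) r _ _) (sweep-length B s r n ps)

act-gridWord : ∀ B t L n ps → length ps ≡ t → suc t ≤ L → act (suc t) (gridWord B L n) ps ≡ sweep B (B (suc t)) t n ps
act-gridWord B t L zero    ps len h = refl
act-gridWord B t L (suc n) ps len h
  rewrite act-++ (suc t) (gridWord B L n) (columnLetters (λ k → B k n) L) ps | act-gridWord B t L n ps len h =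
  act-column (λ k → B k n) t L _ (trans (sweep-length B (B (suc t)) t n ps) len) h

-- The grids may have different numbers of columns. They are compared only through their sweeps,
-- which are the actions of equivalent words on states of length `t`.
wraps-~ : ∀ {B B′ n n′ L t f f′} → gridWord B L n ~ gridWord B′ L n′ → suc t ≤ L →
  Wraps B n t (B (suc t)) f → Wraps B′ n′ t (B′ (suc t)) f′ → f ≡ f′
wraps-~ {B} {B′} {n} {n′} {L} {t} e h w w′ with wraps-least w | wraps-least w′
... | qs , refl , l | qs′ , refl , l′ = cong sum (LeastState-unique same l l′)
  where
  same : ∀ xs → length xs ≡ t → sweep B (B (suc t)) t n xs ≡ sweep B′ (B′ (suc t)) t n′ xs
  same xs len = trans (sym (act-gridWord B t L n xs len h))
    (trans (act-~ (suc t) e xs) (act-gridWord B′ t L n′ xs len h))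

-- Removing a customer

remove : (ℕ → Bool) → ℕ → ℕ → Bool
remove p c j = p j ∧ not (j ≡ᵇ c)

-- Effect of removing one customer and its ball on the carry at a column: δ and δ′ tell whether that
-- customer is travelling just before and just after the column.
data Local : (s b s′ b′ : Bool) (δ δ′ : ℕ) (hit : Bool) → Set where
  absent : ∀ {s b}   → Local s b s b 0 0 false
  pass   : ∀ {s δ}   → Local s false s false δ δ false
  depart : ∀ {δ}     → Local true false false false δ (suc δ) false
  settle : ∀ {s δ}   → Local s true s false (suc δ) δ true
  instant : ∀ {δ}    → Local true true false false δ δ true

local-carry : ∀ {s b s′ b′ δ δ′ h} → Local s b s′ b′ δ δ′ h → ∀ a → a + δ + bit s ∸ bit b ≡ (a + bit s′ ∸ bit b′) + δ′
local-carry (absent {s} {b}) a rewrite +-identityʳ a | +-identityʳ (a + bit s ∸ bit b) = refl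
local-carry (pass {s} {δ})   a = trans (+-assoc a δ (bit s)) (trans (cong (a +_) (+-comm δ (bit s))) (sym (+-assoc a (bit s) δ)))
local-carry (depart {δ})     a rewrite +-identityʳ a = trans (+-assoc a δ 1) (cong (a +_) (+-comm δ 1))
local-carry (settle {s} {δ}) a rewrite +-suc a δ = trans (+-assoc a δ (bit s)) (trans (cong (a +_) (+-comm δ (bit s))) (sym (+-assoc a (bit s) δ)))
local-carry (instant {δ})    a rewrite +-identityʳ a | m+n∸n≡m (a + δ) 1 = refl

local-taken : ∀ {s b s′ b′ δ δ′ h} → Local s b s′ b′ δ δ′ h → ∀ a →
  (b ∧ (0 <ᵇ a + δ + bit s)) ≡ (b′ ∧ (0 <ᵇ a + bit s′)) ∨ h
local-taken (absent {s} {b}) a rewrite +-identityʳ a = sym (∨-identityʳ _)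
local-taken pass             a = refl
local-taken depart           a = refl
local-taken (settle {s} {δ}) a rewrite +-suc a δ = refl
local-taken (instant {δ})    a rewrite +-comm (a + δ) 1 = refl

-- The index of type Bool records a wrap.
data Target (b : ℕ → Bool) (n c d : ℕ) : Bool → Set where
  direct  : c ≤ d → d < n → b d ≡ true → (∀ j → c ≤ j → j < d → b j ≡ false) → Target b n c d false
  wrapped : d < c → b d ≡ true → (∀ j → j < d → b j ≡ false) → (∀ j → c ≤ j → j < n → b j ≡ false) → Target b n c d true

target-ball : ∀ {b n c d ω} → Target b n c d ω → b d ≡ true
target-ball (direct _ _ e _)  = e
target-ball (wrapped _ e _ _) = e

target-< : ∀ {b n c d ω} → c < n → Target b n c d ω → d < n
target-< h (direct _ p _ _)  = p
target-< h (wrapped p _ _ _) = <-trans p h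

<ᵇ-true : ∀ {m n} → m < n → (m <ᵇ n) ≡ true
<ᵇ-true h = Equivalence.to T-≡ (<⇒<ᵇ h)

<ᵇ-false : ∀ {m n} → n ≤ m → (m <ᵇ n) ≡ false
<ᵇ-false {m} {n} h with m <ᵇ n in eq
... | false = refl
... | true  = contradiction h (<⇒≱ (<ᵇ⇒< m n (Equivalence.from T-≡ eq)))

remove-at : ∀ p {c} → remove p c c ≡ false
remove-at p {c} rewrite ≡ᵇ-true (refl {x = c}) = ∧-zeroʳ (p c)

remove-other : ∀ p {c j} → j ≢ c → remove p c j ≡ p j
remove-other p {c} {j} h rewrite ≡ᵇ-false h = ∧-identityʳ (p j)

-- Whether the customer going from `c` to `d` is waiting just before column `j`; `j <ᵇ suc d` stands
-- for j ≤ d. A wrapping customer is waiting both at the start and at the end of the sweep, a direct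
-- one at neither.
travelling : Bool → ℕ → ℕ → ℕ → ℕ
travelling false c d j = bit ((c <ᵇ j) ∧ (j <ᵇ suc d))
travelling true  c d j = bit ((c <ᵇ j) ∨ (j <ᵇ suc d))

local-target : ∀ {s b n c d ω} → s c ≡ true → Target b n c d ω → ∀ j → j < n →
  Local (s j) (b j) (remove s c j) (remove b d j) (travelling ω c d j) (travelling ω c d (suc j)) (j ≡ᵇ d)
local-target {s} {b} {c = c} {d} sc (direct c≤d d<n bd free) j j<n with <-cmp j c | <-cmp j d
... | tri< j<c _ _ | tri< j<d _ _
  rewrite remove-other s (<⇒≢ j<c) | remove-other b (<⇒≢ j<d) | ≡ᵇ-false (<⇒≢ j<d)
        | <ᵇ-false (<⇒≤ j<c) | <ᵇ-false j<c = absent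
... | tri< j<c _ _ | tri≈ _ refl _ = contradiction j<c (≤⇒≯ c≤d)
... | tri< j<c _ _ | tri> _ _ d<j  = contradiction (<-trans d<j j<c) (≤⇒≯ c≤d)
... | tri≈ _ refl _ | tri< j<d _ _
  rewrite sc | free j ≤-refl j<d | ≡ᵇ-false (<⇒≢ j<d) | ≡ᵇ-true (refl {x = j})
        | <ᵇ-false (≤-refl {j}) | <ᵇ-true (n<1+n j) | <ᵇ-true j<d = depart
... | tri≈ _ refl _ | tri≈ _ refl _
  rewrite sc | bd | ≡ᵇ-true (refl {x = j}) | <ᵇ-false (≤-refl {j}) | <ᵇ-true (n<1+n j) = instant
... | tri≈ _ refl _ | tri> _ _ d<j  = contradiction d<j (≤⇒≯ c≤d)
... | tri> _ _ c<j | tri< j<d _ _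
  rewrite remove-other s (>⇒≢ c<j) | remove-other b (<⇒≢ j<d) | ≡ᵇ-false (<⇒≢ j<d) | free j (<⇒≤ c<j) j<d
        | <ᵇ-true c<j | <ᵇ-true (m<n⇒m<1+n c<j) | <ᵇ-true (m<n⇒m<1+n j<d) | <ᵇ-true j<d = pass
... | tri> _ _ c<j | tri≈ _ refl _
  rewrite remove-other s (>⇒≢ c<j) | bd | ≡ᵇ-true (refl {x = j})
        | <ᵇ-true c<j | <ᵇ-true (m<n⇒m<1+n c<j) | <ᵇ-true (n<1+n j) | <ᵇ-false (≤-refl {j}) = settle
... | tri> _ _ c<j | tri> _ _ d<j
  rewrite remove-other s (>⇒≢ c<j) | remove-other b (>⇒≢ d<j) | ≡ᵇ-false (>⇒≢ d<j)
        | <ᵇ-true c<j | <ᵇ-true (m<n⇒m<1+n c<j) | <ᵇ-false d<j | <ᵇ-false (<⇒≤ d<j) = absent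
local-target {s} {b} {c = c} {d} sc (wrapped d<c bd before after) j j<n with <-cmp j c | <-cmp j d
... | tri< j<c _ _ | tri< j<d _ _
  rewrite remove-other s (<⇒≢ j<c) | remove-other b (<⇒≢ j<d) | ≡ᵇ-false (<⇒≢ j<d) | before j j<d
        | <ᵇ-false (<⇒≤ j<c) | <ᵇ-false j<c | <ᵇ-true (m<n⇒m<1+n j<d) | <ᵇ-true j<d = pass
... | tri< j<c _ _ | tri≈ _ refl _
  rewrite remove-other s (<⇒≢ j<c) | bd | ≡ᵇ-true (refl {x = j})
        | <ᵇ-false (<⇒≤ j<c) | <ᵇ-false j<c | <ᵇ-true (n<1+n j) | <ᵇ-false (≤-refl {j}) = settle
... | tri< j<c _ _ | tri> _ _ d<j
  rewrite remove-other s (<⇒≢ j<c) | remove-other b (>⇒≢ d<j) | ≡ᵇ-false (>⇒≢ d<j)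
        | <ᵇ-false (<⇒≤ j<c) | <ᵇ-false j<c | <ᵇ-false d<j | <ᵇ-false (<⇒≤ d<j) = absent
... | tri≈ _ refl _ | tri< j<d _ _ = contradiction (<-trans j<d d<c) (<-irrefl refl)
... | tri≈ _ refl _ | tri≈ _ refl _ = contradiction d<c (<-irrefl refl)
... | tri≈ _ refl _ | tri> _ _ d<j
  rewrite sc | after j ≤-refl j<n | ≡ᵇ-true (refl {x = j}) | ≡ᵇ-false (>⇒≢ d<j)
        | <ᵇ-false (≤-refl {j}) | <ᵇ-true (n<1+n j) | <ᵇ-false d<j = depart
... | tri> _ _ c<j | tri< j<d _ _ = contradiction (<-trans c<j (<-trans j<d d<c)) (<-irrefl refl)
... | tri> _ _ c<j | tri≈ _ refl _ = contradiction (<-trans c<j d<c) (<-irrefl refl)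
... | tri> _ _ c<j | tri> _ _ d<j
  rewrite remove-other s (>⇒≢ c<j) | remove-other b (>⇒≢ d<j) | ≡ᵇ-false (>⇒≢ d<j) | after j (<⇒≤ c<j) j<n
        | <ᵇ-true c<j | <ᵇ-true (m<n⇒m<1+n c<j) = pass

-- Only numbers of customers are recorded, so the ball `d` may be credited to the customer from `c`
-- even if others wait for it too. There is no ball on the way, so removing the pair lowers the
-- queue by one exactly along the journey.
carry-remove : ∀ {s b n c d ω} → s c ≡ true → Target b n c d ω → ∀ q j → j ≤ n →
  carry s b (q + travelling ω c d 0) j ≡ carry (remove s c) (remove b d) q j + travelling ω c d j
carry-remove sc t q zero    _ = refl
carry-remove {s} {b} sc t q (suc j) h rewrite carry-remove {s} {b} sc t q j (<⇒≤ h) =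
  local-carry (local-target {s} sc t j h) _

taken-remove : ∀ {s b n c d ω} → s c ≡ true → Target b n c d ω → ∀ q j → j < n →
  taken s b (q + travelling ω c d 0) j ≡ taken (remove s c) (remove b d) q j ∨ (j ≡ᵇ d)
taken-remove {s} {b} {c = c} {d} sc t q j h rewrite carry-remove {s} {b} sc t q j (<⇒≤ h) =
  local-taken (local-target {s} sc t j h) (carry (remove s c) (remove b d) q j)

travelling-start : ∀ {b n c d ω} → Target b n c d ω → travelling ω c d 0 ≡ bit ω
travelling-start (direct _ _ _ _)  = refl
travelling-start (wrapped _ _ _ _) = refl

travelling-end : ∀ {b n c d ω} → c < n → Target b n c d ω → travelling ω c d n ≡ bit ω
travelling-end h (direct _ d<n _ _) rewrite <ᵇ-true h | <ᵇ-false d<n = refl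
travelling-end h (wrapped _ _ _ _)  rewrite <ᵇ-true h = refl

carry-positive : ∀ {s b n c q} → s c ≡ true → (∀ j → c ≤ j → j < n → b j ≡ false) → ∀ j → c < j → j ≤ n → 1 ≤ carry s b q j
carry-positive {s} {b} {c = c} {q} sc free (suc j) c<j j≤n rewrite free j (s≤s⁻¹ c<j) j≤n with m≤n⇒m<n∨m≡n (s≤s⁻¹ c<j)
... | inj₂ refl rewrite sc = m≤n+m 1 (carry s b q c)
... | inj₁ h = ≤-trans (carry-positive {s} {b} sc free j h (<⇒≤ j≤n)) (m≤m+n _ (bit (s j)))

prefixed-≥ : ∀ {s b n c d ω q} → s c ≡ true → c < n → Target b n c d ω → carry s b q n ≤ q → bit ω ≤ q
prefixed-≥ sc c<n (direct _ _ _ _) h = z≤n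
prefixed-≥ {s} {b} sc c<n (wrapped _ _ _ free) h = ≤-trans (carry-positive {s} {b} sc free _ c<n ≤-refl) h

-- The pre-fixed values of the two systems correspond by adding `bit ω`. Every value arises this
-- way: a customer that meets no ball before the last column forces at least one wrap.
Least-remove : ∀ {s b n c d ω q} → s c ≡ true → c < n → Target b n c d ω →
  Least (remove s c) (remove b d) n q → Least s b n (q + bit ω)
Least-remove {s} {b} {n} {c} {d} {ω} {q} sc c<n t (p , m) =
  subst (_≤ q + bit ω) (sym (shift q)) (+-monoˡ-≤ (bit ω) p) , least
  where
  shift : ∀ q → carry s b (q + bit ω) n ≡ carry (remove s c) (remove b d) q n + bit ω
  shift q = subst₂ (λ x y → carry s b (q + x) n ≡ carry (remove s c) (remove b d) q n + y)
    (travelling-start t) (travelling-end c<n t) (carry-remove {s} sc t q n ≤-refl)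
  least : ∀ q′ → carry s b q′ n ≤ q′ → q + bit ω ≤ q′
  least q′ h = subst (q + bit ω ≤_) e (+-monoˡ-≤ (bit ω) (m q″ (+-cancelʳ-≤ (bit ω) _ q″
      (subst₂ _≤_ (trans (cong (λ x → carry s b x n) (sym e)) (shift q″)) (sym e) h))))
    where
    q″ = q′ ∸ bit ω
    e : q″ + bit ω ≡ q′
    e = m∸n+n≡m (prefixed-≥ {s} {b} sc c<n t h)

taken-remove′ : ∀ {s b n c d ω} → s c ≡ true → Target b n c d ω → ∀ q j → j < n →
  taken s b (q + bit ω) j ≡ taken (remove s c) (remove b d) q j ∨ (j ≡ᵇ d)
taken-remove′ {s} {b} {c = c} {d} sc t q j h =
  subst (λ x → taken s b (q + x) j ≡ taken (remove s c) (remove b d) q j ∨ (j ≡ᵇ d)) (travelling-start t) (taken-remove {s} sc t q j h)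

sumTo : ℕ → (ℕ → ℕ) → ℕ
sumTo zero    f = 0
sumTo (suc n) f = sumTo n f + f (suc n)

∨-∧-not : ∀ x y → (x ≡ true → y ≡ false) → x ≡ (x ∨ y) ∧ not y
∨-∧-not false false h = refl
∨-∧-not false true  h = refl
∨-∧-not true  false h = refl
∨-∧-not true  true  h = h refl

-- At each row the larger system takes the same balls as the smaller one and in addition the ball of
-- the path, which is the customer to be removed in the next row.
Wraps-remove-path : ∀ {B B′ n} {π : ℕ → ℕ} {ω : ℕ → Bool} r {s s′ f} →
  (∀ k → 1 ≤ k → k ≤ r → Target (B k) n (π (suc k)) (π k) (ω k)) →
  (∀ k j → 1 ≤ k → k ≤ r → j < n → B′ k j ≡ remove (B k) (π k) j) →
  s (π (suc r)) ≡ true → π (suc r) < n → (∀ j → j < n → s′ j ≡ remove s (π (suc r)) j) →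
  Wraps B′ n r s′ f → Wraps B n r s (f + sumTo r (bit ∘ ω))
Wraps-remove-path zero ht hB sc c<n hs base = base
Wraps-remove-path {B} {B′} {n} {π} {ω} (suc r) {s} {s′} ht hB sc c<n hs (step {q = q} {f} l w) =
  subst (Wraps B n (suc r) s) arith (step (Least-remove {s} sc c<n t l′) rest)
  where
  t : Target (B (suc r)) n (π (suc (suc r))) (π (suc r)) (ω (suc r))
  t = ht (suc r) (s≤s z≤n) ≤-refl
  hb : ∀ j → j < n → B′ (suc r) j ≡ remove (B (suc r)) (π (suc r)) j
  hb j = hB (suc r) j (s≤s z≤n) ≤-refl
  l′ : Least (remove s (π (suc (suc r)))) (remove (B (suc r)) (π (suc r))) n q
  l′ = Least-cong hs hb l
  d<n = target-< c<n t
  s₁ = taken s (B (suc r)) (q + bit (ω (suc r)))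
  taken₁ = taken (remove s (π (suc (suc r)))) (remove (B (suc r)) (π (suc r))) q
  at-d : s₁ (π (suc r)) ≡ true
  at-d = trans (taken-remove′ {s} sc t q (π (suc r)) d<n) (trans (cong (taken₁ (π (suc r)) ∨_) (≡ᵇ-true (refl {x = π (suc r)}))) (∨-zeroʳ _))
  marks : ∀ j → j < n → taken s′ (B′ (suc r)) q j ≡ remove s₁ (π (suc r)) j
  marks j h rewrite taken-remove′ {s} sc t q j h | taken-cong q hs hb j h =
    ∨-∧-not (taken₁ j) (j ≡ᵇ π (suc r)) λ e → case j ≟ π (suc r) of λ where
      (no ne)    → ≡ᵇ-false ne
      (yes refl) → contradiction (trans (sym (proj₁ (∧-true e))) (remove-at (B (suc r)) {j})) λ ()
  rest : Wraps B n r s₁ (f + sumTo r (bit ∘ ω))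
  rest = Wraps-remove-path r (λ k h h′ → ht k h (m≤n⇒m≤1+n h′)) (λ k j h h′ → hB k j h (m≤n⇒m≤1+n h′)) at-d d<n marks w
  arith : q + bit (ω (suc r)) + (f + sumTo r (bit ∘ ω)) ≡ q + f + (sumTo r (bit ∘ ω) + bit (ω (suc r)))
  arith = solve 4 (λ a b c d → a :+ b :+ (c :+ d) := a :+ c :+ (d :+ b)) refl q (bit (ω (suc r))) f (sumTo r (bit ∘ ω))
    where open +-*-Solver

-- Ferrari–Martin pairing

Increasing : List ℕ → Set
Increasing = AllPairs _<_

≡ᵇ-sound : ∀ {m n} → (m ≡ᵇ n) ≡ true → m ≡ n
≡ᵇ-sound {m} {n} e = ≡ᵇ⇒≡ m n (Equivalence.from T-≡ e)

≤ᵇ-sound : ∀ {m n} → (m ≤ᵇ n) ≡ true → m ≤ n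
≤ᵇ-sound {m} {n} e = ≤ᵇ⇒≤ m n (Equivalence.from T-≡ e)

mem-++ : ∀ x xs ys → memℕ x (xs ++ ys) ≡ memℕ x xs ∨ memℕ x ys
mem-++ x []       ys = refl
mem-++ x (y ∷ xs) ys with x ≡ᵇ y
... | true  = refl
... | false = mem-++ x xs ys

mem-filter : ∀ (p : ℕ → Bool) x xs → memℕ x (filterᵇ p xs) ≡ memℕ x xs ∧ p x
mem-filter p x [] = refl
mem-filter p x (y ∷ xs) with p y in py | x ≟ y
... | true  | yes refl rewrite ≡ᵇ-true (refl {x = x}) = sym py
... | true  | no ne rewrite ≡ᵇ-false ne = mem-filter p x xs
... | false | yes refl rewrite ≡ᵇ-true (refl {x = x}) = trans (mem-filter p x xs) (trans (cong (memℕ x xs ∧_) py) (trans (∧-zeroʳ _) (sym py)))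
... | false | no ne rewrite ≡ᵇ-false ne = mem-filter p x xs

mem-All : ∀ {P : ℕ → Set} {x xs} → All P xs → memℕ x xs ≡ true → P x
mem-All {x = x} {y ∷ xs} (p ∷ ps) e with x ≡ᵇ y in eq
... | true  rewrite ≡ᵇ-sound {x} {y} eq = p
... | false = mem-All ps e

mem-none : ∀ {x xs} → All (x ≢_) xs → memℕ x xs ≡ false
mem-none []       = refl
mem-none (h ∷ hs) rewrite ≡ᵇ-false h = mem-none hs

¬true⇒false : ∀ {b} → ¬ b ≡ true → b ≡ false
¬true⇒false {false} h = refl
¬true⇒false {true}  h = contradiction refl h

All-filter : ∀ {A : Set} {P : A → Set} (p : A → Bool) {xs} → All P xs → All P (filterᵇ p xs)
All-filter p [] = []
All-filter p {x ∷ _} (h ∷ hs) with p x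
... | true  = h ∷ All-filter p hs
... | false = All-filter p hs

AllPairs-filter : ∀ {A : Set} {R : A → A → Set} (p : A → Bool) {xs} → AllPairs R xs → AllPairs R (filterᵇ p xs)
AllPairs-filter p [] = []
AllPairs-filter p {x ∷ _} (h ∷ hs) with p x
... | true  = All-filter p h ∷ AllPairs-filter p hs
... | false = AllPairs-filter p hs

filter-cong : ∀ {A : Set} {p q : A → Bool} {xs} → All (λ x → p x ≡ q x) xs → filterᵇ p xs ≡ filterᵇ q xs
filter-cong [] = refl
filter-cong {p = p} {q} {x ∷ _} (h ∷ hs) rewrite h with q x
... | true  = cong (x ∷_) (filter-cong hs)
... | false = filter-cong hs

filter-all : ∀ {A : Set} {p : A → Bool} {xs} → All (λ x → p x ≡ true) xs → filterᵇ p xs ≡ xs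
filter-all [] = refl
filter-all {xs = x ∷ _} (h ∷ hs) rewrite h = cong (x ∷_) (filter-all hs)

length-filter-remove : ∀ {p : ℕ → Bool} {xs j} → Increasing xs → memℕ j xs ≡ true → p j ≡ true →
  length (filterᵇ p xs) ≡ suc (length (filterᵇ (remove p j) xs))
length-filter-remove {p} {x ∷ xs} {j} (h ∷ hs) e pj with j ≟ x
... | yes refl rewrite remove-at p {j} | pj =
  cong (suc ∘ length) (filter-cong (All.map (λ j<i → sym (remove-other p (>⇒≢ j<i))) h))
... | no ne rewrite ≡ᵇ-false ne | remove-other p {j} {x} (ne ∘ sym) with p x
...   | true  = cong suc (length-filter-remove hs e pj)
...   | false = length-filter-remove hs e pj

posFrom-≥ : ∀ i bs → All (i ≤_) (posFrom i bs)
posFrom-≥ i []           = []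
posFrom-≥ i (true ∷ bs)  = ≤-refl ∷ All.map <⇒≤ (posFrom-≥ (suc i) bs)
posFrom-≥ i (false ∷ bs) = All.map <⇒≤ (posFrom-≥ (suc i) bs)

posFrom-increasing : ∀ i bs → Increasing (posFrom i bs)
posFrom-increasing i []           = []
posFrom-increasing i (true ∷ bs)  = posFrom-≥ (suc i) bs ∷ posFrom-increasing (suc i) bs
posFrom-increasing i (false ∷ bs) = posFrom-increasing (suc i) bs

mem-posFrom : ∀ i bs k → memℕ (i + k) (posFrom i bs) ≡ lookupB bs k
mem-posFrom i []           k       = refl
mem-posFrom i (true ∷ bs)  zero    rewrite ≡ᵇ-true (+-identityʳ i) = refl
mem-posFrom i (false ∷ bs) zero    = mem-none (All.map (λ h e → <-irrefl refl (subst (suc i ≤_) (trans (sym e) (+-identityʳ i)) h)) (posFrom-≥ (suc i) bs))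
mem-posFrom i (true ∷ bs)  (suc k) rewrite ≡ᵇ-false (λ e → m≢1+m+n i (trans (sym e) (+-suc i k))) | +-suc i k = mem-posFrom (suc i) bs k
mem-posFrom i (false ∷ bs) (suc k) rewrite +-suc i k = mem-posFrom (suc i) bs k

mem-positions : ∀ bs j → memℕ j (positions bs) ≡ lookupB bs j
mem-positions = mem-posFrom 0

positions-increasing : ∀ bs → Increasing (positions bs)
positions-increasing = posFrom-increasing 0

lookupB-< : ∀ bs j → lookupB bs j ≡ true → j < length bs
lookupB-< (b ∷ bs) zero    e = s≤s z≤n
lookupB-< (b ∷ bs) (suc j) e = s≤s (lookupB-< bs j e)

mem-self : ∀ xs → All (λ x → memℕ x xs ≡ true) xs
mem-self []       = []
mem-self (x ∷ xs) = cong (_∨ memℕ x xs) (≡ᵇ-true (refl {x = x}))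
  ∷ All.map (λ {y} e → trans (cong ((y ≡ᵇ x) ∨_) e) (∨-zeroʳ _)) (mem-self xs)

firstGeq-just : ∀ {c xs j} → Increasing xs → firstGeq c xs ≡ just j →
  c ≤ j × memℕ j xs ≡ true × (∀ i → c ≤ i → i < j → memℕ i xs ≡ false)
firstGeq-just {c} {x ∷ xs} {j} (h ∷ hs) e with c ≤ᵇ x in le?
firstGeq-just {c} {x ∷ xs} {.x} (h ∷ hs) refl | true =
  ≤ᵇ-sound le? , cong (_∨ memℕ x xs) (≡ᵇ-true (refl {x = x})) ,
  λ i _ i<x → mem-none ((<⇒≢ i<x) ∷ All.map (λ x<y → <⇒≢ (<-trans i<x x<y)) h)
... | false with firstGeq-just hs e
...   | p , q , r = p , trans (cong ((j ≡ᵇ x) ∨_) q) (∨-zeroʳ _) ,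
        λ i c≤i i<j → trans (cong (_∨ memℕ i xs) (≡ᵇ-false {i} {x} λ { refl → contradiction (trans (sym (≤ᵇ-true c≤i)) le?) λ () })) (r i c≤i i<j)

firstGeq-nothing : ∀ {c xs} → firstGeq c xs ≡ nothing → ∀ i → c ≤ i → memℕ i xs ≡ false
firstGeq-nothing {c} {[]} e i c≤i = refl
firstGeq-nothing {c} {x ∷ xs} e i c≤i with c ≤ᵇ x in le?
... | false = trans (cong (_∨ memℕ i xs) (≡ᵇ-false {i} {x} λ { refl → contradiction (trans (sym (≤ᵇ-true c≤i)) le?) λ () })) (firstGeq-nothing {c} {xs} e i c≤i)

findTarget-sound : ∀ {b n c j w} xs → Increasing xs → (∀ i → memℕ i xs ≡ b i) → (∀ i → b i ≡ true → i < n) →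
  findTarget c xs ≡ just (j , w) → Target b n c j w
findTarget-sound {c = c} xs inc hb bd e with firstGeq c xs in eq
findTarget-sound {c = c} xs inc hb bd refl | just j with firstGeq-just inc eq
... | p , q , r = direct p (bd j (trans (sym (hb j)) q)) (trans (sym (hb j)) q) (λ i h h′ → trans (sym (hb i)) (r i h h′))
findTarget-sound {c = c} (j ∷ xs) (h ∷ inc) hb bd refl | nothing =
  wrapped j<c bj (λ i i<j → trans (sym (hb i)) (mem-none (<⇒≢ i<j ∷ All.map (λ j<y → <⇒≢ (<-trans i<j j<y)) h)))
    (λ i c≤i _ → trans (sym (hb i)) (none i c≤i))
  where
  none = firstGeq-nothing {c} {j ∷ xs} eq
  here : memℕ j (j ∷ xs) ≡ true
  here = cong (_∨ memℕ j xs) (≡ᵇ-true (refl {x = j}))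
  bj = trans (sym (hb j)) here
  j<c : j < c
  j<c = ≰⇒> λ c≤j → contradiction (trans (sym here) (none j c≤j)) λ ()

findTarget-nothing : ∀ {c} xs → findTarget c xs ≡ nothing → xs ≡ []
findTarget-nothing {c} xs e with firstGeq c xs
findTarget-nothing []  e | nothing = refl

marked : ℕ → List Lab → ℕ → Bool
marked t []            j = false
marked t ((c , ℓ) ∷ x) j = ((t ≤ᵇ ℓ) ∧ (j ≡ᵇ c)) ∨ marked t x j

marked-small : ∀ {t xs} → All (λ x → proj₂ x < t) xs → ∀ j → marked t xs j ≡ false
marked-small []       j = refl
marked-small (h ∷ hs) j rewrite ≤ᵇ-false h = marked-small hs j

marked-++ : ∀ t xs ys j → marked t (xs ++ ys) j ≡ marked t xs j ∨ marked t ys j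
marked-++ t []             ys j = refl
marked-++ t ((c , ℓ) ∷ xs) ys j with (t ≤ᵇ ℓ) ∧ (j ≡ᵇ c)
... | true  = refl
... | false = marked-++ t xs ys j

marked-large : ∀ {t xs} → All (λ x → t ≤ proj₂ x) xs → ∀ j → marked t xs j ≡ memℕ j (map proj₁ xs)
marked-large []       j = refl
marked-large {xs = (c , ℓ) ∷ xs} (h ∷ hs) j rewrite ≤ᵇ-true h = cong ((j ≡ᵇ c) ∨_) (marked-large hs j)

marked-mem : ∀ t xs j → memℕ j (map proj₁ xs) ≡ false → marked t xs j ≡ false
marked-mem t []             j e = refl
marked-mem t ((c , ℓ) ∷ xs) j e with j ≡ᵇ c
... | false rewrite ∧-zeroʳ (t ≤ᵇ ℓ) = marked-mem t xs j e

sumTo-cong : ∀ n {f g : ℕ → ℕ} → (∀ t → 1 ≤ t → t ≤ n → f t ≡ g t) → sumTo n f ≡ sumTo n g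
sumTo-cong zero    h = refl
sumTo-cong (suc n) h = cong₂ _+_ (sumTo-cong n (λ t p q → h t p (m≤n⇒m≤1+n q))) (h (suc n) (s≤s z≤n) ≤-refl)

sumTo-+ : ∀ n (f g : ℕ → ℕ) → sumTo n (λ t → f t + g t) ≡ sumTo n f + sumTo n g
sumTo-+ zero    f g = refl
sumTo-+ (suc n) f g rewrite sumTo-+ n f g =
  solve 4 (λ a b c d → a :+ b :+ (c :+ d) := a :+ c :+ (b :+ d)) refl (sumTo n f) (sumTo n g) (f (suc n)) (g (suc n))
  where open +-*-Solver

sumTo-0 : ∀ n → sumTo n (λ _ → 0) ≡ 0
sumTo-0 zero    = refl
sumTo-0 (suc n) = trans (+-identityʳ _) (sumTo-0 n)

within : ℕ → ℕ → ℕ → ℕ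
within r ℓ t = bit ((r ≤ᵇ t) ∧ (t ≤ᵇ ℓ))

sumTo-within : ∀ {r ℓ} L → 1 ≤ r → r ≤ ℓ → ℓ ≤ L → sumTo L (within r ℓ) ≡ ℓ + 1 ∸ r
sumTo-within {r} {ℓ} L 1≤r r≤ℓ ℓ≤L with m≤n⇒∃[o]m+o≡n ℓ≤L
... | k , refl = trans (cong (λ m → sumTo m (within r ℓ)) (+-comm ℓ k)) (trans (above k) (upto ℓ ≤-refl))
  where
  above : ∀ k → sumTo (k + ℓ) (within r ℓ) ≡ sumTo ℓ (within r ℓ)
  above zero    = refl
  above (suc k) rewrite ≤ᵇ-false {suc k + ℓ} {ℓ} (s≤s (m≤n+m ℓ k)) | ∧-zeroʳ (r ≤ᵇ suc k + ℓ) =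
    trans (+-identityʳ _) (above k)
  upto : ∀ m → m ≤ ℓ → sumTo m (within r ℓ) ≡ m + 1 ∸ r
  upto zero    _ = sym (m≤n⇒m∸n≡0 1≤r)
  upto (suc m) h rewrite upto m (<⇒≤ h) | ≤ᵇ-true h with r ≤? suc m
  ... | yes p rewrite ≤ᵇ-true p | +-comm m 1 = trans (+-comm (suc m ∸ r) 1) (sym (+-∸-assoc 1 p))
  ... | no p rewrite ≤ᵇ-false (≰⇒> p) | +-comm m 1 | m≤n⇒m∸n≡0 (<⇒≤ (≰⇒> p)) | m≤n⇒m∸n≡0 (≰⇒> p) = refl

unused : List Lab → ℕ → Bool
unused acc j = not (memℕ j (map proj₁ acc))

freeIn : List Lab → List Bool → List ℕ
freeIn acc row′ = filterᵇ (unused acc) (positions row′)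

isFree : List Lab → List Bool → ℕ → Bool
isFree acc row′ j = lookupB row′ j ∧ unused acc j

mem-freeIn : ∀ acc row′ j → memℕ j (freeIn acc row′) ≡ isFree acc row′ j
mem-freeIn acc row′ j = trans (mem-filter (unused acc) j (positions row′)) (cong (_∧ unused acc j) (mem-positions row′ j))

unused-snoc : ∀ acc j ℓ i → unused (acc ++ [ j , ℓ ]) i ≡ remove (unused acc) j i
unused-snoc acc j ℓ i rewrite map-++ proj₁ acc [ j , ℓ ] | mem-++ i (map proj₁ acc) [ j ] with memℕ i (map proj₁ acc)
... | true  = refl
... | false = cong not (∨-identityʳ (i ≡ᵇ j))

isFree-snoc : ∀ acc row′ j ℓ i → isFree (acc ++ [ j , ℓ ]) row′ i ≡ remove (isFree acc row′) j i
isFree-snoc acc row′ j ℓ i rewrite unused-snoc acc j ℓ i with lookupB row′ i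
... | true  = refl
... | false = refl

pairAll-just : ∀ r c ℓ rest row′ acc {j w} → findTarget c (freeIn acc row′) ≡ just (j , w) →
  let P = pairAll r rest row′ (acc ++ [ j , ℓ ]) in
  pairAll r ((c , ℓ) ∷ rest) row′ acc ≡ (proj₁ P , (if w then ℓ + 1 ∸ r else 0) + proj₂ P)
pairAll-just r c ℓ rest row′ acc e with findTarget c (freeIn acc row′)
pairAll-just r c ℓ rest row′ acc refl | just (j , w) = refl

DistinctColumns : List Lab → Set
DistinctColumns = AllPairs (λ x y → proj₁ x ≢ proj₁ y)

Descending : List Lab → Set
Descending = AllPairs (λ x y → proj₂ y ≤ proj₂ x)

-- `wraps t` counts the wraps of balls with label at least `t`. Only thresholds t ≥ r enter the
-- total, since the customers of threshold t begin their descent in row t.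
record Paired (r L : ℕ) (list : List Lab) (row′ : List Bool) (acc : List Lab) : Set where
  field
    new      : List Lab
    wraps    : ℕ → ℕ
    labelled : proj₁ (pairAll r list row′ acc) ≡ acc ++ new
    total    : proj₂ (pairAll r list row′ acc) ≡ sumTo L (λ t → if r ≤ᵇ t then wraps t else 0)
    least    : ∀ t → Least (marked t list) (isFree acc row′) (length row′) (wraps t)
    reached  : ∀ t j → j < length row′ → taken (marked t list) (isFree acc row′) (wraps t) j ≡ marked t new j
    labels   : map proj₂ new ≡ map proj₂ list
    distinct : DistinctColumns new
    free     : All (λ x → isFree acc row′ (proj₁ x) ≡ true) new

if-+ : ∀ b {x y : ℕ} → (if b then x + y else 0) ≡ (if b then x else 0) + (if b then y else 0)
if-+ true  = refl
if-+ false = refl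

Least-none⁻ : ∀ {s b n q} → (∀ j → j < n → s j ≡ false) → Least s b n q → q ≡ 0
Least-none⁻ {s} {b} h (_ , m) = n≤0⇒n≡0 (m 0 (proj₁ (proj₁ (Least-none {s} {b} h))))

findTarget-exists : ∀ c xs → 1 ≤ length xs → ∃ λ x → findTarget c xs ≡ just x
findTarget-exists c xs h with findTarget c xs in eq
... | just x  = x , refl
... | nothing = contradiction (subst (λ l → 1 ≤ length l) (findTarget-nothing xs eq) h) λ ()

-- Labels decrease along the list. For `t ≤ ℓ` the head is a customer and its pairing is split off
-- by `Least-remove`; for `t > ℓ` the list has no customers at all and every count vanishes.
-- Comparing lengths guarantees that a free ball always remains.
pairAll-spec : ∀ r L row′ list acc → 1 ≤ r → DistinctColumns list → Descending list →
  All (λ x → proj₁ x < length row′) list → All (λ x → r ≤ proj₂ x × proj₂ x ≤ L) list →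
  length list ≤ length (freeIn acc row′) → Paired r L list row′ acc
pairAll-spec r L row′ [] acc 1≤r _ _ _ _ _ = record
  { new      = []
  ; wraps    = λ _ → 0
  ; labelled = sym (++-identityʳ acc)
  ; total    = sym (trans (sumTo-cong L (λ t _ _ → if-0 (r ≤ᵇ t))) (sumTo-0 L))
  ; least    = λ t → proj₁ (Least-none {marked t []} {isFree acc row′} {length row′} (λ _ _ → refl))
  ; reached  = λ t → proj₂ (Least-none {marked t []} {isFree acc row′} {length row′} (λ _ _ → refl))
  ; labels   = refl
  ; distinct = []
  ; free     = []
  }
  where
  if-0 : ∀ b → (if b then 0 else 0) ≡ 0
  if-0 true  = refl
  if-0 false = refl
pairAll-spec r L row′ ((c , ℓ) ∷ rest) acc 1≤r (dc ∷ dist) (dl ∷ desc) (c<n ∷ cs) ((r≤ℓ , ℓ≤L) ∷ ls) len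
  with findTarget-exists c (freeIn acc row′) (≤-trans (s≤s z≤n) len)
... | (j , w) , eq = record
  { new      = (j , ℓ) ∷ new
  ; wraps    = wraps′
  ; labelled = trans (cong proj₁ (pairAll-just r c ℓ rest row′ acc eq)) (trans labelled (++-assoc acc [ j , ℓ ] new))
  ; total    = trans (cong proj₂ (pairAll-just r c ℓ rest row′ acc eq)) total′
  ; least    = least′
  ; reached  = reached′
  ; labels   = cong (ℓ ∷_) labels
  -- Every later target is still free after `j` has been used, hence differs from `j`.
  ; distinct = All.map (λ {x} f e → true≢false (trans (sym f) (trans (isFree-snoc acc row′ j ℓ (proj₁ x)) (trans (cong (remove b j) (sym e)) (remove-at b {j}))))) free ∷ distinct
  ; free     = target-ball target ∷ All.map (λ {x} f → proj₁ (∧-true (trans (sym (isFree-snoc acc row′ j ℓ (proj₁ x))) f))) free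
  }
  where
  b = isFree acc row′
  n = length row′
  target : Target b n c j w
  target = findTarget-sound (freeIn acc row′) (AllPairs-filter (unused acc) (positions-increasing row′))
    (mem-freeIn acc row′) (λ i e → lookupB-< row′ i (proj₁ (∧-true e))) eq
  true≢false : ¬ true ≡ false
  true≢false ()
  b-j : b j ≡ true
  b-j = target-ball target
  len′ : length rest ≤ length (freeIn (acc ++ [ j , ℓ ]) row′)
  len′ = s≤s⁻¹ (≤-trans len (≤-reflexive (trans
    (length-filter-remove (positions-increasing row′) (trans (mem-positions row′ j) (proj₁ (∧-true b-j))) (proj₂ (∧-true {lookupB row′ j} b-j)))
    (cong (suc ∘ length) (filter-cong (All.universal (λ i → sym (unused-snoc acc j ℓ i)) (positions row′)))))))
  open Paired (pairAll-spec r L row′ rest (acc ++ [ j , ℓ ]) 1≤r dist desc cs ls len′)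
  wraps′ : ℕ → ℕ
  wraps′ t = wraps t + (if t ≤ᵇ ℓ then bit w else 0)
  total′ : (if w then ℓ + 1 ∸ r else 0) + proj₂ (pairAll r rest row′ (acc ++ [ j , ℓ ])) ≡
           sumTo L (λ t → if r ≤ᵇ t then wraps′ t else 0)
  total′ = sym (begin
    sumTo L (λ t → if r ≤ᵇ t then wraps′ t else 0)
      ≡⟨ sumTo-cong L (λ t _ _ → if-+ (r ≤ᵇ t)) ⟩
    sumTo L (λ t → (if r ≤ᵇ t then wraps t else 0) + (if r ≤ᵇ t then (if t ≤ᵇ ℓ then bit w else 0) else 0))
      ≡⟨ sumTo-+ L _ _ ⟩
    sumTo L (λ t → if r ≤ᵇ t then wraps t else 0) + sumTo L (λ t → if r ≤ᵇ t then (if t ≤ᵇ ℓ then bit w else 0) else 0)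
      ≡⟨ cong₂ _+_ (sym total) (own w) ⟩
    proj₂ (pairAll r rest row′ (acc ++ [ j , ℓ ])) + (if w then ℓ + 1 ∸ r else 0)
      ≡⟨ +-comm _ (if w then ℓ + 1 ∸ r else 0) ⟩
    (if w then ℓ + 1 ∸ r else 0) + proj₂ (pairAll r rest row′ (acc ++ [ j , ℓ ])) ∎)
    where
    open ≡-Reasoning
    own : ∀ w → sumTo L (λ t → if r ≤ᵇ t then (if t ≤ᵇ ℓ then bit w else 0) else 0) ≡ (if w then ℓ + 1 ∸ r else 0)
    own false = trans (sumTo-cong L (λ t _ _ → zero-if (r ≤ᵇ t) (t ≤ᵇ ℓ))) (sumTo-0 L)
      where
      zero-if : ∀ x y → (if x then (if y then 0 else 0) else 0) ≡ 0
      zero-if true  true  = refl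
      zero-if true  false = refl
      zero-if false _     = refl
    own true = trans (sumTo-cong L (λ t _ _ → one-if (r ≤ᵇ t) (t ≤ᵇ ℓ))) (sumTo-within L 1≤r r≤ℓ ℓ≤L)
      where
      one-if : ∀ x y → (if x then (if y then 1 else 0) else 0) ≡ bit (x ∧ y)
      one-if true  true  = refl
      one-if true  false = refl
      one-if false _     = refl
  c∉rest : ∀ t → marked t rest c ≡ false
  c∉rest t = marked-mem t rest c (mem-none (map⁺ dc))
  none : ∀ {t} → ℓ < t → ∀ i → marked t rest i ≡ false
  none ℓ<t = marked-small (All.map (λ h → ≤-<-trans h ℓ<t) dl)
  small : ∀ t → ℓ < t → wraps t ≡ 0
  small t ℓ<t = Least-none⁻ {marked t rest} {isFree (acc ++ [ j , ℓ ]) row′} {n} (λ i _ → none ℓ<t i) (least t)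
  s : ℕ → ℕ → Bool
  s t = marked t ((c , ℓ) ∷ rest)
  s-c : ∀ {t} → t ≤ ℓ → s t c ≡ true
  s-c t≤ℓ rewrite ≤ᵇ-true t≤ℓ | ≡ᵇ-true (refl {x = c}) = refl
  s-rest : ∀ {t} → t ≤ ℓ → ∀ i → marked t rest i ≡ remove (s t) c i
  s-rest {t} t≤ℓ i with i ≟ c
  ... | yes refl = trans (c∉rest t) (sym (remove-at (s t) {i}))
  ... | no ne rewrite remove-other (s t) ne | ≡ᵇ-false ne | ∧-zeroʳ (t ≤ᵇ ℓ) = refl
  s-none : ∀ {t} → ℓ < t → ∀ i → s t i ≡ false
  s-none ℓ<t i rewrite ≤ᵇ-false ℓ<t = none ℓ<t i
  wraps-≤ : ∀ {t} → t ≤ ℓ → wraps′ t ≡ wraps t + bit w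
  wraps-≤ {t} h = cong (λ x → wraps t + (if x then bit w else 0)) (≤ᵇ-true h)
  wraps-> : ∀ {t} → ℓ < t → wraps′ t ≡ 0
  wraps-> {t} h = cong₂ (λ x y → x + (if y then bit w else 0)) (small t h) (≤ᵇ-false h)
  least′ : ∀ t → Least (s t) b n (wraps′ t)
  least′ t with t ≤? ℓ
  ... | yes t≤ℓ = subst (Least (s t) b n) (sym (wraps-≤ t≤ℓ)) (Least-remove {s t} (s-c t≤ℓ) c<n target
          (Least-cong {n = n} (λ i _ → s-rest t≤ℓ i) (λ i _ → isFree-snoc acc row′ j ℓ i) (least t)))
  ... | no t≰ℓ = subst (Least (s t) b n) (sym (wraps-> (≰⇒> t≰ℓ))) (proj₁ (Least-none {s t} {b} {n} (λ i _ → s-none (≰⇒> t≰ℓ) i)))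
  reached′ : ∀ t i → i < n → taken (s t) b (wraps′ t) i ≡ marked t ((j , ℓ) ∷ new) i
  reached′ t i i<n with t ≤? ℓ
  ... | yes t≤ℓ = begin
    taken (s t) b (wraps′ t) i
      ≡⟨ cong (λ q → taken (s t) b q i) (wraps-≤ t≤ℓ) ⟩
    taken (s t) b (wraps t + bit w) i
      ≡⟨ taken-remove′ {s t} (s-c t≤ℓ) target (wraps t) i i<n ⟩
    taken (remove (s t) c) (remove b j) (wraps t) i ∨ (i ≡ᵇ j)
      ≡⟨ cong (_∨ (i ≡ᵇ j)) (sym (taken-cong (wraps t) (λ i _ → s-rest t≤ℓ i) (λ i _ → isFree-snoc acc row′ j ℓ i) i i<n)) ⟩
    taken (marked t rest) (isFree (acc ++ [ j , ℓ ]) row′) (wraps t) i ∨ (i ≡ᵇ j)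
      ≡⟨ cong (_∨ (i ≡ᵇ j)) (reached t i i<n) ⟩
    marked t new i ∨ (i ≡ᵇ j)
      ≡⟨ ∨-comm (marked t new i) (i ≡ᵇ j) ⟩
    (i ≡ᵇ j) ∨ marked t new i
      ≡⟨ cong (λ x → (x ∧ (i ≡ᵇ j)) ∨ marked t new i) (≤ᵇ-true t≤ℓ) ⟨
    marked t ((j , ℓ) ∷ new) i ∎
    where open ≡-Reasoning
  ... | no t≰ℓ = trans (cong (λ q → taken (s t) b q i) (wraps-> (≰⇒> t≰ℓ)))
    (trans (proj₂ (Least-none {s t} {b} {n} (λ i _ → s-none (≰⇒> t≰ℓ) i)) i i<n)
      (sym (marked-small (≰⇒> t≰ℓ ∷ map⁻ (subst (All (_< t)) (sym labels) (map⁺ (All.map (λ h → ≤-<-trans h (≰⇒> t≰ℓ)) dl)))) i)))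

-- Sorting and completing the labelled balls of a row

labBefore-true : ∀ x y → labBefore x y ≡ true → proj₂ y ≤ proj₂ x
labBefore-true (c₁ , l₁) (c₂ , l₂) e with l₂ <ᵇ l₁ in lt
... | true  = <⇒≤ (<ᵇ⇒< l₂ l₁ (Equivalence.from T-≡ lt))
... | false = ≤-reflexive (sym (≡ᵇ-sound {l₁} {l₂} (proj₁ (∧-true e))))

labBefore-false : ∀ x y → labBefore x y ≡ false → proj₂ x ≤ proj₂ y
labBefore-false (c₁ , l₁) (c₂ , l₂) e with l₂ <ᵇ l₁ in lt
... | false = ≮⇒≥ λ h → contradiction (trans (sym lt) (<ᵇ-true h)) λ ()

All-insertLab : ∀ {P : Lab → Set} {x} ys → P x → All P ys → All P (insertLab x ys)
All-insertLab [] p [] = p ∷ []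
All-insertLab {x = x} (y ∷ ys) p (q ∷ qs) with labBefore x y
... | true  = p ∷ q ∷ qs
... | false = q ∷ All-insertLab ys p qs

All-sortLab : ∀ {P : Lab → Set} {xs} → All P xs → All P (sortLab xs)
All-sortLab []       = []
All-sortLab (p ∷ ps) = All-insertLab _ p (All-sortLab ps)

distinct-insertLab : ∀ {x} ys → All (λ y → proj₁ x ≢ proj₁ y) ys → DistinctColumns ys → DistinctColumns (insertLab x ys)
distinct-insertLab [] h [] = [] ∷ []
distinct-insertLab {x} (y ∷ ys) (h ∷ hs) (d ∷ ds) with labBefore x y
... | true  = (h ∷ hs) ∷ d ∷ ds
... | false = All-insertLab ys (h ∘ sym) d ∷ distinct-insertLab ys hs ds

distinct-sortLab : ∀ {xs} → DistinctColumns xs → DistinctColumns (sortLab xs)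
distinct-sortLab []       = []
distinct-sortLab (h ∷ hs) = distinct-insertLab _ (All-sortLab h) (distinct-sortLab hs)

descending-insertLab : ∀ {x} ys → Descending ys → Descending (insertLab x ys)
descending-insertLab [] [] = [] ∷ []
descending-insertLab {x} (y ∷ ys) (h ∷ hs) with labBefore x y in eq
... | true  = (y≤x ∷ All.map (λ z≤y → ≤-trans z≤y y≤x) h) ∷ h ∷ hs
  where y≤x = labBefore-true x y eq
... | false = All-insertLab ys (labBefore-false x y eq) h ∷ descending-insertLab ys hs

descending-sortLab : ∀ xs → Descending (sortLab xs)
descending-sortLab []       = []
descending-sortLab (x ∷ xs) = descending-insertLab (sortLab xs) (descending-sortLab xs)

length-insertLab : ∀ x ys → length (insertLab x ys) ≡ suc (length ys)
length-insertLab x [] = refl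
length-insertLab x (y ∷ ys) with labBefore x y
... | true  = refl
... | false = cong suc (length-insertLab x ys)

length-sortLab : ∀ xs → length (sortLab xs) ≡ length xs
length-sortLab []       = refl
length-sortLab (x ∷ xs) = trans (length-insertLab x (sortLab xs)) (cong suc (length-sortLab xs))

∨-swap : ∀ a b c → a ∨ (b ∨ c) ≡ b ∨ (a ∨ c)
∨-swap true  true  c = refl
∨-swap true  false c = refl
∨-swap false b     c = refl

marked-insertLab : ∀ t x ys j → marked t (insertLab x ys) j ≡ marked t (x ∷ ys) j
marked-insertLab t x [] j = refl
marked-insertLab t x@(c , ℓ) (y@(c′ , ℓ′) ∷ ys) j with labBefore x y
... | true  = refl
... | false = trans (cong (((t ≤ᵇ ℓ′) ∧ (j ≡ᵇ c′)) ∨_) (marked-insertLab t x ys j))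
                    (∨-swap ((t ≤ᵇ ℓ′) ∧ (j ≡ᵇ c′)) ((t ≤ᵇ ℓ) ∧ (j ≡ᵇ c)) (marked t ys j))

marked-sortLab : ∀ t xs j → marked t (sortLab xs) j ≡ marked t xs j
marked-sortLab t []             j = refl
marked-sortLab t ((c , ℓ) ∷ xs) j = trans (marked-insertLab t (c , ℓ) (sortLab xs) j) (cong (((t ≤ᵇ ℓ) ∧ (j ≡ᵇ c)) ∨_) (marked-sortLab t xs j))

-- The local `complete` of `majGo`, named so that lemmas can refer to it; the two agree by
-- computation.
complete : ℕ → List Lab → List Bool → List Lab
complete r partial bs = partial ++ map (λ c → c , r) (freeIn partial bs)

length-unused : ∀ xs {ps} → Increasing ps → DistinctColumns xs → All (λ x → memℕ (proj₁ x) ps ≡ true) xs →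
  length xs + length (filterᵇ (unused xs) ps) ≡ length ps
length-unused [] {ps} inc _ _ = cong length (filter-all (All.universal (λ _ → refl) ps))
length-unused ((c , ℓ) ∷ xs) {ps} inc (d ∷ ds) (h ∷ hs) = begin
  suc (length xs + length (filterᵇ (unused ((c , ℓ) ∷ xs)) ps))
    ≡⟨ +-suc (length xs) _ ⟨
  length xs + suc (length (filterᵇ (unused ((c , ℓ) ∷ xs)) ps))
    ≡⟨ cong (λ l → length xs + suc (length l)) (filter-cong (All.universal same ps)) ⟩
  length xs + suc (length (filterᵇ (remove (unused xs) c) ps))
    ≡⟨ cong (length xs +_) (length-filter-remove inc h (cong not (mem-none (map⁺ d)))) ⟨
  length xs + length (filterᵇ (unused xs) ps)
    ≡⟨ length-unused xs inc ds hs ⟩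
  length ps ∎
  where
  open ≡-Reasoning
  same : ∀ j → unused ((c , ℓ) ∷ xs) j ≡ remove (unused xs) c j
  same j with j ≡ᵇ c
  ... | true  = sym (∧-zeroʳ (unused xs j))
  ... | false = sym (∧-identityʳ (unused xs j))

module _ {r L : ℕ} {bs : List Bool} {partial : List Lab} (distinct : DistinctColumns partial)
  (inRow : All (λ x → lookupB bs (proj₁ x) ≡ true) partial)
  (labels : All (λ x → r < proj₂ x × proj₂ x ≤ L) partial) (r≤L : r ≤ L) where

  private
    fresh : List Lab
    fresh = map (λ c → c , r) (freeIn partial bs)

  map-proj₁-label : ∀ xs → map proj₁ (map {B = Lab} (λ c → c , r) xs) ≡ xs
  map-proj₁-label []       = refl
  map-proj₁-label (x ∷ xs) = cong (x ∷_) (map-proj₁-label xs)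

  freeIn-All : All (λ j → isFree partial bs j ≡ true) (freeIn partial bs)
  freeIn-All = All.map (λ {j} e → trans (sym (mem-freeIn partial bs j)) e) (mem-self (freeIn partial bs))

  complete-inRow : All (λ x → lookupB bs (proj₁ x) ≡ true) (complete r partial bs)
  complete-inRow = ++⁺ inRow (map⁺ (All.map (proj₁ ∘ ∧-true) freeIn-All))

  complete-labels : All (λ x → r ≤ proj₂ x × proj₂ x ≤ L) (complete r partial bs)
  complete-labels = ++⁺ (All.map (λ (h , h′) → <⇒≤ h , h′) labels) (map⁺ (All.universal (λ _ → ≤-refl , r≤L) (freeIn partial bs)))

  complete-distinct : DistinctColumns (complete r partial bs)
  complete-distinct = AllPairsₚ.++⁺ distinct (AllPairsₚ.map⁺ (AllPairs.map <⇒≢ (AllPairs-filter (unused partial) (positions-increasing bs))))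
    (All.map (λ {x} e → map⁺ (All.map (λ {j} f g → contradiction (trans (sym (cong not (trans (cong (λ i → memℕ i (map proj₁ partial)) (sym g)) e))) (proj₂ (∧-true {lookupB bs j} f))) λ ()) freeIn-All))
             (map⁻ (mem-self (map proj₁ partial))))

  complete-length : length (complete r partial bs) ≡ length (positions bs)
  complete-length = trans (length-++ partial) (trans (cong (length partial +_) (length-map {B = Lab} (λ c → c , r) (freeIn partial bs)))
    (length-unused partial (positions-increasing bs) distinct (All.map (λ {x} e → trans (mem-positions bs (proj₁ x)) e) inRow)))

  marked-complete-> : ∀ {t} → r < t → ∀ j → marked t (complete r partial bs) j ≡ marked t partial j
  marked-complete-> {t} r<t j = trans (marked-++ t partial fresh j)
    (trans (cong (marked t partial j ∨_) (marked-small (map⁺ (All.universal (λ _ → r<t) (freeIn partial bs))) j)) (∨-identityʳ _))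

  marked-complete-≡ : ∀ j → marked r (complete r partial bs) j ≡ lookupB bs j
  marked-complete-≡ j = begin
    marked r (complete r partial bs) j
      ≡⟨ marked-large (All.map proj₁ complete-labels) j ⟩
    memℕ j (map proj₁ (complete r partial bs))
      ≡⟨ cong (memℕ j) (trans (map-++ proj₁ partial fresh) (cong (map proj₁ partial ++_) (map-proj₁-label (freeIn partial bs)))) ⟩
    memℕ j (map proj₁ partial ++ freeIn partial bs)
      ≡⟨ mem-++ j (map proj₁ partial) (freeIn partial bs) ⟩
    memℕ j (map proj₁ partial) ∨ memℕ j (freeIn partial bs)
      ≡⟨ cong (memℕ j (map proj₁ partial) ∨_) (mem-freeIn partial bs j) ⟩
    memℕ j (map proj₁ partial) ∨ isFree partial bs j
      ≡⟨ absorb (memℕ j (map proj₁ partial)) refl ⟩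
    lookupB bs j ∎
    where
    open ≡-Reasoning
    absorb : ∀ m → memℕ j (map proj₁ partial) ≡ m → m ∨ (lookupB bs j ∧ not (memℕ j (map proj₁ partial))) ≡ lookupB bs j
    absorb true  e = sym (mem-All (map⁺ inRow) e)
    absorb false e rewrite e = ∧-identityʳ (lookupB bs j)

-- The major index, threshold by threshold

data RowsOf (B : ℕ → ℕ → Bool) (n : ℕ) : ℕ → Rows → Set where
  []  : RowsOf B n 0 []
  row : ∀ {r bs rs} → length bs ≡ n → (∀ j → lookupB bs j ≡ B (suc r) j) → RowsOf B n r rs → RowsOf B n (suc r) (bs ∷ rs)

-- A threshold above the current row already has its customers among the balls labelled from above.
-- Any other threshold starts in its own row, with all of its balls. One function `X` collects both
-- kinds, so that a row merely adds its wraps to the thresholds that have started.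
majGo-spec : ∀ {B n} L r rs partial → RowsOf B n (suc r) rs → suc r ≤ L →
  Linked (λ bs bs′ → length (positions bs) ≤ length (positions bs′)) rs →
  DistinctColumns partial → All (λ x → B (suc r) (proj₁ x) ≡ true) partial →
  All (λ x → suc r < proj₂ x × proj₂ x ≤ L) partial →
  ∃ λ X → majGo (suc r) partial rs ≡ sumTo L X ×
    (∀ t → suc r < t → Wraps B n r (marked t partial) (X t)) ×
    (∀ t → t ≤ r → Wraps B n t (B (suc t)) (X (suc t)))
majGo-spec L zero (bs ∷ []) partial (row _ _ []) _ _ _ _ _ =
  (λ _ → 0) , sym (sumTo-0 L) , (λ _ _ → base) , λ { zero z≤n → base }
majGo-spec {B} {n} L (suc r) (bs ∷ bs′ ∷ rs) partial (row lb hb (row lb′ hb′ ro)) r≤L (size ∷ sizes) dist inRow labs =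
  X , total′ , above , below
  where
  inRow′ : All (λ x → lookupB bs (proj₁ x) ≡ true) partial
  inRow′ = All.map (λ {x} e → trans (hb (proj₁ x)) e) inRow
  full = complete (2 + r) partial bs
  P : Paired (2 + r) L (sortLab full) bs′ []
  P = pairAll-spec (2 + r) L bs′ (sortLab full) [] (s≤s z≤n)
    (distinct-sortLab (complete-distinct {bs = bs} dist inRow′ labs r≤L))
    (descending-sortLab full)
    (All-sortLab (All.map (λ {x} e → subst (proj₁ x <_) (trans lb (sym lb′)) (lookupB-< bs (proj₁ x) e)) (complete-inRow {bs = bs} dist inRow′ labs r≤L)))
    (All-sortLab (complete-labels {bs = bs} dist inRow′ labs r≤L))
    (≤-trans (≤-reflexive (trans (length-sortLab full) (complete-length {bs = bs} dist inRow′ labs r≤L)))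
      (≤-trans size (≤-reflexive (cong length (sym (filter-all (All.universal (λ _ → refl) (positions bs′))))))))
  open Paired P
  newLabels : All (λ x → 2 + r ≤ proj₂ x × proj₂ x ≤ L) new
  newLabels = map⁻ (subst (All (λ ℓ → 2 + r ≤ ℓ × ℓ ≤ L)) (sym labels)
    (map⁺ (All-sortLab (complete-labels {bs = bs} dist inRow′ labs r≤L))))
  IH = majGo-spec L r (bs′ ∷ rs) new (row lb′ hb′ ro) (<⇒≤ r≤L) sizes distinct
    (All.map (λ {x} e → trans (sym (hb′ (proj₁ x))) (proj₁ (∧-true e))) free) newLabels
  X′ = proj₁ IH
  X : ℕ → ℕ
  X t = (if 2 + r ≤ᵇ t then wraps t else 0) + X′ t
  total′ : majGo (2 + r) partial (bs ∷ bs′ ∷ rs) ≡ sumTo L X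
  total′ = sym (trans (sumTo-+ L (λ t → if 2 + r ≤ᵇ t then wraps t else 0) X′)
    (cong₂ _+_ (sym total) (trans (sym (proj₁ (proj₂ IH))) (cong (λ p → majGo (suc r) p (bs′ ∷ rs)) (sym labelled)))))
  isFree-[] : ∀ j → isFree [] bs′ j ≡ B (suc r) j
  isFree-[] j = trans (∧-identityʳ (lookupB bs′ j)) (hb′ j)
  through : ∀ t → 2 + r ≤ t → Wraps B n (suc r) (marked t full) (X t)
  through t h rewrite ≤ᵇ-true h = step
    (Least-cong {n = n} (λ j _ → marked-sortLab t full j) (λ j _ → isFree-[] j)
      (subst (λ m → Least (marked t (sortLab full)) (isFree [] bs′) m (wraps t)) lb′ (least t)))
    (Wraps-cong (λ _ _ _ _ _ → refl)
      (λ j j<n → trans (sym (reached t j (subst (j <_) (sym lb′) j<n)))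
                       (taken-cong (wraps t) (λ i _ → marked-sortLab t full i) (λ i _ → isFree-[] i) j j<n))
      (proj₁ (proj₂ (proj₂ IH)) t h))
  above : ∀ t → 2 + r < t → Wraps B n (suc r) (marked t partial) (X t)
  above t h = Wraps-cong (λ _ _ _ _ _ → refl) (λ j _ → marked-complete-> {bs = bs} dist inRow′ labs r≤L h j) (through t (<⇒≤ h))
  below : ∀ t → t ≤ suc r → Wraps B n t (B (suc t)) (X (suc t))
  below t h with m≤n⇒m<n∨m≡n h
  -- The threshold equals the row number: every ball of the row carries a label at least that large,
  -- so the whole row starts.
  ... | inj₂ refl = Wraps-cong (λ _ _ _ _ _ → refl)
        (λ j _ → trans (marked-complete-≡ {bs = bs} dist inRow′ labs r≤L j) (hb j)) (through (2 + r) ≤-refl)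
  ... | inj₁ t≤r rewrite ≤ᵇ-false {2 + r} {suc t} (s≤s t≤r) = proj₂ (proj₂ (proj₂ IH)) t (s≤s⁻¹ t≤r)

-- Charge extraction

-- wordB w k j: letter k stands at position j.
wordB : IWord → ℕ → ℕ → Bool
wordB []            k j = false
wordB ((p , a) ∷ w) k j = ((a ≡ᵇ k) ∧ (j ≡ᵇ p)) ∨ wordB w k j

letters : IWord → List ℕ
letters = map proj₂

Positioned : IWord → Set
Positioned = AllPairs (λ x y → proj₁ x < proj₁ y)

∨-true : ∀ {x y} → x ∨ y ≡ true → x ≡ true ⊎ y ≡ true
∨-true {true}  e = inj₁ refl
∨-true {false} e = inj₂ e

wordB-All : ∀ {P : ℕ × ℕ → Set} {w k j} → All P w → wordB w k j ≡ true → P (j , k)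
wordB-All {P} {(p , a) ∷ w} {k} {j} (h ∷ hs) e with ∨-true {(a ≡ᵇ k) ∧ (j ≡ᵇ p)} e
... | inj₂ e′ = wordB-All hs e′
... | inj₁ e′ with ∧-true {a ≡ᵇ k} e′
...   | e₁ , e₂ rewrite ≡ᵇ-sound {a} {k} e₁ | ≡ᵇ-sound {j} {p} e₂ = h

wordB-none : ∀ {w k j} → All (λ x → proj₁ x ≡ j → proj₂ x ≢ k) w → wordB w k j ≡ false
wordB-none h = ¬true⇒false λ e → wordB-All h e refl refl

wordB-self : ∀ w → All (λ x → wordB w (proj₂ x) (proj₁ x) ≡ true) w
wordB-self [] = []
wordB-self ((p , a) ∷ w) =
  cong (_∨ wordB w a p) (cong₂ _∧_ (≡ᵇ-true (refl {x = a})) (≡ᵇ-true (refl {x = p})))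
  ∷ All.map (λ {x} e → trans (cong (((a ≡ᵇ proj₂ x) ∧ (proj₁ x ≡ᵇ p)) ∨_) e) (∨-zeroʳ _)) (wordB-self w)

wordB-unique : ∀ {w a b j} → Positioned w → wordB w a j ≡ true → wordB w b j ≡ true → a ≡ b
wordB-unique {(p , c) ∷ w} {a} {b} {j} (h ∷ hs) ea eb with ∨-true {(c ≡ᵇ a) ∧ (j ≡ᵇ p)} ea | ∨-true {(c ≡ᵇ b) ∧ (j ≡ᵇ p)} eb
... | inj₂ ea′ | inj₂ eb′ = wordB-unique hs ea′ eb′
... | inj₁ ea′ | inj₁ eb′ = trans (sym (≡ᵇ-sound {c} {a} (proj₁ (∧-true ea′)))) (≡ᵇ-sound {c} {b} (proj₁ (∧-true eb′)))
... | inj₁ ea′ | inj₂ eb′ = contradiction (wordB-All h eb′) (<-irrefl (sym (≡ᵇ-sound {j} {p} (proj₂ (∧-true {c ≡ᵇ a} ea′)))))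
... | inj₂ ea′ | inj₁ eb′ = contradiction (wordB-All h ea′) (<-irrefl (sym (≡ᵇ-sound {j} {p} (proj₂ (∧-true {c ≡ᵇ b} eb′)))))

wordB-filter : ∀ (f : ℕ → Bool) w k j → wordB (filterᵇ (f ∘ proj₁) w) k j ≡ wordB w k j ∧ f j
wordB-filter f [] k j = refl
wordB-filter f ((p , a) ∷ w) k j with j ≟ p
... | no ne with f p
...   | true rewrite ≡ᵇ-false ne | ∧-zeroʳ (a ≡ᵇ k) = wordB-filter f w k j
...   | false rewrite ≡ᵇ-false ne | ∧-zeroʳ (a ≡ᵇ k) = wordB-filter f w k j
wordB-filter f ((p , a) ∷ w) k .p | yes refl with f p in fp
...   | true rewrite wordB-filter f w k p | fp = trans (cong (((a ≡ᵇ k) ∧ (p ≡ᵇ p)) ∨_) (∧-identityʳ (wordB w k p))) (sym (∧-identityʳ _))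
...   | false rewrite wordB-filter f w k p | fp = trans (∧-zeroʳ (wordB w k p)) (sym (∧-zeroʳ (((a ≡ᵇ k) ∧ (p ≡ᵇ p)) ∨ wordB w k p)))

firstOcc-just : ∀ {m w p} → Positioned w → firstOcc m w ≡ just p →
  wordB w m p ≡ true × (∀ j → j < p → wordB w m j ≡ false)
firstOcc-just {m} {(q , a) ∷ w} (h ∷ hs) e with a ≡ᵇ m in am
firstOcc-just {m} {(q , a) ∷ w} (h ∷ hs) refl | true rewrite ≡ᵇ-true (refl {x = q}) =
  refl , λ j j<q → trans (cong (_∨ wordB w m j) (≡ᵇ-false (<⇒≢ j<q)))
    (wordB-none {w} {m} (All.map (λ q<x e _ → <-asym q<x (subst (_< q) (sym e) j<q)) h))
... | false = firstOcc-just hs e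

firstOcc-nothing : ∀ {m} w → firstOcc m w ≡ nothing → occ m (letters w) ≡ 0 × (∀ j → wordB w m j ≡ false)
firstOcc-nothing [] e = refl , λ _ → refl
firstOcc-nothing {m} ((q , a) ∷ w) e with a ≡ᵇ m
... | false = firstOcc-nothing w e

firstOccAfter-just : ∀ {m q w p} → Positioned w → firstOccAfter m q w ≡ just p →
  wordB w m p ≡ true × q < p × (∀ j → q < j → j < p → wordB w m j ≡ false)
firstOccAfter-just {m} {q} {(p′ , a) ∷ w} {p} (h ∷ hs) e with a ≡ᵇ m in am | q <ᵇ p′ in lt
firstOccAfter-just {m} {q} {(p′ , a) ∷ w} (h ∷ hs) refl | true | true rewrite ≡ᵇ-true (refl {x = p′}) =
  refl , <ᵇ⇒< q p′ (Equivalence.from T-≡ lt) , λ j _ j<p → trans (cong (_∨ wordB w m j) (≡ᵇ-false (<⇒≢ j<p)))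
    (wordB-none {w} {m} (All.map (λ p<x e _ → <-asym p<x (subst (_< p′) (sym e) j<p)) h))
... | false | _ = firstOccAfter-just hs e
... | true | false with firstOccAfter-just hs e
...   | e₁ , q<p , e₂ = trans (cong ((p ≡ᵇ p′) ∨_) e₁) (∨-zeroʳ (p ≡ᵇ p′)) , q<p , λ j q<j j<p →
        trans (cong (_∨ wordB w m j) (≡ᵇ-false {j} {p′} λ { refl → contradiction (trans (sym (<ᵇ-true q<j)) lt) λ () })) (e₂ j q<j j<p)

firstOccAfter-nothing : ∀ {m q} w → firstOccAfter m q w ≡ nothing → ∀ j → q < j → wordB w m j ≡ false
firstOccAfter-nothing [] e j _ = refl
firstOccAfter-nothing {m} {q} ((p′ , a) ∷ w) e j q<j with a ≡ᵇ m | q <ᵇ p′ in lt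
... | false | _ = firstOccAfter-nothing w e j q<j
... | true | false = trans (cong (_∨ wordB w m j) (≡ᵇ-false {j} {p′} λ { refl → contradiction (trans (sym (<ᵇ-true q<j)) lt) λ () })) (firstOccAfter-nothing w e j q<j)

-- Extraction searches strictly to the right of `q`, a `Target` weakly so; they agree because letter
-- `m` does not stand at `q`.
nextOcc-target : ∀ {m q w n} → Positioned w → (∀ j → wordB w m j ≡ true → j < n) → wordB w m q ≡ false →
  1 ≤ occ m (letters w) → ∃₂ λ p ω → nextOcc m q w ≡ just p × Target (wordB w m) n q p ω
nextOcc-target {m} {q} {w} pw bd eq pos with firstOccAfter m q w in ea
... | just p with firstOccAfter-just pw ea
...   | e₁ , q<p , e₂ = p , false , refl , direct (<⇒≤ q<p) (bd p e₁) e₁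
        λ j q≤j j<p → case m≤n⇒m<n∨m≡n q≤j of λ where
          (inj₁ q<j)  → e₂ j q<j j<p
          (inj₂ refl) → eq
nextOcc-target {m} {q} {w} pw bd eq pos | nothing with firstOcc m w in ef
...   | nothing = contradiction pos (subst (λ x → ¬ 1 ≤ x) (sym (proj₁ (firstOcc-nothing w ef))) λ ())
...   | just p with firstOcc-just pw ef
...     | e₁ , e₂ = p , true , refl , wrapped p<q e₁ e₂ λ j q≤j _ → case m≤n⇒m<n∨m≡n q≤j of λ where
            (inj₁ q<j)  → none j q<j
            (inj₂ refl) → eq
  where
  none = firstOccAfter-nothing w ea
  p<q : p < q
  p<q with <-cmp p q
  ... | tri< h _ _ = h
  ... | tri≈ _ refl _ = contradiction (trans (sym e₁) eq) λ ()
  ... | tri> _ _ h = contradiction (trans (sym e₁) (none p h)) λ ()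

-- One round of extraction as a path

onPath : ℕ → (ℕ → ℕ) → ℕ → Bool
onPath zero    π j = false
onPath (suc m) π j = (j ≡ᵇ π (suc m)) ∨ onPath m π j

onPath-cong : ∀ m {π π′ : ℕ → ℕ} → (∀ k → k ≤ m → π k ≡ π′ k) → ∀ j → onPath m π j ≡ onPath m π′ j
onPath-cong zero    h j = refl
onPath-cong (suc m) h j = cong₂ _∨_ (cong (j ≡ᵇ_) (h (suc m) ≤-refl)) (onPath-cong m (λ k p → h k (m≤n⇒m≤1+n p)) j)

onPath-sound : ∀ m {π j} → onPath m π j ≡ true → ∃ λ k → 1 ≤ k × k ≤ m × π k ≡ j
onPath-sound (suc m) {π} {j} e with ∨-true {j ≡ᵇ π (suc m)} e
... | inj₁ e′ = suc m , s≤s z≤n , ≤-refl , sym (≡ᵇ-sound {j} {π (suc m)} e′)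
... | inj₂ e′ with onPath-sound m e′
...   | k , p , q , r = k , p , m≤n⇒m≤1+n q , r

onPath-complete : ∀ m {π} k → 1 ≤ k → k ≤ m → onPath m π (π k) ≡ true
onPath-complete zero    zero () _
onPath-complete (suc m) {π} k p q with m≤n⇒m<n∨m≡n q
... | inj₂ refl = cong (_∨ onPath m π (π k)) (≡ᵇ-true (refl {x = π k}))
... | inj₁ h = trans (cong ((π k ≡ᵇ π (suc m)) ∨_) (onPath-complete m k p (s≤s⁻¹ h))) (∨-zeroʳ _)

-- `π k` is the position of the selected letter k, with `π (suc m) = q` the point of departure;
-- `ω k` records whether the step from k + 1 to k returns to the start of the word.
record Selected (w : IWord) (n m q : ℕ) : Set where
  field
    π      : ℕ → ℕ
    ω      : ℕ → Bool
    ps     : List ℕ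
    result : selectDown m q w ≡ just ps
    start  : π (suc m) ≡ q
    greedy : ∀ k → 1 ≤ k → k ≤ m → Target (wordB w k) n (π (suc k)) (π k) (ω k)
    member : ∀ j → memℕ j ps ≡ onPath m π j

override : {A : Set} → ℕ → A → (ℕ → A) → ℕ → A
override m x f k = if k ≡ᵇ m then x else f k

override-at : ∀ {A : Set} m {x : A} {f} → override m x f m ≡ x
override-at m rewrite ≡ᵇ-true (refl {x = m}) = refl

override-below : ∀ {A : Set} {m k} {x : A} {f} → k < m → override m x f k ≡ f k
override-below h rewrite ≡ᵇ-false (<⇒≢ h) = refl

selectDown-just : ∀ m q w {p ps} → nextOcc (suc m) q w ≡ just p → selectDown m p w ≡ just ps → selectDown (suc m) q w ≡ just (p ∷ ps)
selectDown-just m q w {p} e₁ e₂ with nextOcc (suc m) q w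
selectDown-just m q w {p} refl e₂ | just p with selectDown m p w
selectDown-just m q w {p} refl refl | just p | just _ = refl

selectDown-spec : ∀ {w n} m q → Positioned w → All (λ x → proj₁ x < n) w → wordB w (suc m) q ≡ true →
  (∀ k → 1 ≤ k → k ≤ m → 1 ≤ occ k (letters w)) → Selected w n m q
selectDown-spec zero q pw bd e pos = record
  { π = λ _ → q ; ω = λ _ → false ; ps = [] ; result = refl ; start = refl
  ; greedy = λ { zero () _ } ; member = λ _ → refl }
selectDown-spec {w} {n} (suc m) q pw bd e pos
  with nextOcc-target {suc m} {q} {w} {n} pw (λ j e′ → wordB-All bd e′)
         (¬true⇒false λ e′ → 1+n≢n (wordB-unique pw e e′)) (pos (suc m) (s≤s z≤n) ≤-refl)
... | p , ω₀ , next , t = record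
  { π      = π′
  ; ω      = ω′
  ; ps     = p ∷ ps
  ; result = selectDown-just m q w next result
  ; start  = override-at (2 + m) {q} {π}
  ; greedy = greedy′
  ; member = λ j → cong₂ _∨_ (cong (j ≡ᵇ_) (trans (sym start) (sym (override-below {f = π} (n<1+n (suc m))))))
      (trans (member j) (onPath-cong m (λ k h → sym (override-below {f = π} (m<n⇒m<1+n (s≤s h)))) j))
  }
  where
  open Selected (selectDown-spec {w} {n} m p pw bd (target-ball t) (λ k h h′ → pos k h (m≤n⇒m≤1+n h′)))
  π′ = override (2 + m) q π
  ω′ = override (suc m) ω₀ ω
  greedy′ : ∀ k → 1 ≤ k → k ≤ suc m → Target (wordB w k) n (π′ (suc k)) (π′ k) (ω′ k)
  greedy′ k h h′ with m≤n⇒m<n∨m≡n h′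
  ... | inj₁ k≤m rewrite override-below {x = q} {f = π} (s≤s k≤m) | override-below {x = q} {f = π} (m<n⇒m<1+n k≤m)
          | override-below {x = ω₀} {f = ω} k≤m = greedy k h (s≤s⁻¹ k≤m)
  ... | inj₂ refl rewrite override-at (2 + m) {q} {π} | override-below {x = q} {f = π} (n<1+n (suc m))
          | override-at (suc m) {ω₀} {ω} | start = t

occ-filter-+ : ∀ {A : Set} (g : A → Bool) (h : A → ℕ) k w →
  occ k (map h (filterᵇ g w)) + occ k (map h (filterᵇ (not ∘ g) w)) ≡ occ k (map h w)
occ-filter-+ g h k [] = refl
occ-filter-+ g h k (x ∷ w) with g x
... | true  = trans (+-assoc (if h x ≡ᵇ k then 1 else 0) _ _) (cong ((if h x ≡ᵇ k then 1 else 0) +_) (occ-filter-+ g h k w))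
... | false = trans (+-swap (occ k (map h (filterᵇ g w))) (if h x ≡ᵇ k then 1 else 0) _) (cong ((if h x ≡ᵇ k then 1 else 0) +_) (occ-filter-+ g h k w))

length-filter-+ : ∀ {A : Set} (g : A → Bool) w → length (filterᵇ g w) + length (filterᵇ (not ∘ g) w) ≡ length w
length-filter-+ g [] = refl
length-filter-+ g (x ∷ w) with g x
... | true  = cong suc (length-filter-+ g w)
... | false = trans (+-suc (length (filterᵇ g w)) _) (cong suc (length-filter-+ g w))

occ-filter-0 : ∀ (g : ℕ → Bool) k w → All (λ x → proj₂ x ≡ k → g (proj₁ x) ≡ false) w → occ k (letters (filterᵇ (g ∘ proj₁) w)) ≡ 0
occ-filter-0 g k [] [] = refl
occ-filter-0 g k ((p , a) ∷ w) (h ∷ hs) with g p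
... | false = occ-filter-0 g k w hs
... | true rewrite ≡ᵇ-false {a} {k} (λ e → contradiction (h e) λ ()) = occ-filter-0 g k w hs

occ-filter-1 : ∀ {k p} (g : ℕ → Bool) w → Positioned w → wordB w k p ≡ true →
  All (λ x → proj₂ x ≡ k → g (proj₁ x) ≡ (proj₁ x ≡ᵇ p)) w → occ k (letters (filterᵇ (g ∘ proj₁) w)) ≡ 1
occ-filter-1 {k} {p} g ((q , a) ∷ w) (h ∷ hs) e (f ∷ fs) with a ≟ k | p ≟ q
... | yes refl | yes refl rewrite trans (f refl) (≡ᵇ-true (refl {x = p})) | ≡ᵇ-true (refl {x = a}) =
  cong suc (occ-filter-0 g a w (All.zipWith (λ (f , p<x) e → trans (f e) (≡ᵇ-false (>⇒≢ p<x))) (fs , h)))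
... | yes refl | no ne rewrite ≡ᵇ-true (refl {x = a}) | ≡ᵇ-false ne | trans (f refl) (≡ᵇ-false (ne ∘ sym)) = occ-filter-1 g w hs e fs
... | no ne | _ rewrite ≡ᵇ-false ne with g q
...   | true rewrite ≡ᵇ-false ne = occ-filter-1 g w hs e fs
...   | false = occ-filter-1 g w hs e fs

length-occ : ∀ K v → All (λ x → 1 ≤ proj₂ x × proj₂ x ≤ K) v → length v ≡ sumTo K (λ k → occ k (letters v))
length-occ K [] [] = sym (sumTo-0 K)
length-occ K ((p , a) ∷ v) ((h , h′) ∷ hs) = begin
  suc (length v)
    ≡⟨ cong₂ _+_ (sym one) (length-occ K v hs) ⟩
  sumTo K (λ k → if a ≡ᵇ k then 1 else 0) + sumTo K (λ k → occ k (letters v))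
    ≡⟨ sumTo-+ K _ _ ⟨
  sumTo K (λ k → (if a ≡ᵇ k then 1 else 0) + occ k (letters v)) ∎
  where
  open ≡-Reasoning
  one : sumTo K (λ k → if a ≡ᵇ k then 1 else 0) ≡ 1
  one = trans (sumTo-cong K pointwise) (trans (sumTo-within K h ≤-refl h′) (m+n∸m≡n a 1))
    where
    pointwise : ∀ t → 1 ≤ t → t ≤ K → (if a ≡ᵇ t then 1 else 0) ≡ within a a t
    pointwise t _ _ with <-cmp a t
    ... | tri< p _ _ rewrite ≡ᵇ-false (<⇒≢ p) | ≤ᵇ-false p | ∧-zeroʳ (a ≤ᵇ t) = refl
    ... | tri≈ _ refl _ rewrite ≡ᵇ-true (refl {x = a}) | ≤ᵇ-true (≤-refl {a}) = refl
    ... | tri> _ _ p rewrite ≡ᵇ-false (>⇒≢ p) | ≤ᵇ-false p = refl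

-- Charge compares indices in the extracted word, wrapping compares positions in the original one;
-- since `a` and `b` occur once each and positions increase, the two comparisons agree.
indexOf-< : ∀ {a b p q} v → Positioned v → a ≢ b →
  wordB v a p ≡ true → (∀ j → wordB v a j ≡ true → j ≡ p) → wordB v b q ≡ true → (∀ j → wordB v b j ≡ true → j ≡ q) →
  (indexOf a (letters v) <ᵇ indexOf b (letters v)) ≡ (p <ᵇ q)
indexOf-< {a} {b} {p} {q} ((i , c) ∷ v) (h ∷ hs) a≢b ea ua eb ub with a ≟ c
... | yes refl rewrite ≡ᵇ-false {b} {c} (a≢b ∘ sym) | ≡ᵇ-true (refl {x = c}) | ≡ᵇ-false {c} {b} a≢b
    | ua i (cong (_∨ wordB v c i) (≡ᵇ-true (refl {x = i}))) = sym (<ᵇ-true (wordB-All h eb))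
... | no a≢c rewrite ≡ᵇ-false {a} {c} a≢c | ≡ᵇ-false {c} {a} (a≢c ∘ sym) with b ≟ c
...   | yes refl rewrite ≡ᵇ-true (refl {x = c}) | ub i (cong (_∨ wordB v c i) (≡ᵇ-true (refl {x = i}))) =
        sym (<ᵇ-false (<⇒≤ (wordB-All h ea)))
...   | no b≢c rewrite ≡ᵇ-false {b} {c} b≢c | ≡ᵇ-false {c} {b} (b≢c ∘ sym) = indexOf-< v hs a≢b ea ua eb ub

sum-upTo : ∀ f m → sum (map f (upTo m)) ≡ sumTo m (λ i → f (pred i))
sum-upTo f m = trans (cong sum (map-upTo f m)) (go m)
  where
  open import Data.Nat.ListAction.Properties using (sum-++)
  go : ∀ m → sum (applyUpTo f m) ≡ sumTo m (λ i → f (pred i))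
  go zero    = refl
  go (suc m) = trans (cong sum (sym (applyUpTo-∷ʳ f m))) (trans (sum-++ (applyUpTo f m) [ f m ]) (cong₂ _+_ (go m) (+-identityʳ (f m))))

-- Exchange of summation: i is counted once for every t with i < t ≤ m + 1, hence `suc m ∸ i` times.
sumTo-triangle : ∀ m (g : ℕ → Bool) →
  sumTo (suc m) (λ t → sumTo (pred t) (bit ∘ g)) ≡ sumTo m (λ i → if g i then suc m ∸ i else 0)
sumTo-triangle zero    g = refl
sumTo-triangle (suc m) g = begin
  sumTo (suc m) (λ t → sumTo (pred t) (bit ∘ g)) + sumTo (suc m) (bit ∘ g)
    ≡⟨ cong (_+ sumTo (suc m) (bit ∘ g)) (trans (sumTo-triangle m g) (sym (trans (cong (sumTo m h +_) last) (+-identityʳ _)))) ⟩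
  sumTo (suc m) h + sumTo (suc m) (bit ∘ g)
    ≡⟨ sumTo-+ (suc m) h (bit ∘ g) ⟨
  sumTo (suc m) (λ i → h i + bit (g i))
    ≡⟨ sumTo-cong (suc m) (λ i _ i≤ → pointwise i i≤) ⟩
  sumTo (suc m) (λ i → if g i then 2 + m ∸ i else 0) ∎
  where
  open ≡-Reasoning
  h : ℕ → ℕ
  h i = if g i then suc m ∸ i else 0
  last : h (suc m) ≡ 0
  last rewrite n∸n≡0 m with g (suc m)
  ... | true  = refl
  ... | false = refl
  pointwise : ∀ i → i ≤ suc m → h i + bit (g i) ≡ (if g i then 2 + m ∸ i else 0)
  pointwise i i≤ with g i
  ... | true  = trans (+-comm (suc m ∸ i) 1) (sym (+-∸-assoc 1 i≤))
  ... | false = refl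

sumTo-cut : ∀ {K L} (f : ℕ → ℕ) → K ≤ L → sumTo L (λ t → if t ≤ᵇ K then f t else 0) ≡ sumTo K f
sumTo-cut {K} f K≤L with m≤n⇒∃[o]m+o≡n K≤L
... | k , refl = trans (cong (λ m → sumTo m (λ t → if t ≤ᵇ K then f t else 0)) (+-comm K k)) (trans (above k) (sumTo-cong K (λ t _ h → cong (λ b → if b then f t else 0) (≤ᵇ-true h))))
  where
  above : ∀ k → sumTo (k + K) (λ t → if t ≤ᵇ K then f t else 0) ≡ sumTo K (λ t → if t ≤ᵇ K then f t else 0)
  above zero    = refl
  above (suc k) rewrite ≤ᵇ-false {suc k + K} {K} (s≤s (m≤n+m K k)) = trans (+-identityʳ _) (above k)

maxLetter-≤ : ∀ w → All (λ x → proj₂ x ≤ maxLetter w) w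
maxLetter-≤ [] = []
maxLetter-≤ ((p , a) ∷ w) = m≤m⊔n a (maxLetter w) ∷ All.map (λ h → ≤-trans h (m≤n⊔m a (maxLetter w))) (maxLetter-≤ w)

maxLetter-bound : ∀ {L w} → All (λ x → proj₂ x ≤ L) w → maxLetter w ≤ L
maxLetter-bound []       = z≤n
maxLetter-bound (h ∷ hs) = ⊔-lub h (maxLetter-bound hs)

maxLetter-occ : ∀ x w → 1 ≤ occ (maxLetter (x ∷ w)) (letters (x ∷ w))
maxLetter-occ (p , a) [] rewrite ⊔-identityʳ a | ≡ᵇ-true (refl {x = a}) = s≤s z≤n
maxLetter-occ (p , a) (y ∷ w) with ⊔-sel a (maxLetter (y ∷ w))
... | inj₁ e rewrite e | ≡ᵇ-true (refl {x = a}) = s≤s z≤n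
... | inj₂ e rewrite e = ≤-trans (maxLetter-occ y w) (m≤n+m _ (if a ≡ᵇ maxLetter (y ∷ w) then 1 else 0))

maxLetter-pos : ∀ x w → All (λ x → 1 ≤ proj₂ x) (x ∷ w) → 1 ≤ maxLetter (x ∷ w)
maxLetter-pos (p , a) w (h ∷ _) = ≤-trans h (m≤m⊔n a (maxLetter w))

PartitionContent : IWord → Set
PartitionContent w = ∀ k → 1 ≤ k → occ (suc k) (letters w) ≤ occ k (letters w)

occ-descend : ∀ {w} K → PartitionContent w → 1 ≤ occ K (letters w) → ∀ k → 1 ≤ k → k ≤ K → 1 ≤ occ k (letters w)
occ-descend zero    pc h zero () _
occ-descend {w} (suc K) pc h k p q with m≤n⇒m<n∨m≡n q
... | inj₂ refl = h
... | inj₁ q′ = occ-descend {w} K pc (≤-trans h (pc K (≤-trans p (s≤s⁻¹ q′)))) k p (s≤s⁻¹ q′)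

onList offList : List ℕ → IWord → IWord
onList  ps w = filterᵇ (λ x → memℕ (proj₁ x) ps) w
offList ps w = filterᵇ (λ x → not (memℕ (proj₁ x) ps)) w

chargeGo-just : ∀ f w {ps} → extractPos w ≡ just ps →
  chargeGo (suc f) w ≡ chargePerm (letters (onList ps w)) + chargeGo f (offList ps w)
chargeGo-just f w e with extractPos w
chargeGo-just f w refl | just ps = refl

extractPos-just : ∀ w {p ps} → firstOcc (maxLetter w) w ≡ just p → selectDown (pred (maxLetter w)) p w ≡ just ps →
  extractPos w ≡ just (p ∷ ps)
extractPos-just w e₁ e₂ with firstOcc (maxLetter w) w
extractPos-just w {p} refl e₂ | just p with selectDown (pred (maxLetter w)) p w
extractPos-just w {p} refl refl | just p | just ps = refl

wordB-≤ : ∀ {w k j} → wordB w k j ≡ true → k ≤ maxLetter w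
wordB-≤ {w} e = wordB-All (maxLetter-≤ w) e

occ-none-above : ∀ w {k} → maxLetter w < k → occ k (letters w) ≡ 0
occ-none-above w h = occ-none (go (maxLetter-≤ w))
  where
  go : ∀ {v} → All (λ x → proj₂ x ≤ maxLetter w) v → All (_≢ _) (letters v)
  go []       = []
  go (p ∷ ps) = <⇒≢ (≤-<-trans p h) ∷ go ps

occ-≤-filter : ∀ {A : Set} (g : A → Bool) (h : A → ℕ) k w → occ k (map h (filterᵇ g w)) ≤ occ k (map h w)
occ-≤-filter g h k w = ≤-trans (m≤m+n _ _) (≤-reflexive (occ-filter-+ g h k w))

-- `n` can stay fixed during the extraction because the remaining letters keep their original
-- positions.
ChargeWraps : IWord → (n L c : ℕ) → Set
ChargeWraps w n L c = ∃ λ X → c ≡ sumTo L X × (∀ t → suc t ≤ L → Wraps (wordB w) n t (wordB w (suc t)) (X (suc t)))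

module Extraction {w : IWord} {n L m p : ℕ} (pw : Positioned w) (bd : All (λ x → proj₁ x < n) w)
  (ls : All (λ x → 1 ≤ proj₂ x × proj₂ x ≤ L) w) (mx : maxLetter w ≡ suc m) (p∈w : wordB w (suc m) p ≡ true)
  (S : Selected w n m p) where
  open Selected S

  K : ℕ
  K = suc m
  path : List ℕ
  path = p ∷ ps
  v w′ : IWord
  v  = onList path w
  w′ = offList path w

  K≤L : K ≤ L
  K≤L = subst (_≤ L) mx (maxLetter-bound (All.map proj₂ ls))

  top : π K ≡ p
  top = start

  path-mem : ∀ j → memℕ j path ≡ onPath K π j
  path-mem j = cong₂ _∨_ (cong (j ≡ᵇ_) (sym start)) (member j)

  at-π : ∀ k → 1 ≤ k → k ≤ K → wordB w k (π k) ≡ true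
  at-π k h h′ with m≤n⇒m<n∨m≡n h′
  ... | inj₁ k≤m  = target-ball (greedy k h (s≤s⁻¹ k≤m))
  ... | inj₂ refl = trans (cong (wordB w K) start) p∈w

  on-path : ∀ k j → 1 ≤ k → k ≤ K → wordB w k j ≡ true → memℕ j path ≡ (j ≡ᵇ π k)
  on-path k j h h′ e with j ≟ π k
  ... | yes refl = trans (path-mem (π k)) (trans (onPath-complete K {π} k h h′) (sym (≡ᵇ-true (refl {x = π k}))))
  ... | no ne = trans (¬true⇒false (λ e′ → off (onPath-sound K {π} (trans (sym (path-mem j)) e′)))) (sym (≡ᵇ-false ne))
    where
    off : ¬ (∃ λ i → 1 ≤ i × i ≤ K × π i ≡ j)
    off (i , q , q′ , refl) with wordB-unique pw e (at-π i q q′)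
    ... | refl = ne refl

  rest-remove : ∀ k j → 1 ≤ k → k ≤ K → wordB w′ k j ≡ remove (wordB w k) (π k) j
  rest-remove k j h h′ = trans (wordB-filter (λ i → not (memℕ i path)) w k j) (go (wordB w k j) refl)
    where
    go : ∀ b → wordB w k j ≡ b → b ∧ not (memℕ j path) ≡ b ∧ not (j ≡ᵇ π k)
    go false _ = refl
    go true  e = cong not (on-path k j h h′ e)

  path-at : ∀ k j → 1 ≤ k → k ≤ K → wordB v k j ≡ true → j ≡ π k
  path-at k j h h′ e with ∧-true {wordB w k j} (trans (sym (wordB-filter (λ i → memℕ i path) w k j)) e)
  ... | e₁ , e₂ = ≡ᵇ-sound {j} {π k} (trans (sym (on-path k j h h′ e₁)) e₂)

  path-π : ∀ k → 1 ≤ k → k ≤ K → wordB v k (π k) ≡ true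
  path-π k h h′ = trans (wordB-filter (λ i → memℕ i path) w k (π k))
    (trans (cong₂ _∧_ (at-π k h h′) (on-path k (π k) h h′ (at-π k h h′))) (≡ᵇ-true (refl {x = π k})))

  occ-path : ∀ k → 1 ≤ k → k ≤ K → occ k (letters v) ≡ 1
  occ-path k h h′ = occ-filter-1 (λ i → memℕ i path) w pw (at-π k h h′)
    (All.map (λ {x} e q → on-path k (proj₁ x) h h′ (subst (λ a → wordB w a (proj₁ x) ≡ true) q e)) (wordB-self w))

  occ-rest : ∀ k → 1 ≤ k → k ≤ K → occ k (letters w) ≡ suc (occ k (letters w′))
  occ-rest k h h′ = trans (sym (occ-filter-+ (λ x → memℕ (proj₁ x) path) proj₂ k w)) (cong (_+ occ k (letters w′)) (occ-path k h h′))

  length-path : length v ≡ K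
  length-path = trans (length-occ K v (All-filter _ (All.zipWith (λ (h , h′) → proj₁ h , subst (_ ≤_) mx h′) (ls , maxLetter-≤ w))))
    (trans (sumTo-cong K occ-path) (ones K))
    where
    ones : ∀ K → sumTo K (λ _ → 1) ≡ K
    ones zero    = refl
    ones (suc K) = trans (+-comm (sumTo K (λ _ → 1)) 1) (cong suc (ones K))

  length-rest : length w ≡ suc (m + length w′)
  length-rest = trans (sym (length-filter-+ (λ x → memℕ (proj₁ x) path) w)) (cong (_+ length w′) length-path)

  wrap-< : ∀ {b c d x} → Target b n c d x → (d <ᵇ c) ≡ x
  wrap-< (direct h _ _ _)  = <ᵇ-false h
  wrap-< (wrapped h _ _ _) = <ᵇ-true h

  -- i stands left of i + 1 in the extracted permutation exactly when the step from i + 1 to i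
  -- wraps. Its weight `K ∸ i` is the number of thresholds t with i < t ≤ K, those whose part of the
  -- path contains this step.
  chargePerm-path : chargePerm (letters v) ≡ sumTo L (λ t → if t ≤ᵇ K then sumTo (pred t) (bit ∘ ω) else 0)
  chargePerm-path = begin
    chargePerm (letters v)
      ≡⟨ cong (λ k → sum (map (λ j → if indexOf (suc j) (letters v) <ᵇ indexOf (2 + j) (letters v) then k ∸ suc j else 0) (upTo (k ∸ 1))))
              (trans (length-map proj₂ v) length-path) ⟩
    sum (map (λ j → if indexOf (suc j) (letters v) <ᵇ indexOf (2 + j) (letters v) then K ∸ suc j else 0) (upTo m))
      ≡⟨ sum-upTo _ m ⟩
    sumTo m (λ i → if indexOf (suc (pred i)) (letters v) <ᵇ indexOf (2 + pred i) (letters v) then K ∸ suc (pred i) else 0)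
      ≡⟨ sumTo-cong m term ⟩
    sumTo m (λ i → if ω i then K ∸ i else 0)
      ≡⟨ sumTo-triangle m ω ⟨
    sumTo K (λ t → sumTo (pred t) (bit ∘ ω))
      ≡⟨ sumTo-cut (λ t → sumTo (pred t) (bit ∘ ω)) K≤L ⟨
    sumTo L (λ t → if t ≤ᵇ K then sumTo (pred t) (bit ∘ ω) else 0) ∎
    where
    open ≡-Reasoning
    term : ∀ i → 1 ≤ i → i ≤ m →
      (if indexOf (suc (pred i)) (letters v) <ᵇ indexOf (2 + pred i) (letters v) then K ∸ suc (pred i) else 0) ≡ (if ω i then K ∸ i else 0)
    term (suc i) h h′ = cong (λ b → if b then K ∸ suc i else 0) (trans
      (indexOf-< v (AllPairs-filter _ pw) (<⇒≢ ≤-refl)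
        (path-π (suc i) h (m≤n⇒m≤1+n h′)) (λ j → path-at (suc i) j h (m≤n⇒m≤1+n h′))
        (path-π (2 + i) (s≤s z≤n) (s≤s h′)) (λ j → path-at (2 + i) j (s≤s z≤n) (s≤s h′)))
      (wrap-< (greedy (suc i) h h′)))

  π-< : ∀ k → 1 ≤ k → k ≤ K → π k < n
  π-< k h h′ = wordB-All bd (at-π k h h′)

  -- A threshold t ≤ K recovers the part of the path from letter t down to letter 1. For t > K the
  -- letter t does not occur, so there are no customers before or after the removal.
  extend : ∀ {c} → ChargeWraps w′ n L c → ChargeWraps w n L (chargePerm (letters v) + c)
  extend {c} (X , e , W) = X₁ , total , W₁
    where
    X₁ : ℕ → ℕ
    X₁ t = X t + (if t ≤ᵇ K then sumTo (pred t) (bit ∘ ω) else 0)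
    total : chargePerm (letters v) + c ≡ sumTo L X₁
    total = trans (+-comm _ c) (trans (cong₂ _+_ e chargePerm-path) (sym (sumTo-+ L X _)))
    W₁ : ∀ t → suc t ≤ L → Wraps (wordB w) n t (wordB w (suc t)) (X₁ (suc t))
    W₁ t h with suc t ≤? K
    ... | yes q rewrite ≤ᵇ-true q = Wraps-remove-path {π = π} {ω = ω} t
          (λ k h₁ h₂ → greedy k h₁ (≤-trans h₂ (s≤s⁻¹ q)))
          (λ k j h₁ h₂ _ → rest-remove k j h₁ (≤-trans h₂ (<⇒≤ q)))
          (at-π (suc t) (s≤s z≤n) q) (π-< (suc t) (s≤s z≤n) q) (λ j _ → rest-remove (suc t) j (s≤s z≤n) q) (W t h)
    ... | no q rewrite ≤ᵇ-false (≰⇒> q) = subst (Wraps (wordB w) n t (wordB w (suc t))) (sym zero-X) (Wraps-none t (λ j _ → empty j))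
      where
      empty : ∀ j → wordB w (suc t) j ≡ false
      empty j = ¬true⇒false λ e → q (subst (suc t ≤_) mx (wordB-≤ {w} e))
      empty′ : ∀ j → wordB w′ (suc t) j ≡ false
      empty′ j = trans (wordB-filter (λ i → not (memℕ i path)) w (suc t) j) (cong (_∧ not (memℕ j path)) (empty j))
      zero-X : X (suc t) + 0 ≡ 0
      zero-X = trans (+-identityʳ _) (Wraps-none⁻ (λ j _ → empty′ j) (W t h))
        where
        Wraps-none⁻ : ∀ {B n r s f} → (∀ j → j < n → s j ≡ false) → Wraps B n r s f → f ≡ 0
        Wraps-none⁻ h base = refl
        Wraps-none⁻ {B} {n} {suc r} {s} h (step l u) with Least-none⁻ {s} {B (suc r)} {n} h l
        ... | refl = Wraps-none⁻ (proj₂ (Least-none {s} {B (suc r)} {n} h)) u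

  -- Every letter up to `K` loses exactly one copy and larger letters do not occur, so the
  -- inequalities between consecutive letters persist.
  content-rest : PartitionContent w → PartitionContent w′
  content-rest pc k h with suc k ≤? K
  ... | yes q = s≤s⁻¹ (subst₂ _≤_ (occ-rest (suc k) (s≤s z≤n) q) (occ-rest k h (<⇒≤ q)) (pc k h))
  ... | no q = ≤-trans (≤-trans (occ-≤-filter _ proj₂ (suc k) w) (≤-reflexive (occ-none-above w (subst (_< suc k) (sym mx) (≰⇒> q))))) z≤n

firstOcc-exists : ∀ {k} w → 1 ≤ occ k (letters w) → ∃ λ p → firstOcc k w ≡ just p
firstOcc-exists {k} w h with firstOcc k w in eq
... | just p  = p , refl
... | nothing = contradiction h (subst (λ o → ¬ 1 ≤ o) (sym (proj₁ (firstOcc-nothing w eq))) λ ())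

ChargeSpec : (n L f : ℕ) → Set
ChargeSpec n L f = ∀ w → Positioned w → All (λ x → proj₁ x < n) w → All (λ x → 1 ≤ proj₂ x × proj₂ x ≤ L) w →
  PartitionContent w → length w ≤ f → ChargeWraps w n L (chargeGo f w)

chargeGo-round : ∀ {n L m} f w → maxLetter w ≡ suc m → 1 ≤ occ (suc m) (letters w) → ChargeSpec n L f →
  Positioned w → All (λ x → proj₁ x < n) w → All (λ x → 1 ≤ proj₂ x × proj₂ x ≤ L) w →
  PartitionContent w → length w ≤ suc f → ChargeWraps w n L (chargeGo (suc f) w)
chargeGo-round {n} {L} {m} f w mx oc ih pw bd ls pc len with firstOcc-exists w oc
... | p , fo = subst (ChargeWraps w n L)
  (sym (chargeGo-just f w (extractPos-just w (trans (cong (λ k → firstOcc k w) mx) fo)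
                                             (trans (cong (λ k → selectDown (pred k) p w) mx) result))))
  (extend (ih w′ (AllPairs-filter _ pw) (All-filter _ bd) (All-filter _ ls) (content-rest pc)
    (≤-trans (m≤n+m (length w′) m) (s≤s⁻¹ (subst (_≤ suc f) length-rest len)))))
  where
  p∈w = proj₁ (firstOcc-just pw fo)
  S : Selected w n m p
  S = selectDown-spec m p pw bd p∈w (λ k h h′ → occ-descend {w} (suc m) pc oc k h (m≤n⇒m≤1+n h′))
  open Selected S using (result)
  open Extraction pw bd ls mx p∈w S

suc-pred-pos : ∀ {k} → 1 ≤ k → k ≡ suc (pred k)
suc-pred-pos (s≤s _) = refl

chargeGo-spec : ∀ {n L} f → ChargeSpec n L f
chargeGo-spec {n} {L} zero    [] _ _ _ _ _ = (λ _ → 0) , sym (sumTo-0 L) , λ t _ → Wraps-none t (λ _ _ → refl)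
chargeGo-spec {n} {L} (suc f) [] _ _ _ _ _ = (λ _ → 0) , sym (sumTo-0 L) , λ t _ → Wraps-none t (λ _ _ → refl)
chargeGo-spec {n} {L} (suc f) (x ∷ w) pw bd ls pc len =
  chargeGo-round f (x ∷ w) mx (subst (λ k → 1 ≤ occ k (letters (x ∷ w))) mx (maxLetter-occ x w)) (chargeGo-spec f) pw bd ls pc len
  where
  mx = suc-pred-pos (maxLetter-pos x w (All.map proj₁ ls))

-- Collapsing a multiline queue

Par : Set
Par = Bool × ℕ

-- The loop of removePair is local to Defs. The metavariables below are solved by the loop stopped at a
-- neutral list and by one layer of it; its spurious outer arguments do not matter for conversion.
mutual
  stuck : Par → List Par → Par → List Par → Maybe (List Par)
  stuck = _

  removePair-stuck : ∀ p z zs → proj₁ p ∧ not (proj₁ z) ≡ false → removePair (p ∷ z ∷ zs) ≡ stuck p (z ∷ zs) z zs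
  removePair-stuck p z zs e rewrite e with List Par ∋ z ∷ zs
  ... | ps = refl

mutual
  layer : Par → List Par → List Par → Maybe (List Par) → Maybe (List Par)
  layer = _

  removePair-layer : ∀ p z zs → proj₁ p ∧ not (proj₁ p) ≡ false → proj₁ p ∧ not (proj₁ z) ≡ false →
    removePair (p ∷ p ∷ z ∷ zs) ≡ layer p (p ∷ z ∷ zs) (z ∷ zs) (stuck p (p ∷ z ∷ zs) z zs)
  removePair-layer p z zs e e′ rewrite e | e′ with stuck p (p ∷ z ∷ zs) z zs
  ... | m with List Par ∋ p ∷ z ∷ zs
  ...   | ps with List Par ∋ z ∷ zs
  ...     | zs′ = refl

layer-map : ∀ p ps zs m → layer p ps zs m ≡ Maybe.map (p ∷_) m
layer-map p ps zs nothing  = refl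
layer-map p ps zs (just _) = refl

removePair-skip : ∀ x y ys → proj₁ x ∧ not (proj₁ y) ≡ false →
  removePair (x ∷ y ∷ ys) ≡ Maybe.map (x ∷_) (removePair (y ∷ ys))
removePair-skip x y ys e rewrite e = layer-map x ys ys (removePair (y ∷ ys))

-- Together with `opens`, a one-pass description of the matching, from right to left: `pend` counts
-- the unmatched `)`, starting from `q` of them further right, and `opens` lists the columns of the
-- unmatched `(`.
pend : ℕ → List Par → ℕ
pend q []              = q
pend q ((false , j) ∷ u) = suc (pend q u)
pend q ((true  , j) ∷ u) = pred (pend q u)

opens : ℕ → List Par → List ℕ
opens q []                = []
opens q ((false , j) ∷ u) = opens q u
opens q ((true  , j) ∷ u) = if pend q u ≡ᵇ 0 then j ∷ opens q u else opens q u

pend-++ : ∀ q u v → pend q (u ++ v) ≡ pend (pend q v) u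
pend-++ q []                v = refl
pend-++ q ((false , j) ∷ u) v = cong suc (pend-++ q u v)
pend-++ q ((true  , j) ∷ u) v = cong pred (pend-++ q u v)

opens-++ : ∀ q u v → opens q (u ++ v) ≡ opens (pend q v) u ++ opens q v
opens-++ q []                v = refl
opens-++ q ((false , j) ∷ u) v = opens-++ q u v
opens-++ q ((true  , j) ∷ u) v rewrite pend-++ q u v | opens-++ q u v with pend (pend q v) u ≡ᵇ 0
... | true  = refl
... | false = refl

-- The `)` of a removed pair raises the counter and its `(` lowers it again at once. The counter is
-- positive in between, so that `(` was never listed as unmatched.
removePair-sound : ∀ u {u′} → removePair u ≡ just u′ →
  pend 0 u ≡ pend 0 u′ × opens 0 u ≡ opens 0 u′ × length u ≡ 2 + length u′
removePair-sound ((true , j) ∷ (false , k) ∷ u) refl = refl , refl , refl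
removePair-sound ((true , j) ∷ (true , k) ∷ u) e
  rewrite removePair-skip (true , j) (true , k) u refl with removePair ((true , k) ∷ u) in eq
removePair-sound ((true , j) ∷ (true , k) ∷ u) refl | just r with removePair-sound ((true , k) ∷ u) eq
... | p , o , l rewrite p | o = refl , refl , cong suc l
removePair-sound ((false , j) ∷ y ∷ u) e
  rewrite removePair-skip (false , j) y u refl with removePair (y ∷ u) in eq
removePair-sound ((false , j) ∷ y ∷ u) refl | just r with removePair-sound (y ∷ u) eq
... | p , o , l = cong suc p , o , cong suc l

-- Without an adjacent `()`, every `)` precedes every `(`, so no `(` is matched. The second
-- component carries this through the induction: nothing is pending to the right of a `(`.
removePair-none : ∀ x u → removePair (x ∷ u) ≡ nothing →
  map proj₂ (filterᵇ proj₁ (x ∷ u)) ≡ opens 0 (x ∷ u) × (proj₁ x ≡ true → pend 0 (x ∷ u) ≡ 0)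
removePair-none (true  , j) [] e = refl , λ _ → refl
removePair-none (false , j) [] e = refl , λ ()
removePair-none (true , j) ((true , k) ∷ u) e
  rewrite removePair-skip (true , j) (true , k) u refl with removePair ((true , k) ∷ u) in eq
... | nothing with removePair-none (true , k) u eq
...   | o , z rewrite z refl = cong (j ∷_) o , λ _ → refl
removePair-none (false , j) (y ∷ u) e
  rewrite removePair-skip (false , j) y u refl with removePair (y ∷ u) in eq
... | nothing = proj₁ (removePair-none y u eq) , λ ()

matchLoop-opens : ∀ f u → length u ≤ f → map proj₂ (filterᵇ proj₁ (matchLoop f u)) ≡ opens 0 u
matchLoop-opens zero    []      h = refl
matchLoop-opens (suc f) []      h = refl
matchLoop-opens (suc f) (x ∷ u) h with removePair (x ∷ u) in eq
... | nothing = proj₁ (removePair-none x u eq)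
... | just u′ with removePair-sound (x ∷ u) eq
...   | p , o , l = trans (matchLoop-opens f u′ (≤-trans (n≤1+n _) (s≤s⁻¹ (subst (_≤ suc f) l h)))) (sym o)

parWord-++ : ∀ i u v → parWord i (u ++ v) ≡ parWord i u ++ parWord i v
parWord-++ i [] v = refl
parWord-++ i ((r , j) ∷ u) v with r ≡ᵇ suc i
... | true = cong (_ ∷_) (parWord-++ i u v)
... | false with r ≡ᵇ i
...   | true  = cong (_ ∷_) (parWord-++ i u v)
...   | false = parWord-++ i u v

pend-parWord : ∀ i q w → pend q (parWord i w) ≡ pending i q (map proj₁ w)
pend-parWord i q [] = refl
pend-parWord i q ((r , j) ∷ w) with side i r
... | close rewrite ≡ᵇ-false (<⇒≢ (n<1+n i)) | ≡ᵇ-true (refl {x = i}) = cong suc (pend-parWord i q w)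
... | open′ rewrite ≡ᵇ-true (refl {x = i}) = cong pred (pend-parWord i q w)
... | other m n rewrite ≡ᵇ-false m | ≡ᵇ-false n = pend-parWord i q w

-- From parentheses to columns

columnPairs : (ℕ → Bool) → ℕ → ℕ → List (ℕ × ℕ)
columnPairs c j L = concatMap (λ k → if c (suc k) then (suc k , j) ∷ [] else []) (downFrom L)

gridPairs : (ℕ → ℕ → Bool) → ℕ → ℕ → List (ℕ × ℕ)
gridPairs B L zero    = []
gridPairs B L (suc n) = gridPairs B L n ++ columnPairs (λ k → B k n) n L

columnPairs-letters : ∀ c j L → map proj₁ (columnPairs c j L) ≡ columnLetters c L
columnPairs-letters c j zero    = refl
columnPairs-letters c j (suc k) with c (suc k)
... | true  = cong (suc k ∷_) (columnPairs-letters c j k)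
... | false = columnPairs-letters c j k

cw-gridPairs : ∀ n rows → cw n rows ≡ gridPairs (ball rows) (length rows) n
cw-gridPairs n rows = trans (cong concat (map-upTo column n)) (go n)
  where
  column : ℕ → List (ℕ × ℕ)
  column j = columnPairs (λ k → ball rows k j) j (length rows)
  go : ∀ n → concat (applyUpTo column n) ≡ gridPairs (ball rows) (length rows) n
  go zero    = refl
  go (suc n) = trans (cong concat (sym (applyUpTo-∷ʳ column n))) (trans (concat-∷ʳ (applyUpTo column n) (column n)) (cong (_++ column n) (go n)))

lowered : ℕ → Bool → (ℕ → Bool) → ℕ → Bool
lowered i x c k = if k ≡ᵇ suc i then c k ∧ not x else (if k ≡ᵇ i then c k ∨ x else c k)

lowered-open : ∀ i x c → lowered i x c (suc i) ≡ c (suc i) ∧ not x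
lowered-open i x c rewrite ≡ᵇ-true (refl {x = i}) = refl

lowered-close : ∀ i x c → lowered i x c i ≡ c i ∨ x
lowered-close i x c rewrite ≡ᵇ-false (<⇒≢ (n<1+n i)) | ≡ᵇ-true (refl {x = i}) = refl

lowered-other : ∀ {i k} x c → k ≢ i → k ≢ suc i → lowered i x c k ≡ c k
lowered-other x c m n rewrite ≡ᵇ-false n | ≡ᵇ-false m = refl

columnLetters-cong : ∀ {c c′} L → (∀ k → 1 ≤ k → k ≤ L → c k ≡ c′ k) → columnLetters c L ≡ columnLetters c′ L
columnLetters-cong zero h = refl
columnLetters-cong {c} {c′} (suc k) h rewrite h (suc k) (s≤s z≤n) ≤-refl
  | columnLetters-cong {c} {c′} k (λ i p q → h i p (m≤n⇒m≤1+n q)) = refl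

gridWord-cong : ∀ {B B′ L} n → (∀ k j → 1 ≤ k → k ≤ L → j < n → B k j ≡ B′ k j) → gridWord B L n ≡ gridWord B′ L n
gridWord-cong zero h = refl
gridWord-cong {L = L} (suc n) h = cong₂ _++_ (gridWord-cong n (λ k j p q r → h k j p q (m<n⇒m<1+n r)))
  (columnLetters-cong L (λ k p q → h k n p q ≤-refl))

module _ (i : ℕ) (c : ℕ → Bool) where

  -- A ball of row i + 1 in this column is unmatched above, given q unmatched balls of row i to its right.
  drops : ℕ → Bool
  drops q = c (suc i) ∧ (not (c i) ∧ (q ≡ᵇ 0))

  raise-low : ∀ q L → L < i → pending i q (columnLetters c L) ≡ q × raise i q (columnLetters c L) ≡ columnLetters c L
  raise-low q zero    h = refl , refl
  raise-low q (suc k) h with c (suc k) | raise-low q k (<⇒≤ h)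
  ... | false | p , o = p , o
  ... | true  | p , o rewrite p | o =
    pendingStep-other (side i (suc k)) q (<⇒≢ h) (<⇒≢ (m<n⇒m<1+n h)) ,
    cong (_∷ columnLetters c k) (letterStep-other (side i (suc k)) q (<⇒≢ h) (<⇒≢ (m<n⇒m<1+n h)))

  parWord-low : ∀ j L → L < i → parWord i (columnPairs c j L) ≡ []
  parWord-low j zero    h = refl
  parWord-low j (suc k) h with c (suc k)
  ... | false = parWord-low j k (<⇒≤ h)
  ... | true rewrite ≡ᵇ-false (<⇒≢ (m<n⇒m<1+n h)) | ≡ᵇ-false (<⇒≢ h) = parWord-low j k (<⇒≤ h)

  letters-low : ∀ x L → L < i → columnLetters (lowered i x c) L ≡ columnLetters c L
  letters-low x L h = columnLetters-cong L (λ k _ q → lowered-other x c (<⇒≢ (≤-<-trans q h)) (<⇒≢ (m<n⇒m<1+n (≤-<-trans q h))))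

ColumnRaised : (i : ℕ) (c : ℕ → Bool) (q j L : ℕ) → Set
ColumnRaised i c q j L =
  raise i q (columnLetters c L) ≡ columnLetters (lowered i (drops i c q) c) L ×
  opens q (parWord i (columnPairs c j L)) ≡ (if drops i c q then j ∷ [] else [])

parWord-open : ∀ i j w → parWord i ((suc i , j) ∷ w) ≡ (true , j) ∷ parWord i w
parWord-open i j w rewrite ≡ᵇ-true (refl {x = i}) = refl

parWord-close : ∀ i j w → parWord i ((i , j) ∷ w) ≡ (false , j) ∷ parWord i w
parWord-close i j w rewrite ≡ᵇ-false (<⇒≢ (n<1+n i)) | ≡ᵇ-true (refl {x = i}) = refl

parWord-other : ∀ {i a} j w → a ≢ i → a ≢ suc i → parWord i ((a , j) ∷ w) ≡ parWord i w
parWord-other j w m n rewrite ≡ᵇ-false n | ≡ᵇ-false m = refl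

-- Within a column the letter of the upper row comes just before that of the lower row, so a ball
-- directly beneath always gives a match. Without one, the ball above can be matched only by one of
-- the `q` balls pending from the right.
column-top-raise : ∀ i c q → raise (suc i) q (columnLetters c (2 + i)) ≡ columnLetters (lowered (suc i) (drops (suc i) c q) c) (2 + i)
column-top-raise i c q
  rewrite lowered-open (suc i) (drops (suc i) c q) c | lowered-close (suc i) (drops (suc i) c q) c
        | letters-low (suc i) c (drops (suc i) c q) i ≤-refl
  with c (2 + i) | c (suc i)
... | false | false = proj₂ (raise-low (suc i) c q i ≤-refl)
... | false | true
  rewrite proj₁ (raise-low (suc i) c q i ≤-refl) | proj₂ (raise-low (suc i) c q i ≤-refl) =
  cong (_∷ columnLetters c i) (letterStep-close (side (suc i) (suc i)) q)
... | true  | true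
  rewrite proj₁ (raise-low (suc i) c q i ≤-refl) | proj₂ (raise-low (suc i) c q i ≤-refl)
        | pendingStep-close (side (suc i) (suc i)) q =
  cong₂ (λ x y → x ∷ y ∷ columnLetters c i) (letterStep-matched (side (suc i) (2 + i)) q) (letterStep-close (side (suc i) (suc i)) q)
column-top-raise i c zero | true | false
  rewrite proj₁ (raise-low (suc i) c 0 i ≤-refl) | proj₂ (raise-low (suc i) c 0 i ≤-refl) =
  cong (_∷ columnLetters c i) (letterStep-open (side (suc i) (2 + i)))
column-top-raise i c (suc q) | true | false
  rewrite proj₁ (raise-low (suc i) c (suc q) i ≤-refl) | proj₂ (raise-low (suc i) c (suc q) i ≤-refl) =
  cong (_∷ columnLetters c i) (letterStep-matched (side (suc i) (2 + i)) q)

column-top-opens : ∀ i c q j →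
  opens q (parWord (suc i) (columnPairs c j (2 + i))) ≡ (if drops (suc i) c q then j ∷ [] else [])
column-top-opens i c q j with c (2 + i) | c (suc i)
... | false | false = cong (opens q) low
  where low = parWord-low (suc i) c j i ≤-refl
... | false | true = cong (opens q) (trans (parWord-close (suc i) j (columnPairs c j i)) (cong (_ ∷_) (parWord-low (suc i) c j i ≤-refl)))
... | true  | true = cong (opens q) (trans (parWord-open (suc i) j ((suc i , j) ∷ columnPairs c j i))
  (cong ((true , j) ∷_) (trans (parWord-close (suc i) j (columnPairs c j i)) (cong (_ ∷_) (parWord-low (suc i) c j i ≤-refl)))))
... | true  | false = cong (opens q) (trans (parWord-open (suc i) j (columnPairs c j i)) (cong ((true , j) ∷_) (parWord-low (suc i) c j i ≤-refl)))

column-raised : ∀ i c q j L → 2 + i ≤ L → ColumnRaised (suc i) c q j L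
column-raised i c q j (suc L) h with m≤n⇒m<n∨m≡n h
... | inj₂ refl = column-top-raise i c q , column-top-opens i c q j
... | inj₁ h′ with column-raised i c q j L (s≤s⁻¹ h′)
...   | o , e rewrite lowered-other {suc i} {suc L} (drops (suc i) c q) c (>⇒≢ (<-trans (n<1+n (suc i)) h′)) (>⇒≢ h′)
  with c (suc L)
...     | false = o , e
...     | true =
  cong₂ _∷_ (letterStep-other (side (suc i) (suc L)) _ (>⇒≢ (<-trans (n<1+n (suc i)) h′)) (>⇒≢ h′)) o ,
  trans (cong (opens q) (parWord-other j (columnPairs c j L) (>⇒≢ (<-trans (n<1+n (suc i)) h′)) (>⇒≢ h′))) e

module _ (i L : ℕ) (i<L : 2 + i ≤ L) (B : ℕ → ℕ → Bool) where

  dropColumns : ℕ → ℕ → List ℕ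
  dropColumns q n = opens q (parWord (suc i) (gridPairs B L n))

  private
    next : ℕ → ℕ → ℕ
    next q n = pending (suc i) q (columnLetters (λ k → B k n) L)

  dropColumns-suc : ∀ q n → dropColumns q (suc n) ≡
    dropColumns (next q n) n ++ (if drops (suc i) (λ k → B k n) q then n ∷ [] else [])
  dropColumns-suc q n
    rewrite parWord-++ (suc i) (gridPairs B L n) (columnPairs (λ k → B k n) n L)
          | opens-++ q (parWord (suc i) (gridPairs B L n)) (parWord (suc i) (columnPairs (λ k → B k n) n L))
          | pend-parWord (suc i) q (columnPairs (λ k → B k n) n L) | columnPairs-letters (λ k → B k n) n L
          | proj₂ (column-raised i (λ k → B k n) q n L i<L) = refl

  dropColumns-< : ∀ q n → All (_< n) (dropColumns q n)
  dropColumns-< q zero    = []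
  dropColumns-< q (suc n) rewrite dropColumns-suc q n = ++⁺ (All.map m<n⇒m<1+n (dropColumns-< (next q n) n)) own
    where
    own : All (_< suc n) (if drops (suc i) (λ k → B k n) q then n ∷ [] else [])
    own with drops (suc i) (λ k → B k n) q
    ... | true  = ≤-refl ∷ []
    ... | false = []

  mem-dropColumns-old : ∀ q n j → j < n → memℕ j (dropColumns q (suc n)) ≡ memℕ j (dropColumns (next q n) n)
  mem-dropColumns-old q n j h rewrite dropColumns-suc q n
    | mem-++ j (dropColumns (next q n) n) (if drops (suc i) (λ k → B k n) q then n ∷ [] else [])
    with drops (suc i) (λ k → B k n) q
  ... | true rewrite ≡ᵇ-false (<⇒≢ h) = ∨-identityʳ _
  ... | false = ∨-identityʳ _

  mem-dropColumns-new : ∀ q n → memℕ n (dropColumns q (suc n)) ≡ drops (suc i) (λ k → B k n) q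
  mem-dropColumns-new q n rewrite dropColumns-suc q n
    | mem-++ n (dropColumns (next q n) n) (if drops (suc i) (λ k → B k n) q then n ∷ [] else [])
    | mem-none {n} (All.map >⇒≢ (dropColumns-< (next q n) n))
    with drops (suc i) (λ k → B k n) q
  ... | true rewrite ≡ᵇ-true (refl {x = n}) = refl
  ... | false = refl

  -- The induction peels off the last column, as the counter flows from right to left; the earlier
  -- columns start from the counter it leaves. `B′` is constrained only inside the grid, where the
  -- Boolean rows can be controlled.
  raise-gridWord : ∀ q n (B′ : ℕ → ℕ → Bool) →
    (∀ k j → 1 ≤ k → k ≤ L → j < n → B′ k j ≡ lowered (suc i) (memℕ j (dropColumns q n)) (λ k → B k j) k) →
    raise (suc i) q (gridWord B L n) ≡ gridWord B′ L n
  raise-gridWord q zero    B′ h = refl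
  raise-gridWord q (suc n) B′ h =
    trans (raise-++ (suc i) q (gridWord B L n) (columnLetters (λ k → B k n) L)) (cong₂ _++_
      (raise-gridWord (next q n) n B′ (λ k j p r j<n → trans (h k j p r (m<n⇒m<1+n j<n))
        (cong (λ x → lowered (suc i) x (λ k → B k j) k) (mem-dropColumns-old q n j j<n))))
      (trans (proj₁ (column-raised i (λ k → B k n) q n L i<L))
        (columnLetters-cong L (λ k p r → sym (trans (h k n p r ≤-refl)
          (cong (λ x → lowered (suc i) x (λ k → B k n) k) (mem-dropColumns-new q n)))))))

-- The operators on rows of Booleans

setFrom : Bool → List ℕ → ℕ → List Bool → List Bool
setFrom v cs j []       = []
setFrom v cs j (b ∷ bs) = (if memℕ j cs then v else b) ∷ setFrom v cs (suc j) bs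

-- As for removePair: the metavariable stands for the local loop of setCols.
mutual
  setCols-setFrom : ∀ v cs bs → setCols v cs bs ≡ setFrom v cs 0 bs
  setCols-setFrom v cs bs with 0
  ... | j = setCols-loop v cs j bs

  setCols-loop : ∀ v cs j bs → _ ≡ setFrom v cs j bs
  setCols-loop v cs j []       = refl
  setCols-loop v cs j (b ∷ bs) = cong ((if memℕ j cs then v else b) ∷_) (setCols-loop v cs (suc j) bs)

length-setFrom : ∀ v cs j bs → length (setFrom v cs j bs) ≡ length bs
length-setFrom v cs j []       = refl
length-setFrom v cs j (b ∷ bs) = cong suc (length-setFrom v cs (suc j) bs)

lookupB-setFrom : ∀ v cs j bs k → k < length bs → lookupB (setFrom v cs j bs) k ≡ (if memℕ (j + k) cs then v else lookupB bs k)
lookupB-setFrom v cs j (b ∷ bs) zero    h = cong (λ m → if memℕ m cs then v else b) (sym (+-identityʳ j))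
lookupB-setFrom v cs j (b ∷ bs) (suc k) h rewrite +-suc j k = lookupB-setFrom v cs (suc j) bs k (s≤s⁻¹ h)

length-setCols : ∀ v cs bs → length (setCols v cs bs) ≡ length bs
length-setCols v cs bs = trans (cong length (setCols-setFrom v cs bs)) (length-setFrom v cs 0 bs)

lookupB-setCols : ∀ v cs bs k → k < length bs → lookupB (setCols v cs bs) k ≡ (if memℕ k cs then v else lookupB bs k)
lookupB-setCols v cs bs k h = trans (cong (λ x → lookupB x k) (setCols-setFrom v cs bs)) (lookupB-setFrom v cs 0 bs k h)

lookupRow-updateAt : ∀ i f rows → i < length rows → lookupRow (updateAt i f rows) i ≡ f (lookupRow rows i)
lookupRow-updateAt zero    f (x ∷ rows) h = refl
lookupRow-updateAt (suc i) f (x ∷ rows) h = lookupRow-updateAt i f rows (s≤s⁻¹ h)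

lookupRow-updateAt-≢ : ∀ i f rows k → k ≢ i → lookupRow (updateAt i f rows) k ≡ lookupRow rows k
lookupRow-updateAt-≢ i       f []         k       h = refl
lookupRow-updateAt-≢ zero    f (x ∷ rows) zero    h = contradiction refl h
lookupRow-updateAt-≢ zero    f (x ∷ rows) (suc k) h = refl
lookupRow-updateAt-≢ (suc i) f (x ∷ rows) zero    h = refl
lookupRow-updateAt-≢ (suc i) f (x ∷ rows) (suc k) h = lookupRow-updateAt-≢ i f rows k (h ∘ cong suc)

Rectangle : ℕ → ℕ → Rows → Set
Rectangle L n rows = length rows ≡ L × All (λ bs → length bs ≡ n) rows

length-lookupRow : ∀ {n rows} r → All (λ bs → length bs ≡ n) rows → r < length rows → length (lookupRow rows r) ≡ n
length-lookupRow zero    (p ∷ ps) h = p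
length-lookupRow (suc r) (p ∷ ps) h = length-lookupRow r ps (s≤s⁻¹ h)

updateAt-rectangle : ∀ {L n} i f rows → (∀ bs → length (f bs) ≡ length bs) → Rectangle L n rows → Rectangle L n (updateAt i f rows)
updateAt-rectangle i f rows hf (refl , all) = len i rows , allLen i rows all
  where
  len : ∀ i rows → length (updateAt i f rows) ≡ length rows
  len i       []         = refl
  len zero    (x ∷ rows) = refl
  len (suc i) (x ∷ rows) = cong suc (len i rows)
  allLen : ∀ {n} i rows → All (λ bs → length bs ≡ n) rows → All (λ bs → length bs ≡ n) (updateAt i f rows)
  allLen i       []         []       = []
  allLen zero    (x ∷ rows) (p ∷ ps) = trans (hf x) p ∷ ps
  allLen (suc i) (x ∷ rows) (p ∷ ps) = p ∷ allLen i rows ps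

eStar-rectangle : ∀ {L n} i rows → Rectangle L n rows → Rectangle L n (eStar n i rows)
eStar-rectangle {n = n} i rows R = updateAt-rectangle i _ _ (length-setCols false cs)
  (updateAt-rectangle (pred i) _ rows (length-setCols true cs) R)
  where cs = unmatchedAbove n i rows

unmatchedAbove-opens : ∀ n i rows → unmatchedAbove n i rows ≡ opens 0 (parWord i (gridPairs (ball rows) (length rows) n))
unmatchedAbove-opens n i rows = trans (matchLoop-opens (length u) u ≤-refl) (cong (opens 0 ∘ parWord i) (cw-gridPairs n rows))
  where u = parWord i (cw n rows)

eStar-ball : ∀ {L n} i rows → Rectangle L n rows → 2 + i ≤ L → ∀ k j → 1 ≤ k → k ≤ L → j < n →
  ball (eStar n (suc i) rows) k j ≡ lowered (suc i) (memℕ j (unmatchedAbove n (suc i) rows)) (λ k → ball rows k j) k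
eStar-ball {L} {n} i rows (refl , all) i<L (suc k) j _ k≤L j<n with k ≟ suc i | k ≟ i
... | yes refl | _ = begin
  lookupB (lookupRow (updateAt (suc i) (setCols false cs) (updateAt i (setCols true cs) rows)) (suc i)) j
    ≡⟨ cong (λ x → lookupB x j) (lookupRow-updateAt (suc i) (setCols false cs) (updateAt i (setCols true cs) rows) (subst (suc i <_) (sym len) i<L)) ⟩
  lookupB (setCols false cs (lookupRow (updateAt i (setCols true cs) rows) (suc i))) j
    ≡⟨ cong (λ x → lookupB (setCols false cs x) j) (lookupRow-updateAt-≢ i _ rows (suc i) 1+n≢n) ⟩
  lookupB (setCols false cs (lookupRow rows (suc i))) j
    ≡⟨ lookupB-setCols false cs (lookupRow rows (suc i)) j (subst (j <_) (sym (length-lookupRow (suc i) all i<L)) j<n) ⟩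
  (if memℕ j cs then false else ball rows (2 + i) j)
    ≡⟨ if-∧ (memℕ j cs) (ball rows (2 + i) j) ⟩
  ball rows (2 + i) j ∧ not (memℕ j cs)
    ≡⟨ lowered-open (suc i) (memℕ j cs) (λ k → ball rows k j) ⟨
  lowered (suc i) (memℕ j cs) (λ k → ball rows k j) (2 + i) ∎
  where
  open ≡-Reasoning
  cs = unmatchedAbove n (suc i) rows
  len = proj₁ (updateAt-rectangle i (setCols true cs) rows (length-setCols true cs) (refl , all))
  if-∧ : ∀ x y → (if x then false else y) ≡ y ∧ not x
  if-∧ true  y = sym (∧-zeroʳ y)
  if-∧ false y = sym (∧-identityʳ y)
... | no k≢ | yes refl = begin
  lookupB (lookupRow (updateAt (suc i) (setCols false cs) (updateAt i (setCols true cs) rows)) i) j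
    ≡⟨ cong (λ x → lookupB x j) (lookupRow-updateAt-≢ (suc i) _ (updateAt i (setCols true cs) rows) i k≢) ⟩
  lookupB (lookupRow (updateAt i (setCols true cs) rows) i) j
    ≡⟨ cong (λ x → lookupB x j) (lookupRow-updateAt i _ rows k≤L) ⟩
  lookupB (setCols true cs (lookupRow rows i)) j
    ≡⟨ lookupB-setCols true cs (lookupRow rows i) j (subst (j <_) (sym (length-lookupRow i all k≤L)) j<n) ⟩
  (if memℕ j cs then true else ball rows (suc i) j)
    ≡⟨ if-∨ (memℕ j cs) (ball rows (suc i) j) ⟩
  ball rows (suc i) j ∨ memℕ j cs
    ≡⟨ lowered-close (suc i) (memℕ j cs) (λ k → ball rows k j) ⟨
  lowered (suc i) (memℕ j cs) (λ k → ball rows k j) (suc i) ∎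
  where
  open ≡-Reasoning
  cs = unmatchedAbove n (suc i) rows
  if-∨ : ∀ x y → (if x then true else y) ≡ y ∨ x
  if-∨ true  y = sym (∨-zeroʳ y)
  if-∨ false y = sym (∨-identityʳ y)
... | no k≢1+i | no k≢i = begin
  lookupB (lookupRow (updateAt (suc i) (setCols false cs) (updateAt i (setCols true cs) rows)) k) j
    ≡⟨ cong (λ x → lookupB x j) (trans (lookupRow-updateAt-≢ (suc i) _ (updateAt i (setCols true cs) rows) k k≢1+i) (lookupRow-updateAt-≢ i _ rows k k≢i)) ⟩
  ball rows (suc k) j
    ≡⟨ lowered-other (memℕ j cs) (λ k → ball rows k j) (k≢i ∘ suc-injective) (k≢1+i ∘ suc-injective) ⟨
  lowered (suc i) (memℕ j cs) (λ k → ball rows k j) (suc k) ∎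
  where
  open ≡-Reasoning
  cs = unmatchedAbove n (suc i) rows

rowsWord : ℕ → ℕ → Rows → List ℕ
rowsWord L n rows = gridWord (ball rows) L n

eStar-raise : ∀ {L n} i rows → Rectangle L n rows → 2 + i ≤ L →
  rowsWord L n (eStar n (suc i) rows) ≡ raise (suc i) 0 (rowsWord L n rows)
eStar-raise {L} {n} i rows R@(refl , _) i<L = sym (raise-gridWord i L i<L (ball rows) 0 n (ball (eStar n (suc i) rows))
  (λ k j p q r → trans (eStar-ball i rows R i<L k j p q r)
    (cong (λ cs → lowered (suc i) (memℕ j cs) (λ k → ball rows k j) k) (unmatchedAbove-opens n (suc i) rows))))

eInt-raise : ∀ {L n} m rows → Rectangle L n rows → suc m ≤ L →
  Rectangle L n (eInt n m rows) × rowsWord L n (eInt n m rows) ≡ raiseDown m (rowsWord L n rows)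
eInt-raise zero    rows R h = R , refl
eInt-raise {L} {n} (suc m) rows R h with eInt-raise m (eStar n (suc m) rows) (eStar-rectangle (suc m) rows R) (<⇒≤ h)
... | R′ , e = R′ , trans e (cong (raiseDown m) (eStar-raise m rows R h))

collapse-stage : ∀ {L n} k rows → Rectangle L n rows → k ≤ L →
  Rectangle L n (collapseStage n k rows) × rowsWord L n (collapseStage n k rows) ≡ stage k (rowsWord L n rows)
collapse-stage zero          rows R h = R , refl
collapse-stage (suc zero)    rows R h = R , refl
collapse-stage {L} {n} (suc (suc k)) rows R h with collapse-stage (suc k) rows R (<⇒≤ h)
... | R₁ , e₁ with eInt-raise (suc k) (collapseStage n (suc k) rows) R₁ h
...   | R₂ , e₂ = R₂ , trans e₂ (cong (raiseDown (suc k)) e₁)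

-- Row sizes as letter counts

columnSum : (ℕ → Bool) → ℕ → ℕ
columnSum f zero    = 0
columnSum f (suc n) = columnSum f n + bit (f n)

columnSum-∷ : ∀ f n → columnSum f (suc n) ≡ bit (f 0) + columnSum (f ∘ suc) n
columnSum-∷ f zero    = +-comm 0 (bit (f 0))
columnSum-∷ f (suc n) = trans (cong (_+ bit (f (suc n))) (columnSum-∷ f n)) (+-assoc (bit (f 0)) _ _)

columnSum-cong : ∀ {f g} n → (∀ j → f j ≡ g j) → columnSum f n ≡ columnSum g n
columnSum-cong zero    h = refl
columnSum-cong (suc n) h = cong₂ _+_ (columnSum-cong n h) (cong bit (h n))

columnSum-countᵇ : ∀ bs → columnSum (lookupB bs) (length bs) ≡ countᵇ (λ b → b) bs
columnSum-countᵇ []       = refl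
columnSum-countᵇ (b ∷ bs) = trans (columnSum-∷ (lookupB (b ∷ bs)) (length bs)) (cong₂ _+_ (bit-if b) (columnSum-countᵇ bs))
  where
  bit-if : ∀ b → bit b ≡ (if b then 1 else 0)
  bit-if true  = refl
  bit-if false = refl

length-posFrom : ∀ i bs → length (posFrom i bs) ≡ countᵇ (λ b → b) bs
length-posFrom i []           = refl
length-posFrom i (true ∷ bs)  = cong suc (length-posFrom (suc i) bs)
length-posFrom i (false ∷ bs) = length-posFrom (suc i) bs

columnLetters-≤ : ∀ c L → All (λ a → 1 ≤ a × a ≤ L) (columnLetters c L)
columnLetters-≤ c zero = []
columnLetters-≤ c (suc k) with c (suc k) | All.map (λ (p , q) → p , m≤n⇒m≤1+n q) (columnLetters-≤ c k)
... | true  | h = (s≤s z≤n , ≤-refl) ∷ h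
... | false | h = h

gridWord-≤ : ∀ B L n → All (λ a → 1 ≤ a × a ≤ L) (gridWord B L n)
gridWord-≤ B L zero    = []
gridWord-≤ B L (suc n) = ++⁺ (gridWord-≤ B L n) (columnLetters-≤ (λ k → B k n) L)

occ-columnLetters : ∀ {c r} L → 1 ≤ r → r ≤ L → occ r (columnLetters c L) ≡ bit (c r)
occ-columnLetters {c} {r} zero p q = contradiction (≤-trans p q) λ ()
occ-columnLetters {c} {r} (suc L) p q with m≤n⇒m<n∨m≡n q
... | inj₂ refl with c (suc L)
...   | true rewrite ≡ᵇ-true (refl {x = L}) = cong suc (occ-none (All.map (λ (_ , h) → <⇒≢ (s≤s h)) (columnLetters-≤ c L)))
...   | false = occ-none (All.map (λ (_ , h) → <⇒≢ (s≤s h)) (columnLetters-≤ c L))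
occ-columnLetters {c} {r} (suc L) p q | inj₁ q′ with c (suc L)
... | true rewrite ≡ᵇ-false (>⇒≢ q′) = occ-columnLetters L p (s≤s⁻¹ q′)
... | false = occ-columnLetters L p (s≤s⁻¹ q′)

occ-gridWord : ∀ {B L r} n → 1 ≤ r → r ≤ L → occ r (gridWord B L n) ≡ columnSum (B r) n
occ-gridWord zero p q = refl
occ-gridWord {B} {L} {r} (suc n) p q = trans (occ-++ r (gridWord B L n) _) (cong₂ _+_ (occ-gridWord n p q) (occ-columnLetters L p q))

cnt-stage : ∀ {L n} rows → Rectangle L n rows → ∀ k r → k ≤ L → 1 ≤ r →
  cnt n rows k r ≡ (if r ≤ᵇ k then occ r (stage k (rowsWord L n rows)) else 0)
cnt-stage {L} {n} rows R k (suc r) k≤L _ with suc r ≤? k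
... | no p rewrite ≤ᵇ-false (≰⇒> p) = refl
... | yes p rewrite ≤ᵇ-true p with collapse-stage k rows R k≤L
...   | (len , all) , e = begin
  countᵇ (λ b → b) (lookupRow (collapseStage n k rows) r)
    ≡⟨ columnSum-countᵇ (lookupRow (collapseStage n k rows) r) ⟨
  columnSum (ball (collapseStage n k rows) (suc r)) (length (lookupRow (collapseStage n k rows) r))
    ≡⟨ cong (columnSum _) (length-lookupRow r all (subst (r <_) (sym len) (≤-trans p k≤L))) ⟩
  columnSum (ball (collapseStage n k rows) (suc r)) n
    ≡⟨ occ-gridWord n (s≤s z≤n) (≤-trans p k≤L) ⟨
  occ (suc r) (rowsWord L n (collapseStage n k rows))
    ≡⟨ cong (occ (suc r)) e ⟩
  occ (suc r) (stage k (rowsWord L n rows)) ∎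
  where open ≡-Reasoning

rowsWord-recorded : ∀ {L n} rows → Rectangle L n rows → rowsWord L n rows ~ readingWord (recRows n rows)
rowsWord-recorded {L} {n} rows R@(refl , _) = readingWord-recorded (cnt n rows)
  (All.map proj₁ (gridWord-≤ (ball rows) L n)) (All.map proj₂ (gridWord-≤ (ball rows) L n)) (cnt-stage rows R)

-- The two statistics agree

idx : ℕ → List ℕ → IWord
idx i []      = []
idx i (a ∷ w) = (i , a) ∷ idx (suc i) w

mutual
  -- The local loop of `indexWord` is reached as for `setCols`: once 0 is abstracted, it solves the
  -- metavariable in the statement of `indexWord-loop`.
  indexWord-idx : ∀ w → indexWord w ≡ idx 0 w
  indexWord-idx w with 0
  ... | i = indexWord-loop i w

  indexWord-loop : ∀ i w → _ ≡ idx i w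
  indexWord-loop i []      = refl
  indexWord-loop i (a ∷ w) = cong ((i , a) ∷_) (indexWord-loop (suc i) w)

letters-idx : ∀ i w → letters (idx i w) ≡ w
letters-idx i []      = refl
letters-idx i (a ∷ w) = cong (a ∷_) (letters-idx (suc i) w)

length-idx : ∀ i w → length (idx i w) ≡ length w
length-idx i []      = refl
length-idx i (a ∷ w) = cong suc (length-idx (suc i) w)

idx-≥ : ∀ i w → All (λ x → i ≤ proj₁ x) (idx i w)
idx-≥ i []      = []
idx-≥ i (a ∷ w) = ≤-refl ∷ All.map <⇒≤ (idx-≥ (suc i) w)

idx-< : ∀ i w → All (λ x → proj₁ x < i + length w) (idx i w)
idx-< i []      = []
idx-< i (a ∷ w) rewrite +-suc i (length w) = s≤s (m≤m+n i (length w)) ∷ idx-< (suc i) w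

idx-positioned : ∀ i w → Positioned (idx i w)
idx-positioned i []      = []
idx-positioned i (a ∷ w) = idx-≥ (suc i) w ∷ idx-positioned (suc i) w

idx-All : ∀ {P : ℕ → Set} i {w} → All P w → All (λ x → P (proj₂ x)) (idx i w)
idx-All i []       = []
idx-All i (p ∷ ps) = p ∷ idx-All (suc i) ps

gridWord-∷ : ∀ B L n → gridWord B L (suc n) ≡ columnLetters (λ k → B k 0) L ++ gridWord (λ k j → B k (suc j)) L n
gridWord-∷ B L zero    = sym (++-identityʳ _)
gridWord-∷ B L (suc n) = trans (cong (_++ columnLetters (λ k → B k (suc n)) L) (gridWord-∷ B L n))
  (++-assoc (columnLetters (λ k → B k 0) L) _ _)

columnLetters-none : ∀ c L → (∀ k → k ≤ L → c k ≡ false) → columnLetters c L ≡ []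
columnLetters-none c zero    h = refl
columnLetters-none c (suc k) h rewrite h (suc k) ≤-refl = columnLetters-none c k (λ i p → h i (m≤n⇒m≤1+n p))

columnLetters-single : ∀ {c a} L → 1 ≤ a → a ≤ L → (∀ k → c k ≡ (a ≡ᵇ k)) → columnLetters c L ≡ [ a ]
columnLetters-single zero p q h = contradiction (≤-trans p q) λ ()
columnLetters-single {c} {a} (suc L) p q h rewrite h (suc L) with m≤n⇒m<n∨m≡n q
... | inj₂ refl rewrite ≡ᵇ-true (refl {x = L}) = cong (suc L ∷_) (columnLetters-none c L (λ k k≤L → trans (h k) (≡ᵇ-false (>⇒≢ (s≤s k≤L)))))
... | inj₁ q′ rewrite ≡ᵇ-false (<⇒≢ q′) = columnLetters-single L p (s≤s⁻¹ q′) h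

-- Each position is a column with a single ball, in the row named by its letter; `i` is the offset
-- of the remaining columns.
gridWord-idx : ∀ {L} i w → All (λ a → 1 ≤ a × a ≤ L) w → gridWord (λ k j → wordB (idx i w) k (i + j)) L (length w) ≡ w
gridWord-idx i [] [] = refl
gridWord-idx {L} i (a ∷ w) ((p , q) ∷ h) = trans (gridWord-∷ (λ k j → wordB (idx i (a ∷ w)) k (i + j)) L (length w))
  (cong₂ _++_ (columnLetters-single L p q first)
    (trans (gridWord-cong (length w) (λ k j _ _ _ → later k j)) (gridWord-idx (suc i) w h)))
  where
  first : ∀ k → wordB (idx i (a ∷ w)) k (i + 0) ≡ (a ≡ᵇ k)
  first k rewrite +-identityʳ i | ≡ᵇ-true (refl {x = i})
    | wordB-none {idx (suc i) w} {k} {i} (All.map (λ h e _ → <-irrefl (sym e) h) (idx-≥ (suc i) w)) =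
    trans (∨-identityʳ _) (∧-identityʳ (a ≡ᵇ k))
  later : ∀ k j → wordB (idx i (a ∷ w)) k (i + suc j) ≡ wordB (idx (suc i) w) k (suc i + j)
  later k j rewrite ≡ᵇ-false {i + suc j} {i} (λ e → m≢1+m+n i (trans (sym e) (+-suc i j))) | ∧-zeroʳ (a ≡ᵇ k) | +-suc i j = refl

rowsOf-snoc : ∀ {B B′ n m rs bs} → RowsOf B′ n m rs → length bs ≡ n → (∀ j → lookupB bs j ≡ B 1 j) →
  (∀ r j → B′ (suc r) j ≡ B (2 + r) j) → RowsOf B n (suc m) (rs ++ [ bs ])
rowsOf-snoc []                l h s = row l h []
rowsOf-snoc (row l′ h′ ro) l h s = row l′ (λ j → trans (h′ j) (s _ j)) (rowsOf-snoc ro l h s)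

rowsOf-reverse : ∀ {n} rows → All (λ bs → length bs ≡ n) rows → RowsOf (ball rows) n (length rows) (reverse rows)
rowsOf-reverse [] [] = []
rowsOf-reverse {n} (bs ∷ rows) (l ∷ ls) = subst (RowsOf (ball (bs ∷ rows)) n (suc (length rows))) (sym (unfold-reverse bs rows))
  (rowsOf-snoc (rowsOf-reverse rows ls) l (λ _ → refl) (λ _ _ → refl))

rowsOf-sizes : ∀ {B n m rs} → RowsOf B n m rs → (∀ r → columnSum (B (2 + r)) n ≤ columnSum (B (suc r)) n) →
  Linked (λ bs bs′ → length (positions bs) ≤ length (positions bs′)) rs
rowsOf-sizes []                     h = []
rowsOf-sizes (row _ _ [])           h = [-]
rowsOf-sizes {B} {n} (row {bs = bs} l e ro@(row {r} {bs = bs′} l′ e′ _)) h =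
  subst₂ _≤_ (sym (size bs l e)) (sym (size bs′ l′ e′)) (h r) ∷ rowsOf-sizes ro h
  where
  size : ∀ {k} bs → length bs ≡ n → (∀ j → lookupB bs j ≡ B k j) → length (positions bs) ≡ columnSum (B k) n
  size bs refl e = trans (length-posFrom 0 bs) (trans (sym (columnSum-countᵇ bs)) (columnSum-cong (length bs) e))

majRows-charge : ∀ n rows → All (λ bs → length bs ≡ n) rows →
  (∀ r → columnSum (ball rows (2 + r)) n ≤ columnSum (ball rows (suc r)) n) →
  majRows rows ≡ chargeTableau (recRows n rows)
majRows-charge n [] _ _ = refl
majRows-charge n rows@(bs ∷ rows₀) all anti = begin
  majRows rows                        ≡⟨ proj₁ (proj₂ M) ⟩
  sumTo L (proj₁ M)                   ≡⟨ sumTo-cong L same ⟩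
  sumTo L (proj₁ C)                   ≡⟨ proj₁ (proj₂ C) ⟨
  chargeGo (length W) (idx 0 W)       ≡⟨ cong (chargeGo (length W)) (indexWord-idx W) ⟨
  chargeTableau (recRows n rows)      ∎
  where
  open ≡-Reasoning
  L = length rows
  B = ball rows
  W = readingWord (recRows n rows)
  W~ : gridWord B L n ~ W
  W~ = rowsWord-recorded rows (refl , all)
  W-letters : All (λ a → 1 ≤ a × a ≤ L) W
  W-letters = proj₁ (All-~ W~) (gridWord-≤ B L n)
  rowsOf = rowsOf-reverse rows all
  M = majGo-spec L (length rows₀) (reverse rows) [] rowsOf ≤-refl (rowsOf-sizes rowsOf anti) [] [] []
  -- Letter counts are plactic invariants, so the reading word inherits the row sizes of the queue,
  -- which decrease weakly upwards.
  content : PartitionContent (idx 0 W)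
  content k 1≤k rewrite letters-idx 0 W | sym (occ-~ k W~) | sym (occ-~ (suc k) W~) with suc k ≤? L
  content (suc k) 1≤k | yes p rewrite occ-gridWord {B} {L} n (s≤s (z≤n {suc k})) p | occ-gridWord {B} {L} n 1≤k (<⇒≤ p) = anti k
  content k 1≤k | no p =
    ≤-trans (≤-reflexive (occ-none (All.map (λ (_ , h) → <⇒≢ (≤-<-trans h (≰⇒> p))) (gridWord-≤ B L n)))) z≤n
  C = chargeGo-spec {length W} {L} (length W) (idx 0 W) (idx-positioned 0 W) (idx-< 0 W) (idx-All 0 W-letters) content
    (≤-reflexive (length-idx 0 W))
  words : gridWord B L n ~ gridWord (wordB (idx 0 W)) L (length W)
  words = ~trans W~ (~reflexive (sym (gridWord-idx 0 W W-letters)))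
  same : ∀ t → 1 ≤ t → t ≤ L → proj₁ M t ≡ proj₁ C t
  same (suc t) _ h = wraps-~ words h (proj₂ (proj₂ (proj₂ M)) t (s≤s⁻¹ h)) (proj₂ (proj₂ C) t h)

subset-size : ∀ {n} (S : Subset n) → countᵇ (λ b → b) (Vec.toList S) ≡ ∣ S ∣
subset-size []          = refl
subset-size (true ∷ S)  = cong suc (subset-size S)
subset-size (false ∷ S) = subset-size S

toRows-lengths : ∀ {L n} (M : MLQConfig L n) → All (λ bs → length bs ≡ n) (toRows M)
toRows-lengths []      = []
toRows-lengths (S ∷ M) = length-toList S ∷ toRows-lengths M

conj-antitone : ∀ p r → conj p (suc r) ≤ conj p r
conj-antitone []      r = z≤n
conj-antitone (x ∷ p) r = +-mono-≤ dec (conj-antitone p r)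
  where
  dec : (if suc r ≤ᵇ x then 1 else 0) ≤ (if r ≤ᵇ x then 1 else 0)
  dec with suc r ≤? x
  ... | yes h rewrite ≤ᵇ-true h | ≤ᵇ-true (<⇒≤ h) = ≤-refl
  ... | no  h rewrite ≤ᵇ-false (≰⇒> h) = z≤n

columnSum-none : ∀ n → columnSum (λ _ → false) n ≡ 0
columnSum-none zero    = refl
columnSum-none (suc n) = trans (+-identityʳ _) (columnSum-none n)

toRows-size : ∀ {L n} (M : MLQConfig L n) (f : ℕ → ℕ) → (∀ r → ∣ Vec.lookup M r ∣ ≡ f (toℕ r)) →
  ∀ r → r < L → columnSum (ball (toRows M) (suc r)) n ≡ f r
toRows-size {n = n} (S ∷ M) f h zero _ = trans (cong (columnSum (lookupB (Vec.toList S))) (sym (length-toList S)))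
  (trans (columnSum-countᵇ (Vec.toList S)) (trans (subset-size S) (h zero)))
toRows-size (S ∷ M) f h (suc r) p = toRows-size M (f ∘ suc) (h ∘ suc) r (s≤s⁻¹ p)

toRows-outside : ∀ {L n} (M : MLQConfig L n) r → L ≤ r → columnSum (ball (toRows M) (suc r)) n ≡ 0
toRows-outside {n = n} []      r       _ = columnSum-none n
toRows-outside         (S ∷ M) (suc r) h = toRows-outside M r (s≤s⁻¹ h)

theorem4p9 : (p : List ℕ) → IsPartition p → (n : ℕ) →
    (M : MLQConfig (largestPart p) n) → IsMLQ p n M →
    maj M ≡ chargeTableau (ρQ M)
theorem4p9 p _ n M isMLQ = majRows-charge n (toRows M) (toRows-lengths M) anti
  where
  -- Rows within the queue have the sizes of the conjugate partition; a row beyond the top is empty.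
  anti : ∀ r → columnSum (ball (toRows M) (2 + r)) n ≤ columnSum (ball (toRows M) (suc r)) n
  anti r with suc r <? largestPart p
  ... | yes h rewrite toRows-size M (conj p ∘ suc) isMLQ (suc r) h | toRows-size M (conj p ∘ suc) isMLQ r (<⇒≤ h) = conj-antitone p (suc r)
  ... | no h rewrite toRows-outside M (suc r) (≮⇒≥ h) = z≤n
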